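{- Let $G$ be a connected vertex transitive graph with two ends. Then there exist positive integers $s,t$ and a cyclic system $\vec{\sigma}$ such that $G$ is $(s,t)$-ring-like and $2st$-cohesive with respect to $\vec{\sigma}$, and $\kappa_{\infty}(G) = st$.
   Context: Graphs are simple, undirected, locally finite. A ray is a one-way-infinite path; two rays are equivalent if for every finite vertex set $X$, the component of $G\setminus X$ containing infinitely many vertices of one also contains infinitely many vertices of the other; ends are the equivalence classes. $\kappa_\infty(G)=\inf\{|S|: S\subseteq V(G),\ G\setminus S \text{ has at least two infinite components}\}$. A system of imprimitivity is a partition of $V(G)$ into blocks permuted by every automorphism. A cyclic order on a set is a symmetric relation whose graph is a cycle or a two-way-infinite path. A cyclic system $\vec\sigma$ is a system of imprimitivity with a cyclic order on its blocks preserved by all automorphisms of $G$. For positive integers $s,t$, $G$ is $(s,t)$-ring-like with respect to $\vec\sigma$ if every block has size $s$ and adjacent vertices lie in blocks at cyclic-order distance at most $t$. $G$ is $q$-cohesive with respect to $\vec\sigma$ if any two vertices lying in the same block or in adjacent blocks (in the cyclic order) are joined by a path of length at most $q$. -}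

module Defs where

open import Level using (0ℓ)
open import Data.Nat using (ℕ; zero; suc; _≤_; _*_)
open import Data.Integer as ℤ using (ℤ)
open import Data.Fin as Fin using (Fin)
open import Data.List using (List; length)
open import Data.List.Membership.Propositional using (_∈_; _∉_)
open import Data.List.Relation.Unary.Unique.Propositional using (Unique)
open import Data.Product using (Σ; ∃; ∃-syntax; _×_; _,_)
open import Data.Sum using (_⊎_)
open import Function using (_∘_)
open import Function.Bundles using (_↔_; _⇔_; Inverse)
open import Relation.Nullary using (¬_)
open import Relation.Binary.PropositionalEquality using (_≡_; _≢_)

record Graph : Set₁ where
  field
    V    : Set
    E    : V → V → Set
    irr  : ∀ v → ¬ E v v
    sym  : ∀ {u v} → E u v → E v u

open Graph public

LocallyFinite : Graph → Set
LocallyFinite G = ∀ v → ∃[ L ] (∀ w → E G v w → w ∈ L)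

data Walk {A : Set} (R : A → A → Set) : A → A → ℕ → Set where
  here : ∀ {a} → Walk R a a zero
  step : ∀ {a b c n} → R a b → Walk R b c n → Walk R a c (suc n)

-- "joined by a path of length at most q" (a shortest walk is a path)
Within : {A : Set} → (A → A → Set) → ℕ → A → A → Set
Within R q a b = ∃[ n ] (n ≤ q × Walk R a b n)

Connected : Graph → Set
Connected G = ∀ u v → ∃[ n ] Walk (E G) u v n

EAvoid : (G : Graph) → List (V G) → V G → V G → Set
EAvoid G X u w = u ∉ X × w ∉ X × E G u w

ConnAvoid : (G : Graph) → List (V G) → V G → V G → Set
ConnAvoid G X u w = u ∉ X × w ∉ X × ∃[ n ] Walk (EAvoid G X) u w n

record Aut (G : Graph) : Set where
  field
    bij  : V G ↔ V G
    pres : ∀ u v → E G u v ⇔ E G (Inverse.to bij u) (Inverse.to bij v)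

open Aut public

app : {G : Graph} → Aut G → V G → V G
app f = Inverse.to (bij f)

VertexTransitive : Graph → Set
VertexTransitive G = ∀ u v → Σ (Aut G) λ f → app f u ≡ v

record Ray (G : Graph) : Set where
  field
    r    : ℕ → V G
    inj  : ∀ i j → r i ≡ r j → i ≡ j
    adj  : ∀ i → E G (r i) (r (suc i))

open Ray public

InfManyIn : (G : Graph) → List (V G) → V G → Ray G → Set
InfManyIn G X v ρ = ∀ n → ∃[ i ] (n ≤ i × ConnAvoid G X v (r ρ i))

EquivRay : (G : Graph) → Ray G → Ray G → Set
EquivRay G ρ₁ ρ₂ = ∀ (X : List (V G)) (v : V G) →
  (InfManyIn G X v ρ₁ → InfManyIn G X v ρ₂) ×
  (InfManyIn G X v ρ₂ → InfManyIn G X v ρ₁)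

TwoEnded : Graph → Set
TwoEnded G = Σ (Ray G) λ ρ₁ → Σ (Ray G) λ ρ₂ →
  ¬ EquivRay G ρ₁ ρ₂ × (∀ ρ → EquivRay G ρ ρ₁ ⊎ EquivRay G ρ ρ₂)

InfiniteComponent : (G : Graph) → List (V G) → V G → Set
InfiniteComponent G S v =
  v ∉ S × ¬ (∃[ L ] (∀ w → ConnAvoid G S v w → w ∈ L))

Separates : (G : Graph) → List (V G) → Set
Separates G S = ∃[ u ] ∃[ v ]
  (InfiniteComponent G S u × InfiniteComponent G S v × ¬ ConnAvoid G S u v)

-- κ∞(G) = k  (infimum over vertex sets S; sets are duplicate-free lists,
-- infinite S never attain a finite infimum)
KappaInfEq : Graph → ℕ → Set
KappaInfEq G k =
  (∃[ S ] (Unique S × length S ≡ k × Separates G S)) ×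
  (∀ S → Unique S → Separates G S → k ≤ length S)

-- the graph of R on B is a cycle (n ≥ 3 vertices) or a two-way infinite path
IsCyclicOrder : (B : Set) → (B → B → Set) → Set
IsCyclicOrder B R =
  (∃[ n ] (3 ≤ n × Σ (B ↔ Fin n) λ φ →
     ∀ a b → R a b ⇔
       (Fin.toℕ (Inverse.to φ b) ≡ suc (Fin.toℕ (Inverse.to φ a))
        ⊎ Fin.toℕ (Inverse.to φ a) ≡ suc (Fin.toℕ (Inverse.to φ b))
        ⊎ (suc (Fin.toℕ (Inverse.to φ a)) ≡ n × Fin.toℕ (Inverse.to φ b) ≡ 0)
        ⊎ (suc (Fin.toℕ (Inverse.to φ b)) ≡ n × Fin.toℕ (Inverse.to φ a) ≡ 0))))
  ⊎
  (Σ (B ↔ ℤ) λ φ → ∀ a b → R a b ⇔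
       (Inverse.to φ b ≡ Inverse.to φ a ℤ.+ ℤ.1ℤ
        ⊎ Inverse.to φ a ≡ Inverse.to φ b ℤ.+ ℤ.1ℤ))

-- A cyclic system: partition of V G into blocks (fibres of the surjection
-- `block` onto the block type B), permuted by every automorphism, with a
-- cyclic order on the blocks preserved by every automorphism.
record CyclicSystem (G : Graph) : Set₁ where
  field
    B      : Set
    block  : V G → B
    surj   : ∀ b → ∃[ v ] block v ≡ b
    R      : B → B → Set
    cyc    : IsCyclicOrder B R
    imprim : ∀ (f : Aut G) u v → block u ≡ block v →
               block (app f u) ≡ block (app f v)
    presR  : ∀ (f : Aut G) u v →
               R (block u) (block v) ⇔ R (block (app f u)) (block (app f v))

open CyclicSystem public

RingLike : (G : Graph) → CyclicSystem G → ℕ → ℕ → Set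
RingLike G σ s t =
  (∀ b → ∃[ L ] (Unique L × length L ≡ s × (∀ v → (v ∈ L ⇔ block σ v ≡ b)))) ×
  (∀ u v → E G u v → Within (R σ) t (block σ u) (block σ v))

Cohesive : (G : Graph) → CyclicSystem G → ℕ → Set
Cohesive G σ q = ∀ u v →
  (block σ u ≡ block σ v ⊎ R σ (block σ u) (block σ v)) →
  Within (E G) q u v

{-# OPTIONS --safe #-}

-- Fix a finite cut separating the two ends, let C be its side, and let Γ⁺ be the group of
-- automorphisms fixing both ends.  Then g ↦ |g⁻¹C ∖ C| − |C ∖ g⁻¹C| is a homomorphism Γ⁺ → ℤ,
-- negated by conjugation with an automorphism that exchanges the ends.  Its kernel contains the vertex
-- stabilisers and moves every vertex in a finite orbit only: an element of Γ⁺ that moves a large ball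
-- off itself nests the two cuts strictly and so has non-zero translation length.  Hence, after
-- division by the least positive translation length, there is a height V → ℤ along which Γ⁺
-- translates and the end-exchanging automorphisms reflect.  It is unique up to its relative offset
-- on the at most two Γ⁺-orbits; this offset is chosen so that the largest rise t along an edge is
-- attained at every vertex, by edges that all stay in their orbit or by edges that all change it.
-- The blocks are the levels of the height, and s is their size.
--
-- κ∞ = s t: any t consecutive levels separate.  Conversely the rising edges form biregular graphs
-- between levels, so going up along them does not shrink a finite set; applied to the top of the
-- lower component of G ∖ S this gives |S| ≥ s t.
--
-- Cohesion: if some edge x — y inside an orbit changes the height, then every vertex v is adjacent
-- to a translate g v with shift δ ≤ t.  Modulo ⟨g⟩ there are s δ vertices, so some gᵏ v is reached in
-- s δ − 1 steps, and |k| ≤ s t further steps lead back to v.  Otherwise edges inside an orbit are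
-- horizontal.  Then g is taken with shift 2t along v — v⁺ — g v, and each change of orbit in the
-- search modulo ⟨g⟩ discovers at least a whole new class of the horizontal connectivity relation,
-- because the bipartite graph of orbit-changing edges is regular; so one of the ⟨g⟩-orbits of v
-- and v⁺ is reached in s t − 1 steps.
module Submission where

open import Defs renaming (sym to E-sym)
open import Level using (0ℓ)
open import Axiom.ExcludedMiddle using (ExcludedMiddle)
open import Data.Empty using (⊥; ⊥-elim)
open import Data.Integer as ℤ using (ℤ; +_; -[1+_]; 0ℤ; 1ℤ; ∣_∣)
import Data.Integer.DivMod as ℤ
import Data.Integer.Properties as ℤ
open import Data.Integer.Tactic.RingSolver using (solve-∀)
open import Data.List using (List; []; _∷_; _++_; length; map; concatMap; filter; deduplicate)
open import Data.List.Membership.Propositional using (_∈_; _∉_)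
open import Data.List.Membership.Propositional.Properties
  using (∈-filter⁺; ∈-filter⁻; ∈-deduplicate⁺; ∈-deduplicate⁻; ∈-∃++; ∈-++⁻; ∈-++⁺ˡ; ∈-++⁺ʳ; ∈-map⁺; ∈-map⁻)
open import Data.List.Properties using (length-++; length-map)
open import Data.List.Relation.Unary.All using (lookup)
open import Data.List.Relation.Unary.AllPairs using ([]; _∷_)
open import Data.List.Relation.Unary.Any using (here; there)
open import Data.List.Relation.Unary.Unique.DecPropositional.Properties using (deduplicate-!)
open import Data.List.Relation.Unary.Unique.Propositional using (Unique)
import Data.List.Relation.Unary.Unique.Propositional.Properties as Unique
open import Data.Nat
open import Data.Nat.Induction using (<-wellFounded)
open import Data.Nat.Properties
open import Data.Product using (Σ; ∃; ∃-syntax; _×_; _,_; proj₁; proj₂)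
open import Data.Sum using (_⊎_; inj₁; inj₂; swap; reduce)
open import Function using (_∘_; id)
open import Function.Bundles using (Inverse; Equivalence; mk⇔)
open import Function.Construct.Composition using (_↔-∘_)
open import Function.Construct.Identity using (↔-id)
open import Function.Construct.Symmetry using (↔-sym)
open import Induction.WellFounded using (Acc; acc)
open import Relation.Binary.PropositionalEquality
open import Relation.Nullary using (¬_; Dec; yes; no)

-- Counting by excluded middle

-- The obstacle is that Γ⁺ need not be transitive on vertices. Ring-likeness alone gives only κ∞ ≤ s
-- t; for equality a steepest rise must start at every vertex, and with the two orbits at an
-- unsuitable relative height it may start in one of them only. The suitable offset is a midpoint of
-- extreme heights, possibly half an integer, so heights are first doubled, and halved again when no
-- odd value occurs. Reflections put no constraint on the offset.
--
-- In the bound 2 s t one half pays for the search modulo ⟨g⟩ and the other for the way back to v.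
-- When edges inside orbits are horizontal, a period of g has 2t levels, hence 2 s t vertices, so a
-- plain search could use up the whole bound. It is therefore run in stages that alternate between
-- the orbits: consecutive stages are disjoint and do not shrink, so the earlier of two has at most
-- s t vertices modulo ⟨g⟩; as v and v⁺ lie in different orbits, one of them is met there.
--
-- Cohesion is also used for κ∞: far from a finite set S it joins neighbouring levels without
-- meeting S, so G - S has at most two infinite components.

Finite : {A : Set} → (A → Set) → Set
Finite P = ∃[ L ] (∀ x → P x → x ∈ L)

∑ : {A : Set} → (A → ℕ) → List A → ℕ
∑ f []       = 0
∑ f (x ∷ xs) = f x + ∑ f xs

module _ {A : Set} where

  ∑-++ : (f : A → ℕ) → ∀ xs ys → ∑ f (xs ++ ys) ≡ ∑ f xs + ∑ f ys
  ∑-++ f []       ys = refl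
  ∑-++ f (x ∷ xs) ys = trans (cong (_+_ (f x)) (∑-++ f xs ys)) (sym (+-assoc (f x) _ _))

  ∑-map : {B : Set} (f : A → ℕ) (g : B → A) → ∀ xs → ∑ f (map g xs) ≡ ∑ (f ∘ g) xs
  ∑-map f g []       = refl
  ∑-map f g (x ∷ xs) = cong (_+_ (f (g x))) (∑-map f g xs)

  ∑-mono-≤ : ∀ {f g : A → ℕ} xs → (∀ x → x ∈ xs → f x ≤ g x) → ∑ f xs ≤ ∑ g xs
  ∑-mono-≤ []       le = z≤n
  ∑-mono-≤ (x ∷ xs) le = +-mono-≤ (le x (here refl)) (∑-mono-≤ xs (λ y → le y ∘ there))

  ∑-cong : ∀ {f g : A → ℕ} xs → (∀ x → x ∈ xs → f x ≡ g x) → ∑ f xs ≡ ∑ g xs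
  ∑-cong []       eq = refl
  ∑-cong (x ∷ xs) eq = cong₂ _+_ (eq x (here refl)) (∑-cong xs (λ y → eq y ∘ there))

  ∑-mono-< : ∀ {f g : A → ℕ} {y} xs → (∀ x → x ∈ xs → f x ≤ g x) → y ∈ xs → f y < g y →
             ∑ f xs < ∑ g xs
  ∑-mono-< (x ∷ xs) le (here refl) lt = +-mono-<-≤ lt (∑-mono-≤ xs (λ z → le z ∘ there))
  ∑-mono-< (x ∷ xs) le (there y∈)  lt =
    +-mono-≤-< (le x (here refl)) (∑-mono-< xs (λ z → le z ∘ there) y∈ lt)

  ∑-zero : ∀ (xs : List A) → ∑ (λ _ → 0) xs ≡ 0
  ∑-zero []       = refl
  ∑-zero (x ∷ xs) = ∑-zero xs

  ∑-+ : (f g : A → ℕ) → ∀ xs → ∑ (λ x → f x + g x) xs ≡ ∑ f xs + ∑ g xs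
  ∑-+ f g []       = refl
  ∑-+ f g (x ∷ xs) = begin
    f x + g x + ∑ (λ z → f z + g z) xs  ≡⟨ cong (_+_ (f x + g x)) (∑-+ f g xs) ⟩
    f x + g x + (∑ f xs + ∑ g xs)       ≡⟨ +-assoc (f x) (g x) _ ⟩
    f x + (g x + (∑ f xs + ∑ g xs))     ≡⟨ cong (_+_ (f x)) (sym (+-assoc (g x) _ _)) ⟩
    f x + (g x + ∑ f xs + ∑ g xs)       ≡⟨ cong (λ k → f x + (k + ∑ g xs)) (+-comm (g x) _) ⟩
    f x + (∑ f xs + g x + ∑ g xs)       ≡⟨ cong (_+_ (f x)) (+-assoc (∑ f xs) _ _) ⟩
    f x + (∑ f xs + (g x + ∑ g xs))     ≡⟨ +-assoc (f x) _ _ ⟨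
    f x + ∑ f xs + (g x + ∑ g xs)       ∎
    where open ≡-Reasoning

  ∑-*ʳ : (f : A → ℕ) (d : ℕ) → ∀ xs → ∑ (λ x → f x * d) xs ≡ ∑ f xs * d
  ∑-*ʳ f d []       = refl
  ∑-*ʳ f d (x ∷ xs) = trans (cong (_+_ (f x * d)) (∑-*ʳ f d xs)) (sym (*-distribʳ-+ d (f x) _))

∑-swap : {A B : Set} (f : A → B → ℕ) → ∀ xs ys →
         ∑ (λ x → ∑ (f x) ys) xs ≡ ∑ (λ y → ∑ (λ x → f x y) xs) ys
∑-swap f []       ys = sym (∑-zero ys)
∑-swap f (x ∷ xs) ys = trans (cong (_+_ (∑ (f x) ys)) (∑-swap f xs ys)) (sym (∑-+ (f x) _ ys))

length-⊆ : {A : Set} {xs ys : List A} → Unique xs → (∀ x → x ∈ xs → x ∈ ys) → length xs ≤ length ys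
length-⊆ {xs = []} _ _ = z≤n
length-⊆ {xs = x ∷ xs} (x∉ ∷ u) sub with ∈-∃++ (sub x (here refl))
... | ps , qs , refl = begin
    suc (length xs)               ≤⟨ s≤s (length-⊆ u sub′) ⟩
    suc (length (ps ++ qs))       ≡⟨ cong suc (length-++ ps) ⟩
    suc (length ps + length qs)   ≡⟨ +-suc (length ps) (length qs) ⟨
    length ps + suc (length qs)   ≡⟨ length-++ ps ⟨
    length (ps ++ x ∷ qs)         ∎
  where
  open ≤-Reasoning
  sub′ : ∀ z → z ∈ xs → z ∈ ps ++ qs
  sub′ z z∈ with ∈-++⁻ ps (sub z (there z∈))
  ... | inj₁ p            = ∈-++⁺ˡ p
  ... | inj₂ (here refl)  = ⊥-elim (lookup x∉ z∈ refl)
  ... | inj₂ (there q)    = ∈-++⁺ʳ ps q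

module Counting (em : ExcludedMiddle 0ℓ) where

  by-contradiction : {P : Set} → ¬ ¬ P → P
  by-contradiction {P} nnp with em {P}
  ... | yes p = p
  ... | no ¬p = ⊥-elim (nnp ¬p)

  ¬∀⇒∃¬ : {A : Set} {P : A → Set} → ¬ (∀ x → P x) → ∃[ x ] ¬ P x
  ¬∀⇒∃¬ h = by-contradiction λ ne → h λ x → by-contradiction λ np → ne (x , np)

  ¬⇒ : {P Q : Set} → ¬ (P → Q) → P × ¬ Q
  ¬⇒ h = by-contradiction (λ np → h (⊥-elim ∘ np)) , λ q → h λ _ → q

  ι : Set → ℕ
  ι P with em {P}
  ... | yes _ = 1
  ... | no  _ = 0

  ι-yes : {P : Set} → P → ι P ≡ 1
  ι-yes {P} p with em {P}
  ... | yes _ = refl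
  ... | no ¬p = ⊥-elim (¬p p)

  ι-no : {P : Set} → ¬ P → ι P ≡ 0
  ι-no {P} ¬p with em {P}
  ... | yes p = ⊥-elim (¬p p)
  ... | no  _ = refl

  ι-mono : {P Q : Set} → (P → Q) → ι P ≤ ι Q
  ι-mono {P} {Q} f with em {P}
  ... | yes p = ≤-reflexive (sym (ι-yes (f p)))
  ... | no  _ = z≤n

  ι-cong : {P Q : Set} → (P → Q) → (Q → P) → ι P ≡ ι Q
  ι-cong f g = ≤-antisym (ι-mono f) (ι-mono g)

  ♯ : {A : Set} → (A → Set) → List A → ℕ
  ♯ P = ∑ (λ x → ι (P x))

  unique-list : {A : Set} (L : List A) →
    ∃[ M ] (Unique M × (∀ x → x ∈ L → x ∈ M) × (∀ x → x ∈ M → x ∈ L))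
  unique-list L = deduplicate _≟ᵉ_ L , deduplicate-! _≟ᵉ_ L ,
                  (λ x → ∈-deduplicate⁺ _≟ᵉ_) , λ x → ∈-deduplicate⁻ _≟ᵉ_ L
    where
    _≟ᵉ_ : ∀ x y → Dec (x ≡ y)
    x ≟ᵉ y = em

  module _ {A : Set} where

    select : (A → Set) → List A → List A
    select P = filter (λ x → em {P x})

    ∈-select⁺ : ∀ {P : A → Set} {x L} → x ∈ L → P x → x ∈ select P L
    ∈-select⁺ {P} = ∈-filter⁺ (λ x → em {P x})

    ∈-select⁻ : ∀ {P : A → Set} {x L} → x ∈ select P L → x ∈ L × P x
    ∈-select⁻ {P} = ∈-filter⁻ (λ x → em {P x})

    select-unique : ∀ (P : A → Set) {L} → Unique L → Unique (select P L)
    select-unique P = Unique.filter⁺ (λ x → em {P x})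

    length-select : ∀ (P : A → Set) L → length (select P L) ≡ ♯ P L
    length-select P []       = refl
    length-select P (x ∷ xs) with em {P x}
    ... | yes _ = cong suc (length-select P xs)
    ... | no  _ = length-select P xs

    enumerate : ∀ {P : A → Set} → Finite P →
      ∃[ L ] (Unique L × (∀ x → x ∈ L → P x) × (∀ x → P x → x ∈ L))
    enumerate {P} (L , all) with unique-list L
    ... | M , uM , L⊆M , _ = select P M , select-unique P uM ,
          (λ x → proj₂ ∘ ∈-select⁻ {P} {x} {M}) , λ x p → ∈-select⁺ {P} (L⊆M x (all x p)) p

    ♯-mono : ∀ {P Q : A → Set} L → (∀ x → x ∈ L → P x → Q x) → ♯ P L ≤ ♯ Q L
    ♯-mono L h = ∑-mono-≤ L (λ x x∈ → ι-mono (h x x∈))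

    ♯-cong : ∀ {P Q : A → Set} L → (∀ x → x ∈ L → P x → Q x) → (∀ x → x ∈ L → Q x → P x) → ♯ P L ≡ ♯ Q L
    ♯-cong L h k = ≤-antisym (♯-mono L h) (♯-mono L k)

    ♯-mono-< : ∀ {P Q : A → Set} {y} L → (∀ x → x ∈ L → P x → Q x) → y ∈ L → ¬ P y → Q y → ♯ P L < ♯ Q L
    ♯-mono-< {P} {Q} {y} L h y∈ ¬p q = ∑-mono-< L (λ x x∈ → ι-mono (h x x∈)) y∈
      (subst₂ _<_ (sym (ι-no ¬p)) (sym (ι-yes q)) (s≤s z≤n))

    ♯-all : ∀ {P : A → Set} L → (∀ x → x ∈ L → P x) → ♯ P L ≡ length L
    ♯-all []       h = refl
    ♯-all (x ∷ xs) h = cong₂ _+_ (ι-yes (h x (here refl))) (♯-all xs (λ y → h y ∘ there))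

    ♯-none : ∀ {P : A → Set} L → (∀ x → x ∈ L → ¬ P x) → ♯ P L ≡ 0
    ♯-none []       h = refl
    ♯-none (x ∷ xs) h = cong₂ _+_ (ι-no (h x (here refl))) (♯-none xs (λ y → h y ∘ there))

    ♯≤length : ∀ (P : A → Set) L → ♯ P L ≤ length L
    ♯≤length P L = ≤-trans (♯-mono {P} {λ x → x ∈ L} L (λ x x∈ _ → x∈)) (≤-reflexive (♯-all L (λ _ → id)))

    ♯-full : ∀ {P : A → Set} {L} → length L ≤ ♯ P L → ∀ x → x ∈ L → P x
    ♯-full {P} {L} le x x∈ = by-contradiction λ ¬p →
      <⇒≱ (subst (♯ P L <_) (♯-all L (λ _ → id)) (♯-mono-< {P} {λ x → x ∈ L} L (λ x x∈ _ → x∈) x∈ ¬p x∈)) le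

    ♯-positive : ∀ {P : A → Set} {x L} → x ∈ L → P x → 1 ≤ ♯ P L
    ♯-positive {P} {L = L} x∈ p = ≤-trans (s≤s z≤n)
      (♯-mono-< {λ _ → ⊥} {P} L (λ _ _ ()) x∈ (λ ()) p)

    ♯-split : ∀ (P Q : A → Set) L → ♯ P L ≡ ♯ (λ x → P x × Q x) L + ♯ (λ x → P x × ¬ Q x) L
    ♯-split P Q L = trans (∑-cong L (λ x _ → pointwise x)) (∑-+ _ _ L)
      where
      pointwise : ∀ x → ι (P x) ≡ ι (P x × Q x) + ι (P x × ¬ Q x)
      pointwise x with em {Q x}
      ... | yes q = trans (ι-cong (λ p → p , q) proj₁)
                      (sym (trans (cong (_+_ (ι (P x × Q x))) (ι-no (λ r → proj₂ r q))) (+-identityʳ _)))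
      ... | no ¬q = trans (ι-cong (λ p → p , ¬q) proj₁)
                      (sym (cong (_+ ι (P x × ¬ Q x)) (ι-no (λ r → ¬q (proj₂ r)))))

    ♯-⊆ : ∀ {P Q : A → Set} {L M} → Unique L → (∀ x → x ∈ L → P x → x ∈ M × Q x) → ♯ P L ≤ ♯ Q M
    ♯-⊆ {P} {Q} {L} {M} u h = subst₂ _≤_ (length-select P L) (length-select Q M)
      (length-⊆ (select-unique P u) λ x x∈ → let (l , p) = ∈-select⁻ {P} x∈ ; (m , q) = h x l p in ∈-select⁺ {Q} m q)

    length≤♯ : ∀ {P : A → Set} {L M} → Unique L → (∀ x → x ∈ L → x ∈ M × P x) → length L ≤ ♯ P M
    length≤♯ {P} {L} {M} u h =
      subst (_≤ ♯ P M) (♯-all L (λ _ → id)) (♯-⊆ {λ x → x ∈ L} {P} u (λ x x∈ _ → h x x∈))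

    ♯≤length-⊆ : ∀ {P : A → Set} {L M} → Unique L → (∀ x → x ∈ L → P x → x ∈ M) → ♯ P L ≤ length M
    ♯≤length-⊆ {P} {L} {M} u h =
      subst (♯ P L ≤_) (♯-all M (λ _ → id)) (♯-⊆ {P} {λ x → x ∈ M} u (λ x x∈ p → h x x∈ p , h x x∈ p))

    -- Serves to sharpen a strict inequality between the sizes of two unions of classes to a gap of
    -- at least `m`. The recursion removes the class of the first entry.
    equal-classes : (_≈_ : A → A → Set) → (∀ x → x ≈ x) → (∀ {x y} → x ≈ y → y ≈ x) →
      (∀ {x y z} → x ≈ y → y ≈ z → x ≈ z) → ∀ m L →
      (∀ x → x ∈ L → ♯ (x ≈_) L ≡ m) → ∃[ k ] length L ≡ k * m
    equal-classes _≈_ rfl sm tr m L size = go (length L) L ≤-refl size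
      where
      go : ∀ n L → length L ≤ n → (∀ x → x ∈ L → ♯ (x ≈_) L ≡ m) → ∃[ k ] length L ≡ k * m
      go _       []       _  _    = 0 , refl
      go (suc n) (x ∷ xs) le size = let (k , eq) = ih in suc k , trans len (cong (_+_ m) eq)
        where
        L′ M : List A
        L′ = x ∷ xs
        M = select (λ y → ¬ (x ≈ y)) L′
        len : length L′ ≡ m + length M
        len = begin
          length L′                                       ≡⟨ ♯-all L′ (λ _ → id) ⟨
          ♯ (_∈ L′) L′                                    ≡⟨ ♯-split (_∈ L′) (x ≈_) L′ ⟩
          ♯ (λ y → y ∈ L′ × x ≈ y) L′ + ♯ (λ y → y ∈ L′ × ¬ (x ≈ y)) L′
            ≡⟨ cong₂ _+_ (♯-cong L′ (λ _ _ → proj₂) (λ _ y∈ p → y∈ , p))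
                         (♯-cong L′ (λ _ _ → proj₂) (λ _ y∈ p → y∈ , p)) ⟩
          ♯ (x ≈_) L′ + ♯ (λ y → ¬ (x ≈ y)) L′
            ≡⟨ cong₂ _+_ (size x (here refl)) (sym (length-select (λ y → ¬ (x ≈ y)) L′)) ⟩
          m + length M ∎
          where open ≡-Reasoning
        m≥1 : 1 ≤ m
        m≥1 = subst (1 ≤_) (size x (here refl)) (♯-positive {x ≈_} {x} {L′} (here refl) (rfl x))
        M≤n : length M ≤ n
        M≤n = s≤s⁻¹ (≤-trans (≤-trans (+-monoˡ-≤ (length M) m≥1) (≤-reflexive (sym len))) le)
        size′ : ∀ z → z ∈ M → ♯ (z ≈_) M ≡ m
        size′ z z∈ with ∈-select⁻ {λ y → ¬ (x ≈ y)} z∈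
        ... | z∈L , ¬xz = trans (sym (trans
              (♯-split (z ≈_) (λ y → ¬ (x ≈ y)) L′)
              (trans (cong₂ _+_ (♯-filter L′) (♯-none L′ (λ y _ (zy , nn) → nn (λ xy → ¬xz (tr xy (sm zy))))))
                     (+-identityʳ _))))
              (size z z∈L)
          where
          ♯-filter : ∀ L → ♯ (λ y → z ≈ y × ¬ (x ≈ y)) L ≡ ♯ (z ≈_) (select (λ y → ¬ (x ≈ y)) L)
          ♯-filter []       = refl
          ♯-filter (y ∷ ys) with em {¬ (x ≈ y)}
          ... | yes q = cong₂ _+_ (ι-cong proj₁ (λ p → p , q)) (♯-filter ys)
          ... | no ¬q = cong₂ _+_ (ι-no (λ p → ¬q (proj₂ p))) (♯-filter ys)
        ih : ∃[ k ] length M ≡ k * m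
        ih = go n M M≤n size′

    -- The count of a breadth-first search: one element is present at stage 0 and each stage that is
    -- not yet full is followed by a strictly larger one, which gives the exponent one below
    -- `length Q`.
    growth : (P : ℕ → A → Set) (Q : List A) → (∃[ x ] (x ∈ Q × P 0 x)) →
      (∀ i x → P i x → P (suc i) x) →
      (∀ i → (∀ x → x ∈ Q → P i x) ⊎ ∃[ x ] (x ∈ Q × P (suc i) x × ¬ P i x)) →
      ∀ x → x ∈ Q → P (pred (length Q)) x
    growth P Q@(_ ∷ Q′) (x₀ , x₀∈ , p₀) up next with claim (length Q′)
      where
      claim : ∀ i → (∀ x → x ∈ Q → P i x) ⊎ suc i ≤ ♯ (P i) Q
      claim zero = inj₂ (♯-positive {P 0} {x₀} {Q} x₀∈ p₀)
      claim (suc i) with claim i | next i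
      ... | inj₁ all | _ = inj₁ (λ x x∈ → up i x (all x x∈))
      ... | inj₂ _   | inj₁ all = inj₁ (λ x x∈ → up i x (all x x∈))
      ... | inj₂ le  | inj₂ (x , x∈ , p , ¬p) = inj₂ (≤-trans (s≤s le) (♯-mono-< {P i} {P (suc i)} Q
          (λ y _ → up i y) x∈ ¬p p))
    ... | inj₁ all = all
    ... | inj₂ le  = ♯-full le

-- Ends and cuts

module _ {A : Set} {R : A → A → Set} where

  _++ʷ_ : ∀ {a b c m n} → Walk R a b m → Walk R b c n → Walk R a c (m + n)
  here     ++ʷ q = q
  step r p ++ʷ q = step r (p ++ʷ q)

  snocʷ : ∀ {a b c n} → Walk R a b n → R b c → Walk R a c (suc n)
  snocʷ here       r = step r here
  snocʷ (step s p) r = step s (snocʷ p r)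

  reverseʷ : (∀ {a b} → R a b → R b a) → ∀ {a b n} → Walk R a b n → Walk R b a n
  reverseʷ s here       = here
  reverseʷ s (step r p) = snocʷ (reverseʷ s p) (s r)

  mapʷ : {B : Set} {S : B → B → Set} (f : A → B) → (∀ {a b} → R a b → S (f a) (f b)) →
         ∀ {a b n} → Walk R a b n → Walk S (f a) (f b) n
  mapʷ f h here       = here
  mapʷ f h (step r p) = step (h r) (mapʷ f h p)

module Automorphisms (G : Graph) where

  infixr 9 _•_ _∘ᴬ_
  infix  10 _⁻ᴬ

  _•_ : Aut G → V G → V G
  _•_ = app

  idᴬ : Aut G
  idᴬ = record { bij = ↔-id _ ; pres = λ u v → mk⇔ id id }

  _∘ᴬ_ : Aut G → Aut G → Aut G
  f ∘ᴬ g = record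
    { bij  = bij f ↔-∘ bij g
    ; pres = λ u v → mk⇔ (Equivalence.to (pres f _ _) ∘ Equivalence.to (pres g u v))
                         (Equivalence.from (pres g u v) ∘ Equivalence.from (pres f _ _)) }

  invˡ : ∀ f x → f • Inverse.from (bij f) x ≡ x
  invˡ f = Inverse.strictlyInverseˡ (bij f)

  invʳ : ∀ f x → Inverse.from (bij f) (f • x) ≡ x
  invʳ f = Inverse.strictlyInverseʳ (bij f)

  _⁻ᴬ : Aut G → Aut G
  f ⁻ᴬ = record
    { bij  = ↔-sym (bij f)
    ; pres = λ u v → mk⇔
        (λ e → Equivalence.from (pres f _ _) (subst₂ (E G) (sym (invˡ f u)) (sym (invˡ f v)) e))
        (λ e → subst₂ (E G) (invˡ f u) (invˡ f v) (Equivalence.to (pres f _ _) e)) }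

  E-pres : ∀ f {u v} → E G u v → E G (f • u) (f • v)
  E-pres f = Equivalence.to (pres f _ _)

  •-injective : ∀ f {x y} → f • x ≡ f • y → x ≡ y
  •-injective f {x} {y} eq = trans (sym (invʳ f x)) (trans (cong (f ⁻ᴬ •_) eq) (invʳ f y))

  iter : ℕ → Aut G → Aut G
  iter zero    f = idᴬ
  iter (suc n) f = f ∘ᴬ iter n f

module Ends (em : ExcludedMiddle 0ℓ) (G : Graph) (lf : LocallyFinite G) (conn : Connected G) where
  open Counting em
  open Automorphisms G

  FinB : (V G → Set) → Set
  FinB Y = ∃[ L ] (∀ {x y} → E G x y → Y x → ¬ Y y → x ∈ L × y ∈ L)

  FinB-¬ : ∀ {Y} → FinB Y → FinB (λ x → ¬ Y x)
  FinB-¬ (L , h) = L , λ e ¬y ¬¬y → let (p , q) = h (E-sym G e) (by-contradiction ¬¬y) ¬y in q , p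

  FinB-∩ : ∀ {Y Z} → FinB Y → FinB Z → FinB (λ x → Y x × Z x)
  FinB-∩ {Y} {Z} (L , h) (M , k) = L ++ M , bd
    where
    bd : ∀ {x y} → E G x y → Y x × Z x → ¬ (Y y × Z y) → x ∈ L ++ M × y ∈ L ++ M
    bd {x} {y} e (p , q) n with em {Y y}
    ... | yes p′ = let (a , b) = k e q (λ q′ → n (p′ , q′)) in ∈-++⁺ʳ L a , ∈-++⁺ʳ L b
    ... | no ¬p  = let (a , b) = h e p ¬p in ∈-++⁺ˡ a , ∈-++⁺ˡ b

  FinB-∘ : ∀ {Y} f → FinB Y → FinB (λ x → Y (f • x))
  FinB-∘ f (L , h) = map (f ⁻ᴬ •_) L , λ e p q →
    let (a , b) = h (E-pres f e) p q in pull a , pull b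
    where
    pull : ∀ {x} → f • x ∈ L → x ∈ map (f ⁻ᴬ •_) L
    pull {x} m = subst (_∈ map (f ⁻ᴬ •_) L) (invʳ f x) (∈-map⁺ (f ⁻ᴬ •_) m)

  Finite-⊆ : ∀ {P Q : V G → Set} → (∀ x → P x → Q x) → Finite Q → Finite P
  Finite-⊆ h (L , k) = L , λ x → k x ∘ h x

  Finite-∪ : ∀ {P Q R : V G → Set} → (∀ x → P x → Q x ⊎ R x) → Finite Q → Finite R → Finite P
  Finite-∪ {P} h (L , k) (M , l) = L ++ M , go
    where
    go : ∀ x → P x → x ∈ L ++ M
    go x p with h x p
    ... | inj₁ q = ∈-++⁺ˡ (k x q)
    ... | inj₂ r = ∈-++⁺ʳ L (l x r)

  Finite-⋃ : ∀ N {Q : V G → V G → Set} → (∀ y → y ∈ N → Finite (Q y)) →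
             Finite (λ w → ∃[ y ] (y ∈ N × Q y w))
  Finite-⋃ []      h = [] , λ { x (_ , () , _) }
  Finite-⋃ (y ∷ N) {Q} h = Finite-∪ split (h y (here refl)) (Finite-⋃ N (λ z → h z ∘ there))
    where
    split : ∀ w → ∃[ z ] (z ∈ y ∷ N × Q z w) → Q y w ⊎ ∃[ z ] (z ∈ N × Q z w)
    split w (z , here refl , q) = inj₁ q
    split w (z , there z∈ , q)  = inj₂ (z , z∈ , q)

  infinite-pigeonhole : ∀ N {P : V G → Set} {Q : V G → V G → Set} →
    (∀ w → P w → ∃[ y ] (y ∈ N × Q y w)) → ¬ Finite P → ∃[ y ] (y ∈ N × ¬ Finite (Q y))
  infinite-pigeonhole N h ¬fin = by-contradiction λ ne →
    ¬fin (Finite-⊆ h (Finite-⋃ N (λ y y∈ → by-contradiction λ nf → ne (y , y∈ , nf))))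

  -- König's lemma: rays inside infinite sets of finite boundary

  module König (Y : V G → Set) where

    Step : List (V G) → V G → V G → Set
    Step P a b = E G a b × Y b × b ∉ P

    Reach : List (V G) → V G → V G → Set
    Reach P x w = ∃[ n ] Walk (Step P) x w n

    -- Cutting a walk at its last visit to `y` leaves a walk whose later vertices avoid `y`. Hence
    -- adding the new tip to the visited vertices keeps infinitely many vertices within reach.
    last-visit : ∀ P y {a w n} → Walk (Step P) a w n → Reach (y ∷ P) a w ⊎ Reach (y ∷ P) y w
    last-visit P y here = inj₁ (0 , here)
    last-visit P y (step {b = b} (e , yb , b∉) p) with last-visit P y p | em {b ≡ y}
    ... | inj₂ r       | _        = inj₂ r
    ... | inj₁ r       | yes refl = inj₂ r
    ... | inj₁ (n , q) | no b≢y   = inj₁ (suc n , step (e , yb , λ { (here eq) → b≢y eq ; (there m) → b∉ m }) q)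

    -- Only the targets of a `Step` must avoid `visited`, so walks may start at the tip although the
    -- tip itself counts as visited.
    record State : Set where
      field
        visited  : List (V G)
        tip      : V G
        tip∈     : tip ∈ visited
        inside   : Y tip
        infinite : ¬ Finite (Reach visited tip)
    open State

    revisit : ∀ P y → ¬ Finite (Reach P y) → ¬ Finite (Reach (y ∷ P) y)
    revisit P y ¬fin = ¬fin ∘ Finite-⊆ λ w (n , p) → reduce (last-visit P y p)

    extend : (s : State) → ∃[ s′ ] (E G (tip s) (tip s′) × tip s′ ∉ visited s × visited s′ ≡ tip s′ ∷ visited s)
    extend s with infinite-pigeonhole (tip s ∷ proj₁ (lf (tip s)))
                    {Q = λ y w → (y ≡ tip s × w ≡ tip s) ⊎ (Step (visited s) (tip s) y × Reach (visited s) y w)}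
                    first (infinite s)
      where
      first : ∀ w → Reach (visited s) (tip s) w →
        ∃[ y ] (y ∈ tip s ∷ proj₁ (lf (tip s)) ×
                ((y ≡ tip s × w ≡ tip s) ⊎ (Step (visited s) (tip s) y × Reach (visited s) y w)))
      first w (_ , here)                 = tip s , here refl , inj₁ (refl , refl)
      first w (_ , step {b = b} st p)    = b , there (proj₂ (lf (tip s)) b (proj₁ st)) , inj₂ (st , _ , p)
    ... | y , _ , ¬fin = record
            { visited = y ∷ visited s ; tip = y ; tip∈ = here refl ; inside = proj₁ (proj₂ st)
            ; infinite = revisit _ y λ (L , h) → ¬fin (tip s ∷ L , λ
                { w (inj₁ (_ , eq)) → here eq ; w (inj₂ (_ , r)) → there (h w r) }) }
          , proj₁ st , proj₂ (proj₂ st) , refl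
      where
      st : Step (visited s) (tip s) y
      st = by-contradiction λ n → ¬fin (tip s ∷ [] , λ
             { w (inj₁ (_ , eq)) → here eq ; w (inj₂ (s′ , _)) → ⊥-elim (n s′) })

    module _ (s₀ : State) where
      states : ℕ → State
      states zero    = s₀
      states (suc n) = proj₁ (extend (states n))

      visited-mono : ∀ {i j x} → i ≤′ j → x ∈ visited (states i) → x ∈ visited (states j)
      visited-mono ≤′-refl     x∈ = x∈
      visited-mono {x = x} (≤′-step {n} le) x∈ =
        subst (x ∈_) (sym (proj₂ (proj₂ (proj₂ (extend (states n)))))) (there (visited-mono le x∈))

      distinct : ∀ i j → i < j → tip (states i) ≢ tip (states j)
      distinct i (suc j) (s≤s i≤j) eq = proj₁ (proj₂ (proj₂ (extend (states j))))
        (subst (_∈ visited (states j)) eq (visited-mono (≤⇒≤′ i≤j) (tip∈ (states i))))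

      tips : Ray G
      tips = record
        { r   = tip ∘ states
        ; inj = λ i j eq → ≤-antisym (≮⇒≥ λ lt → distinct j i lt (sym eq)) (≮⇒≥ λ lt → distinct i j lt eq)
        ; adj = λ i → proj₁ (proj₂ (extend (states i))) }

    -- `Y` need not be connected. Following a walk towards a fixed point of `Y` until it first
    -- leaves `Y` shows that every vertex of `Y` can be reached inside `Y` from that point or from
    -- one of the finitely many boundary vertices; one of these sources reaches infinitely many
    -- vertices.
    ray-inside : FinB Y → ¬ Finite Y → ∃[ ρ ] (∀ i → Y (r ρ i))
    ray-inside (L , bd) ¬fin = tips s₀ , λ i → inside (states s₀ i)
      where
      y₀ : ∃[ y ] Y y
      y₀ = by-contradiction λ ne → ¬fin ([] , λ x y → ⊥-elim (ne (x , y)))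
      source : ∀ {w n} → Y w → Walk (E G) w (proj₁ y₀) n → ∃[ z ] (z ∈ proj₁ y₀ ∷ L × (Y z × Reach [] z w))
      source yw here = proj₁ y₀ , here refl , proj₂ y₀ , 0 , here
      source yw (step {b = w′} e p) with em {Y w′}
      ... | no ¬y  = _ , there (proj₁ (bd e yw ¬y)) , yw , 0 , here
      ... | yes yw′ with source yw′ p
      ...   | z , z∈ , yz , n , q = z , z∈ , yz , suc n , snocʷ q (E-sym G e , yw , λ ())
      seed : ∃[ z ] (z ∈ proj₁ y₀ ∷ L × ¬ Finite (λ w → Y z × Reach [] z w))
      seed = infinite-pigeonhole (proj₁ y₀ ∷ L) (λ w yw → source yw (proj₂ (conn w (proj₁ y₀)))) ¬fin
      s₀ : State
      s₀ = let (z , _ , nf) = seed in record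
        { visited = z ∷ [] ; tip = z ; tip∈ = here refl
        ; inside = by-contradiction λ n → nf ([] , λ w (yz , _) → ⊥-elim (n yz))
        ; infinite = revisit [] z λ (M , h) → nf (M , λ w (_ , r) → h w r) }

  ray-leaves : ∀ (ρ : Ray G) L → ∃[ n ] (∀ i → n ≤ i → r ρ i ∉ L)
  ray-leaves ρ []      = 0 , λ i _ ()
  ray-leaves ρ (x ∷ L) with ray-leaves ρ L | em {∃[ j ] r ρ j ≡ x}
  ... | n , h | no ne        = n , λ { i le (here eq) → ne (i , eq) ; i le (there m) → h i le m }
  ... | n , h | yes (j , eq) = n ⊔ suc j , λ
    { i le (here eq′) → <⇒≢ (≤-trans (m≤n⊔m n (suc j)) le) (inj ρ j i (trans eq (sym eq′)))
    ; i le (there m)  → h i (≤-trans (m≤m⊔n n (suc j)) le) m }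

  frequent-infinite : ∀ (Y : V G → Set) (ρ : Ray G) → (∀ n → ∃[ i ] (n ≤ i × Y (r ρ i))) → ¬ Finite Y
  frequent-infinite Y ρ h (L , k) with ray-leaves ρ L
  ... | n , out with h n
  ...   | i , le , y = out i le (k _ y)

  tail-connected : ∀ (ρ : Ray G) L n → (∀ i → n ≤ i → r ρ i ∉ L) → ∀ k →
    ConnAvoid G L (r ρ n) (r ρ (k + n))
  tail-connected ρ L n out k = out n ≤-refl , out (k + n) (m≤n+m n k) , k , walk k
    where
    walk : ∀ k → Walk (EAvoid G L) (r ρ n) (r ρ (k + n)) k
    walk zero    = here
    walk (suc k) = snocʷ (walk k) (out _ (m≤n+m n k) , out _ (m≤n+m n (suc k)) , adj ρ (k + n))

  tail-in : ∀ (ρ : Ray G) L n → (∀ i → n ≤ i → r ρ i ∉ L) → InfManyIn G L (r ρ n) ρ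
  tail-in ρ L n out m = m + n , m≤m+n m n , tail-connected ρ L n out m

  boundary-constant : ∀ {Y} ((L , _) : FinB Y) → ∀ {x y n} → Walk (EAvoid G L) x y n → Y x → Y y
  boundary-constant fb here y = y
  boundary-constant {Y} fb@(L , bd) (step (a∉ , b∉ , e) p) ya =
    boundary-constant {Y} fb p (by-contradiction λ ¬yb → a∉ (proj₁ (bd e ya ¬yb)))

  -- If both parts were infinite, each would contain a ray. Both rays would be equivalent to `ρ`,
  -- yet removing the finite boundary of `Y` separates their tails.
  one-end : ∀ (ρ : Ray G) {D} → FinB D → (∀ ρ′ → (∀ i → D (r ρ′ i)) → EquivRay G ρ′ ρ) →
    ∀ Y → FinB Y → Finite (λ x → D x × Y x) ⊎ Finite (λ x → D x × ¬ Y x)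
  one-end ρ {D} fD only Y fY@(L , bd) with em {Finite (λ x → D x × Y x)} | em {Finite (λ x → D x × ¬ Y x)}
  ... | yes p | _     = inj₁ p
  ... | no _  | yes q = inj₂ q
  ... | no ¬p | no ¬q = ⊥-elim contra
    where
    ray₁ : ∃[ ρ′ ] (∀ i → D (r ρ′ i) × Y (r ρ′ i))
    ray₁ = König.ray-inside _ (FinB-∩ {D} {Y} fD fY) ¬p
    ray₂ : ∃[ ρ′ ] (∀ i → D (r ρ′ i) × ¬ Y (r ρ′ i))
    ray₂ = König.ray-inside _ (FinB-∩ {D} {λ x → ¬ Y x} fD (FinB-¬ {Y} fY)) ¬q
    contra : ⊥
    contra with ray₁ | ray₂
    ... | ρ₁ , in₁ | ρ₂ , in₂ with ray-leaves ρ₁ L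
    ...   | n , out with proj₂ (only ρ₂ (proj₁ ∘ in₂) L (r ρ₁ n))
                         (proj₁ (only ρ₁ (proj₁ ∘ in₁) L (r ρ₁ n)) (tail-in ρ₁ L n out)) 0
    ...     | i , _ , _ , _ , _ , w = proj₂ (in₂ i) (boundary-constant {Y} fY w (proj₂ (in₁ n)))

  -- `split` and `split-¬` are all that is kept of the two ends: no set of finite boundary divides a
  -- side of the cut into two infinite parts.
  record Cut : Set₁ where
    field
      C       : V G → Set
      finB    : FinB C
      inf     : ¬ Finite C
      co-inf  : ¬ Finite (λ x → ¬ C x)
      split   : ∀ Y → FinB Y → Finite (λ x → C x × Y x) ⊎ Finite (λ x → C x × ¬ Y x)
      split-¬ : ∀ Y → FinB Y → Finite (λ x → ¬ C x × Y x) ⊎ Finite (λ x → ¬ C x × ¬ Y x)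

  -- `C` is the component of `v` after removal of `X`. A ray inside `C` cannot be equivalent to
  -- `ρ₂`, nor a ray outside `C` to `ρ₁`, so each side carries the rays of a single end.
  separating-cut : ∀ ρ₁ ρ₂ → (∀ ρ → EquivRay G ρ ρ₁ ⊎ EquivRay G ρ ρ₂) → ∀ X v →
    InfManyIn G X v ρ₁ → ¬ InfManyIn G X v ρ₂ → Cut
  separating-cut ρ₁ ρ₂ all X v in₁ ¬in₂ = record
    { C = C ; finB = fC
    ; inf = frequent-infinite C ρ₁ in₁
    ; co-inf = frequent-infinite (λ x → ¬ C x) ρ₂ λ n →
        proj₁ late + n , m≤n+m n _ , λ c → proj₂ late (_ , m≤m+n (proj₁ late) n , c)
    ; split = one-end ρ₁ {C} fC λ ρ inC → only₁ ρ inC (all ρ)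
    ; split-¬ = one-end ρ₂ {λ x → ¬ C x} (FinB-¬ {C} fC) λ ρ out → only₂ ρ out (all ρ) }
    where
    C : V G → Set
    C = ConnAvoid G X v
    nbrs : List (V G)
    nbrs = concatMap (λ x → proj₁ (lf x)) X
    nbrs∈ : ∀ {x y} Z → x ∈ Z → E G x y → y ∈ concatMap (λ x → proj₁ (lf x)) Z
    nbrs∈ {x} {y} (z ∷ Z) (here refl) e = ∈-++⁺ˡ (proj₂ (lf x) y e)
    nbrs∈ (z ∷ Z) (there m) e = ∈-++⁺ʳ (proj₁ (lf z)) (nbrs∈ Z m e)
    fC : FinB C
    fC = X ++ nbrs , λ {x} {y} e (v∉ , x∉ , n , w) ¬c →
      let y∈ = by-contradiction λ y∉ → ¬c (v∉ , y∉ , suc n , snocʷ w (x∉ , y∉ , e))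
      in ∈-++⁺ʳ X (nbrs∈ X y∈ (E-sym G e)) , ∈-++⁺ˡ y∈
    late : ∃[ n ] ¬ (∃[ i ] (n ≤ i × C (r ρ₂ i)))
    late = ¬∀⇒∃¬ ¬in₂
    only₁ : ∀ ρ → (∀ i → C (r ρ i)) → EquivRay G ρ ρ₁ ⊎ EquivRay G ρ ρ₂ → EquivRay G ρ ρ₁
    only₁ ρ inC (inj₁ eq) = eq
    only₁ ρ inC (inj₂ eq) = ⊥-elim (¬in₂ (proj₁ (eq X v) (λ n → n , ≤-refl , inC n)))
    only₂ : ∀ ρ → (∀ i → ¬ C (r ρ i)) → EquivRay G ρ ρ₁ ⊎ EquivRay G ρ ρ₂ → EquivRay G ρ ρ₂
    only₂ ρ out (inj₂ eq) = eq
    only₂ ρ out (inj₁ eq) = let (i , _ , c) = proj₂ (eq X v) in₁ 0 in ⊥-elim (out i c)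

  cut : TwoEnded G → Cut
  cut (ρ₁ , ρ₂ , ¬eq , all) with ¬∀⇒∃¬ ¬eq
  ... | X , h with ¬∀⇒∃¬ h
  ...   | v , k with em {InfManyIn G X v ρ₁ → InfManyIn G X v ρ₂}
  ...     | no ¬f = let (p , q) = ¬⇒ ¬f in separating-cut ρ₁ ρ₂ all X v p q
  ...     | yes f = let (p , q) = ¬⇒ (λ g → k (f , g)) in separating-cut ρ₂ ρ₁ (λ ρ → swap (all ρ)) X v p q

-- Translation lengths

+ℤ-cancelˡ : ∀ a {b c} → a ℤ.+ b ≡ a ℤ.+ c → b ≡ c
+ℤ-cancelˡ a {b} {c} eq = trans (cancel a b) (trans (cong (ℤ._+_ (ℤ.- a)) eq) (sym (cancel a c)))
  where
  cancel : ∀ a b → b ≡ ℤ.- a ℤ.+ (a ℤ.+ b)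
  cancel = solve-∀

-- What is kept of the cut: `Sh f z` stands for fixing both ends with normalised translation length
-- `z`, `Flip f` for exchanging them. The length is a relation; its uniqueness will follow from
-- `Sh-stab`.
record ShiftStructure (G : Graph) : Set₁ where
  open Automorphisms G
  field
    Sh       : Aut G → ℤ → Set
    Flip     : Aut G → Set
    dich     : ∀ f → (∃[ z ] Sh f z) ⊎ Flip f
    Sh-∘     : ∀ {f g a b} → Sh f a → Sh g b → Sh (f ∘ᴬ g) (a ℤ.+ b)
    Sh-inv   : ∀ {f a} → Sh f a → Sh (f ⁻ᴬ) (ℤ.- a)
    Sh-ext   : ∀ {f g a} → (∀ x → f • x ≡ g • x) → Sh f a → Sh g a
    Sh-stab  : ∀ {f a x} → Sh f a → f • x ≡ x → a ≡ 0ℤ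
    Sh-unit  : ∃[ f ] Sh f 1ℤ
    Sh-fin   : ∀ w → Finite (λ x → ∃[ f ] (Sh f 0ℤ × f • w ≡ x))
    Flip-∘   : ∀ {f g} → Flip f → Flip g → ∃[ z ] Sh (f ∘ᴬ g) z
    Flip-inv : ∀ {f} → Flip f → Flip (f ⁻ᴬ)
    Flip-conj : ∀ {f g a} → Flip f → Sh g a → Sh (f ∘ᴬ g ∘ᴬ f ⁻ᴬ) (ℤ.- a)

-- Signed differences of almost equal sets

module Differences (em : ExcludedMiddle 0ℓ) {A : Set} where
  open Counting em

  Agree : (A → Set) → (A → Set) → List A → Set
  Agree Y Z L = ∀ v → v ∉ L → (Y v → Z v) × (Z v → Y v)

  -- Y and Z differ finitely and |Y ∖ Z| − |Z ∖ Y| = n.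
  record Diff (Y Z : A → Set) (n : ℤ) : Set where
    constructor diff
    field
      support : List A
      unique  : Unique support
      agree   : Agree Y Z support
      count   : + ♯ Y support ≡ + ♯ Z support ℤ.+ n
  open Diff

  -- Outside the support the two sets agree, so enlarging the list adds the same number to both
  -- counts. This lets two differences be compared on a common support.
  Diff-on : ∀ {Y Z n} (d : Diff Y Z n) M → Unique M → (∀ x → x ∈ support d → x ∈ M) →
            + ♯ Y M ≡ + ♯ Z M ℤ.+ n
  Diff-on {Y} {Z} {n} (diff L uL ag eq) M uM L⊆M = begin
    + ♯ Y M                           ≡⟨ cong +_ (decompose Y) ⟩
    + (♯ Y L + ♯ (λ x → Y x × x ∉ L) M)
      ≡⟨ cong (λ k → + (♯ Y L + k)) (♯-cong M (λ x _ (y , o) → proj₁ (ag x o) y , o)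
                                              (λ x _ (z , o) → proj₂ (ag x o) z , o)) ⟩
    + (♯ Y L + rest)                  ≡⟨ ℤ.pos-+ (♯ Y L) rest ⟩
    + ♯ Y L ℤ.+ + rest                ≡⟨ cong (ℤ._+ + rest) eq ⟩
    + ♯ Z L ℤ.+ n ℤ.+ + rest          ≡⟨ shuffle (+ ♯ Z L) n (+ rest) ⟩
    + ♯ Z L ℤ.+ + rest ℤ.+ n          ≡⟨ cong (ℤ._+ n) (ℤ.pos-+ (♯ Z L) rest) ⟨
    + (♯ Z L + rest) ℤ.+ n            ≡⟨ cong (λ k → + k ℤ.+ n) (decompose Z) ⟨
    + ♯ Z M ℤ.+ n                     ∎
    where
    open ≡-Reasoning
    rest : ℕ
    rest = ♯ (λ x → Z x × x ∉ L) M
    shuffle : ∀ a b c → a ℤ.+ b ℤ.+ c ≡ a ℤ.+ c ℤ.+ b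
    shuffle = solve-∀
    decompose : ∀ W → ♯ W M ≡ ♯ W L + ♯ (λ x → W x × x ∉ L) M
    decompose W = trans (♯-split W (_∈ L) M) (cong (_+ ♯ (λ x → W x × x ∉ L) M)
      (≤-antisym (♯-⊆ uM (λ x _ (w , l) → l , w)) (♯-⊆ uL (λ x l w → L⊆M x l , (w , l)))))

  common : (L M : List A) → ∃[ N ] (Unique N × (∀ x → x ∈ L → x ∈ N) × (∀ x → x ∈ M → x ∈ N))
  common L M = let (N , u , sub , _) = unique-list (L ++ M) in
    N , u , (λ x → sub x ∘ ∈-++⁺ˡ) , λ x → sub x ∘ ∈-++⁺ʳ L

  Diff-refl : ∀ {Y} → Diff Y Y 0ℤ
  Diff-refl = diff [] [] (λ _ _ → id , id) refl

  Diff-trans : ∀ {Y Z W a b} → Diff Y Z a → Diff Z W b → Diff Y W (a ℤ.+ b)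
  Diff-trans {W = W} {a} {b} d d′ =
    let (N , u , l , m) = common (support d) (support d′) in diff N u
    (λ v o → proj₁ (agree d′ v (o ∘ m v)) ∘ proj₁ (agree d v (o ∘ l v)) ,
             proj₂ (agree d v (o ∘ l v)) ∘ proj₂ (agree d′ v (o ∘ m v)))
    (trans (Diff-on d N u l) (trans (cong (ℤ._+ a) (Diff-on d′ N u m)) (shuffle (+ ♯ W N) a b)))
    where
    shuffle : ∀ w a b → w ℤ.+ b ℤ.+ a ≡ w ℤ.+ (a ℤ.+ b)
    shuffle = solve-∀

  Diff-sym : ∀ {Y Z a} → Diff Y Z a → Diff Z Y (ℤ.- a)
  Diff-sym {Y} {Z} {a} (diff L u ag eq) = diff L u (λ v o → proj₂ (ag v o) , proj₁ (ag v o))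
    (trans (cancel (+ ♯ Z L) a) (cong (ℤ._+ ℤ.- a) (sym eq)))
    where
    cancel : ∀ z a → z ≡ z ℤ.+ a ℤ.+ ℤ.- a
    cancel = solve-∀

  Diff-congˡ : ∀ {Y Z W a} → (∀ x → (Y x → Z x) × (Z x → Y x)) → Diff Y W a → Diff Z W a
  Diff-congˡ h (diff L u ag eq) = diff L u
    (λ v o → proj₁ (ag v o) ∘ proj₂ (h v) , proj₁ (h v) ∘ proj₂ (ag v o))
    (trans (cong +_ (♯-cong L (λ x _ → proj₂ (h x)) (λ x _ → proj₁ (h x)))) eq)

  Diff-congʳ : ∀ {Y Z W a} → (∀ x → (Y x → Z x) × (Z x → Y x)) → Diff W Y a → Diff W Z a
  Diff-congʳ {Y} {Z} {W} {a} h d =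
    subst (Diff W Z) (ℤ.neg-involutive a) (Diff-sym (Diff-congˡ h (Diff-sym d)))

  Diff-¬ : ∀ {Y Z a} → Diff Y Z a → Diff (λ x → ¬ Y x) (λ x → ¬ Z x) (ℤ.- a)
  Diff-¬ {Y} {Z} {a} (diff L u ag eq) = diff L u
    (λ v o → (λ ¬y z → ¬y (proj₂ (ag v o) z)) , (λ ¬z y → ¬z (proj₁ (ag v o) y)))
    (+ℤ-cancelˡ (+ ♯ Y L) (begin
      + ♯ Y L ℤ.+ + ♯ (λ x → ¬ Y x) L            ≡⟨ total Y ⟩
      + length L                                 ≡⟨ total Z ⟨
      + ♯ Z L ℤ.+ ¬Z                             ≡⟨ shuffle (+ ♯ Z L) ¬Z a ⟩
      + ♯ Z L ℤ.+ a ℤ.+ (¬Z ℤ.+ ℤ.- a)           ≡⟨ cong (ℤ._+ (¬Z ℤ.+ ℤ.- a)) (sym eq) ⟩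
      + ♯ Y L ℤ.+ (¬Z ℤ.+ ℤ.- a)                 ∎))
    where
    open ≡-Reasoning
    ¬Z : ℤ
    ¬Z = + ♯ (λ x → ¬ Z x) L
    shuffle : ∀ z w a → z ℤ.+ w ≡ z ℤ.+ a ℤ.+ (w ℤ.+ ℤ.- a)
    shuffle = solve-∀
    total : ∀ W → + ♯ W L ℤ.+ + ♯ (λ x → ¬ W x) L ≡ + length L
    total W = trans (sym (ℤ.pos-+ (♯ W L) _)) (cong +_ (trans
      (cong₂ _+_ (♯-cong L (λ x m w → m , w) (λ _ _ → proj₂)) (♯-cong L (λ x m w → m , w) (λ _ _ → proj₂)))
      (trans (sym (♯-split (_∈ L) W L)) (♯-all L (λ _ → id)))))

  Diff-∘ : ∀ {Y Z a} (f f⁻ : A → A) → (∀ x → f (f⁻ x) ≡ x) → (∀ x → f⁻ (f x) ≡ x) →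
           Diff Y Z a → Diff (λ x → Y (f x)) (λ x → Z (f x)) a
  Diff-∘ {Y} {Z} {a} f f⁻ ff⁻ f⁻f (diff L u ag eq) = diff (map f⁻ L)
    (Unique.map⁺ (λ {x} {y} e → trans (sym (ff⁻ x)) (trans (cong f e) (ff⁻ y))) u)
    (λ v o → ag (f v) (λ m → o (subst (_∈ map f⁻ L) (f⁻f v) (∈-map⁺ f⁻ m))))
    (trans (cong +_ (pull Y)) (trans eq (cong (λ k → + k ℤ.+ a) (sym (pull Z)))))
    where
    pull : ∀ W → ♯ (W ∘ f) (map f⁻ L) ≡ ♯ W L
    pull W = trans (∑-map _ f⁻ L) (∑-cong L (λ x _ → cong (ι ∘ W) (ff⁻ x)))

  Diff-exists : ∀ {Y Z L} → Agree Y Z L → ∃[ a ] Diff Y Z a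
  Diff-exists {Y} {Z} {L} ag = let (M , u , sub , _) = unique-list L in
    + ♯ Y M ℤ.+ ℤ.- + ♯ Z M , diff M u (λ v o → ag v (o ∘ sub v)) (shuffle (+ ♯ Y M) (+ ♯ Z M))
    where
    shuffle : ∀ y z → y ≡ z ℤ.+ (y ℤ.+ ℤ.- z)
    shuffle = solve-∀

  Diff-strict : ∀ {Y Z a x} → (∀ v → Y v → Z v) → Z x → ¬ Y x → Diff Y Z a → a ≢ 0ℤ
  Diff-strict {Y} {Z} {a} {x} sub z ¬y (diff L u ag eq) refl =
    <⇒≢ (♯-mono-< {P = Y} {Z} L (λ v _ → sub v) (by-contradiction (λ o → ¬y (proj₂ (ag x o) z))) ¬y z)
        (ℤ.+-injective (trans eq (ℤ.+-identityʳ _)))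

least : ExcludedMiddle 0ℓ → (P : ℕ → Set) → ∃ P → ∃[ k ] (P k × (∀ j → j < k → ¬ P j))
least em P (n , p) = go n p (<-wellFounded n)
  where
  go : ∀ n → P n → Acc _<_ n → ∃[ k ] (P k × (∀ j → j < k → ¬ P j))
  go n p (acc rs) with em {∃[ j ] (j < n × P j)}
  ... | yes (j , lt , q) = go j q (rs lt)
  ... | no ne            = n , p , λ j lt q → ne (j , lt , q)

module Balls (G : Graph) (lf : LocallyFinite G) where
  open Automorphisms G

  Ball : V G → ℕ → V G → Set
  Ball v n x = Within (E G) n v x

  Ball-finite : ∀ v n → Finite (Ball v n)
  Ball-finite v n = ball n v , λ { x (k , le , p) → covers n v le p }
    where
    ball : ℕ → V G → List (V G)
    ball zero    v = v ∷ []
    ball (suc n) v = v ∷ concatMap (ball n) (proj₁ (lf v))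
    union : ∀ (f : V G → List (V G)) {x y} N → y ∈ N → x ∈ f y → x ∈ concatMap f N
    union f (z ∷ N) (here refl) x∈ = ∈-++⁺ˡ x∈
    union f (z ∷ N) (there y∈)  x∈ = ∈-++⁺ʳ (f z) (union f N y∈ x∈)
    covers : ∀ n v {x k} → k ≤ n → Walk (E G) v x k → x ∈ ball n v
    covers zero    v z≤n      here       = here refl
    covers (suc n) v le       here       = here refl
    covers (suc n) v (s≤s le) (step e p) =
      there (union (ball n) (proj₁ (lf v)) (proj₂ (lf v) _ e) (covers n _ le p))

  Ball-sym : ∀ {v x n} → Ball v n x → Ball x n v
  Ball-sym (k , le , p) = k , le , reverseʷ (E-sym G) p

  Ball-trans : ∀ {u v x m n} → Ball u m v → Ball v n x → Ball u (m + n) x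
  Ball-trans (k , le , p) (l , le′ , q) = k + l , +-mono-≤ le le′ , p ++ʷ q

  Ball-• : ∀ f {v x n} → Ball v n x → Ball (f • v) n (f • x)
  Ball-• f (k , le , p) = k , le , mapʷ (f •_) (E-pres f) p

module Translations (em : ExcludedMiddle 0ℓ) (G : Graph) (lf : LocallyFinite G) (conn : Connected G)
                    (vt : VertexTransitive G) (end-cut : Ends.Cut em G lf conn) where
  open Counting em
  open Automorphisms G
  open Ends em G lf conn
  open Cut end-cut
  open Differences em {V G}
  open Balls G lf

  record T (g : Aut G) (n : ℤ) : Set where
    constructor mkT
    field unT : Diff (λ x → C (g • x)) C n
  open T

  Pos Flip : Aut G → Set
  Pos g  = ∃[ n ] T g n
  Flip g = ∃[ n ] Diff (λ x → C (g • x)) (λ x → ¬ C x) n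

  Diff-• : ∀ {Y Z a} g → Diff Y Z a → Diff (λ x → Y (g • x)) (λ x → Z (g • x)) a
  Diff-• g = Diff-∘ (g •_) (g ⁻ᴬ •_) (invˡ g) (invʳ g)

  C-cong : ∀ {x y} → x ≡ y → (C x → C y) × (C y → C x)
  C-cong eq = subst C eq , subst C (sym eq)

  -- The homomorphism property: differences add up along (fg)⁻¹C, g⁻¹C, C, and the first of the two
  -- is the difference of f⁻¹C and C pulled back by the bijection `g`.
  T-∘ : ∀ {f g a b} → T f a → T g b → T (f ∘ᴬ g) (a ℤ.+ b)
  T-∘ {f} {g} (mkT s) (mkT t) = mkT (Diff-trans (Diff-• g s) t)

  T-ext : ∀ {f g a} → (∀ x → f • x ≡ g • x) → T f a → T g a
  T-ext h (mkT s) = mkT (Diff-congˡ (λ x → C-cong (h x)) s)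

  T-inv : ∀ {g a} → T g a → T (g ⁻ᴬ) (ℤ.- a)
  T-inv {g} (mkT s) = mkT (Diff-sym (Diff-congˡ (λ x → C-cong (invˡ g x)) (Diff-• (g ⁻ᴬ) s)))

  T-id : T idᴬ 0ℤ
  T-id = mkT Diff-refl

  T-iter : ∀ {g a} n → T g a → T (iter n g) (+ n ℤ.* a)
  T-iter {g} {a} zero    s = subst (T idᴬ) (sym (ℤ.*-zeroˡ a)) T-id
  T-iter {g} {a} (suc n) s = subst (T (iter (suc n) g)) (sym (ℤ.suc-* (+ n) a)) (T-∘ s (T-iter n s))

  -- Complementation reverses the sign of a difference, and the contribution `n` of `f` enters once
  -- with each sign.
  Flip-conj : ∀ {f g a} → Flip f → T g a → T (f ∘ᴬ g ∘ᴬ f ⁻ᴬ) (ℤ.- a)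
  Flip-conj {f} {g} {a} (n , d) (mkT s) = mkT (Diff-congʳ (λ x → C-cong (invˡ f x)) (Diff-• (f ⁻ᴬ) total))
    where
    shuffle : ∀ n a → n ℤ.+ (ℤ.- a ℤ.+ ℤ.- n) ≡ ℤ.- a
    shuffle = solve-∀
    total : Diff (λ x → C (f • g • x)) (λ x → C (f • x)) (ℤ.- a)
    total = subst (Diff _ _) (shuffle n a)
      (Diff-trans (Diff-• g d) (Diff-trans (Diff-¬ s) (Diff-sym d)))

  T-conj : ∀ {f g a} → Pos f → T g a → T (f ∘ᴬ g ∘ᴬ f ⁻ᴬ) a
  T-conj {f} {g} {a} (n , s) t = subst (T (f ∘ᴬ g ∘ᴬ f ⁻ᴬ)) (shuffle n a) (T-∘ s (T-∘ t (T-inv s)))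
    where
    shuffle : ∀ n a → n ℤ.+ (a ℤ.+ ℤ.- n) ≡ a
    shuffle = solve-∀

  Flip-∘ : ∀ {f g} → Flip f → Flip g → Pos (f ∘ᴬ g)
  Flip-∘ {f} {g} (a , s) (b , t) = _ , mkT
    (Diff-congʳ (λ x → by-contradiction , λ c n → n c) (Diff-trans (Diff-• g s) (Diff-¬ t)))

  Flip-inv : ∀ {f} → Flip f → Flip (f ⁻ᴬ)
  Flip-inv {f} (a , s) = _ , Diff-congˡ (λ x → by-contradiction , λ c n → n c)
    (Diff-¬ (Diff-sym (Diff-congˡ (λ x → C-cong (invˡ f x)) (Diff-• (f ⁻ᴬ) s))))

  -- The set f⁻¹C has finite boundary, so up to finitely many vertices it contains or misses each
  -- side of the cut. Missing both would make C finite, containing both would make its complement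
  -- finite.
  dich : ∀ f → Pos f ⊎ Flip f
  dich f with split Y fY | split-¬ Y fY
    where
    Y : V G → Set
    Y x = C (f • x)
    fY : FinB Y
    fY = FinB-∘ {C} f finB
  ... | inj₁ (L , p) | inj₁ (M , q) = ⊥-elim (inf (map (f •_) (L ++ M) , λ x c →
          subst (_∈ map (f •_) (L ++ M)) (invˡ f x) (∈-map⁺ (f •_) (covered (f ⁻ᴬ • x) (subst C (sym (invˡ f x)) c)))))
    where
    covered : ∀ x → C (f • x) → x ∈ L ++ M
    covered x y with em {C x}
    ... | yes c = ∈-++⁺ˡ (p x (c , y))
    ... | no ¬c = ∈-++⁺ʳ L (q x (¬c , y))
  ... | inj₁ (L , p) | inj₂ (M , q) = inj₂ (Diff-exists {L = L ++ M} λ x o →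
          (λ y c → o (∈-++⁺ˡ (p x (c , y)))) , λ ¬c → by-contradiction λ ¬y → o (∈-++⁺ʳ L (q x (¬c , ¬y))))
  ... | inj₂ (L , p) | inj₁ (M , q) = let (n , d) = Diff-exists {L = L ++ M} λ x o →
                                               (λ y → by-contradiction λ ¬c → o (∈-++⁺ʳ L (q x (¬c , y)))) ,
                                               (λ c → by-contradiction λ ¬y → o (∈-++⁺ˡ (p x (c , ¬y))))
                                in inj₁ (n , mkT d)
  ... | inj₂ (L , p) | inj₂ (M , q) = ⊥-elim (co-inf (map (f •_) (L ++ M) , λ x ¬c →
          subst (_∈ map (f •_) (L ++ M)) (invˡ f x)
            (∈-map⁺ (f •_) (covered (f ⁻ᴬ • x) (¬c ∘ subst C (invˡ f x))))))
    where
    covered : ∀ x → ¬ C (f • x) → x ∈ L ++ M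
    covered x ¬y with em {C x}
    ... | yes c = ∈-++⁺ˡ (p x (c , ¬y))
    ... | no ¬c = ∈-++⁺ʳ L (q x (¬c , ¬y))

  closed-full : ∀ {Y : V G → Set} → (∀ {x y} → E G x y → Y x → Y y) → ∀ {a} b → Y a → Y b
  closed-full {Y} cl {a} b ya = go (proj₂ (conn a b)) ya
    where
    go : ∀ {a n} → Walk (E G) a b n → Y a → Y b
    go here       y = y
    go (step e p) y = go p (cl e y)

  some-C : ∃[ x ] C x
  some-C = by-contradiction λ ne → inf ([] , λ x c → ⊥-elim (ne (x , c)))

  some-¬C : ∃[ x ] ¬ C x
  some-¬C = by-contradiction λ ne → co-inf ([] , λ x c → ⊥-elim (ne (x , c)))

  crossing : ∃[ x ] ∃[ y ] (E G x y × C x × ¬ C y)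
  crossing = by-contradiction λ ne → proj₂ some-¬C
    (closed-full {C} (λ {x} {y} e c → by-contradiction λ ¬c → ne (x , y , e , c , ¬c)) (proj₁ some-¬C) (proj₂ some-C))

  v₀ : V G
  v₀ = proj₁ some-C

  radius : ∃[ rad ] (∀ x → x ∈ proj₁ finB → Ball v₀ rad x)
  radius = go (proj₁ finB)
    where
    go : ∀ L → ∃[ rad ] (∀ x → x ∈ L → Ball v₀ rad x)
    go []      = 0 , λ x ()
    go (y ∷ L) with go L | conn v₀ y
    ... | rad , h | d , p = rad ⊔ d , λ
      { x (here refl) → d , m≤n⊔m rad d , p
      ; x (there m)   → let (k , le , q) = h x m in k , ≤-trans le (m≤m⊔n rad d) , q }

  rad : ℕ
  rad = proj₁ radius

  -- A ball around the boundary of `C` instead of the boundary itself, because a ball is connected: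
  -- a set whose boundary lies elsewhere is constant on it.
  Core : V G → Set
  Core = Ball v₀ rad

  boundary-Core : ∀ {x y} → E G x y → C x → ¬ C y → Core x × Core y
  boundary-Core e c ¬c = let (p , q) = proj₂ finB e c ¬c in proj₂ radius _ p , proj₂ radius _ q

  record Displaced (g : Aut G) : Set where
    constructor displaced
    field displaces : ∀ x → Core x → ¬ Core (g • x)
  open Displaced

  Displaced-inv : ∀ {g} → Displaced g → Displaced (g ⁻ᴬ)
  Displaced-inv {g} d = displaced λ x b b′ → displaces d (g ⁻ᴬ • x) b′ (subst Core (sym (invˡ g x)) b)

  -- The image of the core is connected and disjoint from the core, which contains every end of
  -- every edge between `C` and its complement.
  constant-on-Core : ∀ {g} → Displaced g → ∀ {x} → Core x → (C (g • v₀) → C (g • x)) × (C (g • x) → C (g • v₀))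
  constant-on-Core {g} d (n , le , p) = go 0 here p le
    where
    go : ∀ {y x n} i → Walk (E G) v₀ y i → Walk (E G) y x n → i + n ≤ rad →
         (C (g • y) → C (g • x)) × (C (g • x) → C (g • y))
    go i w here le = id , id
    go {y} {n = suc n} i w (step {b = b} e p) le with go (suc i) (snocʷ w e) p (subst (_≤ rad) (+-suc i n) le)
    ... | to , from = (λ c → to (by-contradiction λ ¬c → away (proj₁ (boundary-Core (E-pres g e) c ¬c)))) ,
                      (λ c → by-contradiction λ ¬c → away (proj₂ (boundary-Core (E-pres g (E-sym G e)) (from c) ¬c)))
      where
      away : ¬ Core (g • y)
      away = displaces d y (i , ≤-trans (m≤m+n i (suc n)) le , w)

  -- A set with no boundary edge is empty or full, so P ∩ Q is empty once each of the two
  -- boundaries lies outside the other set.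
  disjoint : ∀ {P Q Bp Bq : V G → Set} →
    (∀ {x y} → E G x y → P x → ¬ P y → Bp x × Bp y) → (∀ {x y} → E G x y → Q x → ¬ Q y → Bq x × Bq y) →
    (∀ {x} → Bp x → ¬ Q x) → (∀ {x} → Bq x → ¬ P x) → ∀ {z} → ¬ (P z × Q z) → ∀ x → ¬ (P x × Q x)
  disjoint {P} {Q} bp bq out₁ out₂ {z} nz x pq = nz (closed-full {λ y → P y × Q y} cl z pq)
    where
    cl : ∀ {x y} → E G x y → P x × Q x → P y × Q y
    cl e (p , q) = by-contradiction (λ ¬p → out₁ (proj₁ (bp e p ¬p)) q) ,
                   by-contradiction (λ ¬q → out₂ (proj₁ (bq e q ¬q)) p)

  data Nested (g : Aut G) : Set where
    down : (∀ x → C (g • x) → C x) → (∀ x → Core x → ¬ C (g • x)) → (∀ x → Core (g • x) → C x) → Nested g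
    up   : (∀ x → C x → C (g • x)) → (∀ x → Core x → C (g • x)) → (∀ x → Core (g • x) → ¬ C x) → Nested g

  boundary-∘ : ∀ g {x y} → E G x y → C (g • x) → ¬ C (g • y) → Core (g • x) × Core (g • y)
  boundary-∘ g e = boundary-Core (E-pres g e)

  boundary-¬ : ∀ {x y} → E G x y → ¬ C x → ¬ ¬ C y → Core x × Core y
  boundary-¬ e ¬c nn = let (p , q) = boundary-Core (E-sym G e) (by-contradiction nn) ¬c in q , p

  -- The sides containing the image and the preimage of the core determine which side of g⁻¹C is
  -- disjoint from which side of C. Two of the four cases are the inclusions. In the other two g⁻¹C
  -- and C are disjoint or cover all vertices, which makes C or its complement finite because the
  -- two sets differ finitely.
  nested : ∀ {g} → Displaced g → Pos g → Nested g
  nested {g} d (_ , mkT (diff L _ ag _)) with em {C (g • v₀)} | em {C (g ⁻ᴬ • v₀)}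
  ... | no ¬p | yes q = down (λ x c → by-contradiction λ ¬c →
          disjoint {λ x → C (g • x)} {λ x → ¬ C x} {λ x → Core (g • x)} {Core} (boundary-∘ g) boundary-¬
            (λ b n → n (inner b)) outer {proj₁ some-C} (λ (_ , n) → n (proj₂ some-C)) x (c , ¬c))
          (λ x → outer) (λ x → inner)
    where
    outer : ∀ {x} → Core x → ¬ C (g • x)
    outer b c = ¬p (proj₂ (constant-on-Core d b) c)
    inner : ∀ {x} → Core (g • x) → C x
    inner {x} b = proj₁ (C-cong (invʳ g x)) (proj₁ (constant-on-Core (Displaced-inv d) b) q)
  ... | yes p | no ¬q = up (λ x c → by-contradiction λ ¬c →
          disjoint {λ x → ¬ C (g • x)} {C} {λ x → Core (g • x)} {Core} (λ e → boundary-¬ (E-pres g e)) boundary-Core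
            inner (λ b n → n (outer b)) {proj₁ some-¬C} (λ (_ , c) → proj₂ some-¬C c) x (¬c , c))
          (λ x → outer) (λ x → inner)
    where
    outer : ∀ {x} → Core x → C (g • x)
    outer b = proj₁ (constant-on-Core d b) p
    inner : ∀ {x} → Core (g • x) → ¬ C x
    inner {x} b c = ¬q (proj₂ (constant-on-Core (Displaced-inv d) b) (proj₂ (C-cong (invʳ g x)) c))
  ... | yes p | yes q = ⊥-elim (co-inf (L , λ x ¬c → by-contradiction λ o →
          disjoint {λ x → ¬ C (g • x)} {λ x → ¬ C x} {λ x → Core (g • x)} {Core} (λ e → boundary-¬ (E-pres g e)) boundary-¬
            (λ b n → n (inner b)) (λ b n → n (outer b)) {proj₁ some-C} (λ (_ , n) → n (proj₂ some-C)) x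
            ((λ c → ¬c (proj₁ (ag x o) c)) , ¬c)))
    where
    outer : ∀ {x} → Core x → C (g • x)
    outer b = proj₁ (constant-on-Core d b) p
    inner : ∀ {x} → Core (g • x) → C x
    inner {x} b = proj₁ (C-cong (invʳ g x)) (proj₁ (constant-on-Core (Displaced-inv d) b) q)
  ... | no ¬p | no ¬q = ⊥-elim (inf (L , λ x c → by-contradiction λ o →
          disjoint {λ x → C (g • x)} {C} {λ x → Core (g • x)} {Core} (boundary-∘ g) boundary-Core
            inner outer {proj₁ some-¬C} (λ (_ , c) → proj₂ some-¬C c) x (proj₂ (ag x o) c , c)))
    where
    outer : ∀ {x} → Core x → ¬ C (g • x)
    outer b c = ¬p (proj₂ (constant-on-Core d b) c)
    inner : ∀ {x} → Core (g • x) → ¬ C x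
    inner {x} b c = ¬q (proj₂ (constant-on-Core (Displaced-inv d) b) (proj₂ (C-cong (invʳ g x)) c))

  displaced-shift : ∀ {g n} → Displaced g → T g n → n ≢ 0ℤ
  displaced-shift {g} {n} d t with nested d (n , t) | crossing
  ... | down sub out _ | x , y , e , c , ¬c =
        Diff-strict sub c (out x (proj₁ (boundary-Core e c ¬c))) (T.unT t)
  ... | up sub inn _   | x , y , e , c , ¬c = λ { refl →
        Diff-strict sub (inn y (proj₂ (boundary-Core e c ¬c))) ¬c (Diff-sym (T.unT t)) refl }

  -- The first image of the core lies on one side of `C`, and by the inclusion all later images stay
  -- there, whereas a point that `g` sends into the core lies on the other side.
  displaced-powers : ∀ {g} → Displaced g → Pos g → ∀ k x → Core x → ¬ Core (iter (suc k) g • x)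
  displaced-powers {g} d p k x b with nested d p
  ... | down sub out inn = λ b′ → far k b′
    where
    outside : ∀ k → ¬ C (iter (suc k) g • x)
    outside zero    c = out x b c
    outside (suc k) c = outside k (sub _ c)
    far : ∀ k → ¬ Core (iter (suc k) g • x)
    far zero    b′ = displaces d x b b′
    far (suc k) b′ = outside k (inn _ b′)
  ... | up sub out inn = λ b′ → far k b′
    where
    inside : ∀ k → C (iter (suc k) g • x)
    inside zero    = out x b
    inside (suc k) = sub _ (inside k)
    far : ∀ k → ¬ Core (iter (suc k) g • x)
    far zero    b′ = displaces d x b b′
    far (suc k) b′ = inn _ b′ (inside k)

  outside-ball : ∀ v n → ∃[ x ] ¬ Ball v n x
  outside-ball v n = by-contradiction λ ne → inf (Finite-⊆ {C} {Ball v n}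
    (λ x _ → by-contradiction λ n → ne (x , n)) (Ball-finite v n))

  displacing : ∀ g v x → g • v₀ ≡ x → ¬ Ball v (rad + rad) x → ∀ y → Ball v rad y → ¬ (∃[ z ] (Core z × g • z ≡ y))
  displacing g v x refl far y b (z , bz , refl) = far (Ball-trans b (Ball-sym (Ball-• g bz)))

  both-far : ∀ v w n → ∃[ x ] (¬ Ball v n x × ¬ Ball w n x)
  both-far v w n = by-contradiction λ ne → inf (Finite-∪ {C} {Ball v n} {Ball w n} (λ x _ → dec ne x)
                     (Ball-finite v n) (Ball-finite w n))
    where
    dec : ¬ (∃[ x ] (¬ Ball v n x × ¬ Ball w n x)) → ∀ x → Ball v n x ⊎ Ball w n x
    dec ne x with em {Ball v n x}
    ... | yes p = inj₁ p
    ... | no ¬p = inj₂ (by-contradiction λ ¬q → ne (x , ¬p , ¬q))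

  -- A far move of `v₀` may exchange the ends. Then a second automorphism is chosen that moves `v₀`
  -- far from both `v₀` and its first image; if it exchanges the ends too, f₁⁻¹f₂ fixes them and
  -- still displaces the core.
  displaced-exists : ∃[ g ] (Displaced g × Pos g)
  displaced-exists with outside-ball v₀ (rad + rad)
  ... | x₁ , far₁ with vt v₀ x₁
  ... | f₁ , eq₁ with dich f₁
  ... | inj₁ p = f₁ , displaced (λ z bz b → displacing f₁ v₀ x₁ eq₁ far₁ (f₁ • z) b (z , bz , refl)) , p
  ... | inj₂ fl₁ with both-far v₀ x₁ (rad + rad)
  ... | x₂ , far₂ , far₁₂ with vt v₀ x₂
  ... | f₂ , eq₂ with dich f₂
  ... | inj₁ p = f₂ , displaced (λ z bz b → displacing f₂ v₀ x₂ eq₂ far₂ (f₂ • z) b (z , bz , refl)) , p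
  ... | inj₂ fl₂ = f₁ ⁻ᴬ ∘ᴬ f₂ , disp , Flip-∘ {f₁ ⁻ᴬ} {f₂} (Flip-inv {f₁} fl₁) fl₂
    where
    disp : Displaced (f₁ ⁻ᴬ ∘ᴬ f₂)
    disp = displaced λ z bz b → displacing f₂ x₁ x₂ eq₂ far₁₂ (f₂ • z)
      (subst₂ (λ v w → Ball v rad w) eq₁ (invˡ f₁ (f₂ • z)) (Ball-• f₁ b)) (z , bz , refl)

  positive : ∃[ g ] ∃[ k ] (Displaced g × T g (+ suc k))
  positive with displaced-exists
  ... | g , d , (+ zero , t)     = ⊥-elim (displaced-shift d t refl)
  ... | g , d , (+ suc k , t)    = g , k , d , t
  ... | g , d , (-[1+ k ] , t)   = g ⁻ᴬ , k , Displaced-inv d , T-inv t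

  -- If g fixes v₀ and shifts, some gʲaᵏ with k ≥ 1 has shift 0 although it displaces the core.
  no-negative-stabilizer : ∀ {g a n k} → Displaced a → T a (+ suc k) → T g (ℤ.- + suc n) → g • v₀ ≡ v₀ → ⊥
  no-negative-stabilizer {g} {a} {n} {k} d s t fix = displaced-shift disp zero-shift refl
    where
    cancel : ∀ x y → x ℤ.* ℤ.- y ℤ.+ y ℤ.* x ≡ 0ℤ
    cancel = solve-∀
    h : Aut G
    h = iter (suc k) g ∘ᴬ iter (suc n) a
    zero-shift : T h 0ℤ
    zero-shift = subst (T h) (cancel (+ suc k) (+ suc n)) (T-∘ (T-iter (suc k) t) (T-iter (suc n) s))
    fix⁻ : g ⁻ᴬ • v₀ ≡ v₀
    fix⁻ = trans (cong (g ⁻ᴬ •_) (sym fix)) (invʳ g v₀)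
    back : ∀ j {x} → Core (iter j g • x) → Core x
    back zero    b = b
    back (suc j) {x} b = back j (subst₂ (λ v w → Ball v rad w) fix⁻ (invʳ g (iter j g • x)) (Ball-• (g ⁻ᴬ) b))
    disp : Displaced h
    disp = displaced λ x bx b → displaced-powers d (_ , s) n x bx (back (suc k) b)

  stabilizer-shift : ∀ {g n} → T g n → g • v₀ ≡ v₀ → n ≡ 0ℤ
  stabilizer-shift {g} {+ zero}    t fix = refl
  stabilizer-shift {g} {+ suc n}   t fix = let (a , k , d , s) = positive in
    ⊥-elim (no-negative-stabilizer d s (T-inv t) (trans (cong (g ⁻ᴬ •_) (sym fix)) (invʳ g v₀)))
  stabilizer-shift {g} { -[1+ n ]} t fix = let (a , k , d , s) = positive in
    ⊥-elim (no-negative-stabilizer d s t fix)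

  -- Conjugation may change the sign of a length but not whether it is 0, which suffices to carry
  -- the statements about `v₀` to every other vertex.
  conj-shift : ∀ f {g a} → T g a → ∃[ b ] (T (f ∘ᴬ g ∘ᴬ f ⁻ᴬ) b × (b ≡ 0ℤ → a ≡ 0ℤ) × (a ≡ 0ℤ → b ≡ 0ℤ))
  conj-shift f {g} {a} t with dich f
  ... | inj₁ p  = a , T-conj p t , id , id
  ... | inj₂ fl = ℤ.- a , Flip-conj {f} fl t , (λ eq → ℤ.neg-injective eq) , λ eq → cong (λ z → ℤ.- z) eq

  T-stab : ∀ {g a x} → T g a → g • x ≡ x → a ≡ 0ℤ
  T-stab {g} {a} {x} t fix = let (f , eq) = vt v₀ x ; (b , s , back , _) = conj-shift (f ⁻ᴬ) t in
    back (stabilizer-shift s (trans (cong (λ y → f ⁻ᴬ • g • y) eq) (trans (cong (f ⁻ᴬ •_) (trans fix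
        (sym eq))) (invʳ f v₀))))

  T-fin : ∀ w → Finite (λ x → ∃[ g ] (T g 0ℤ × g • w ≡ x))
  T-fin w = let (f , eq) = vt v₀ w ; (L , near) = Ball-finite v₀ (rad + rad) in
    map (f •_) L , λ x (g , t , gw≡x) → let (b , s , _ , b≡0) = conj-shift (f ⁻ᴬ) t in
      subst (_∈ map (f •_) L) (trans (invˡ f (g • f • v₀)) (trans (cong (g •_) eq) gw≡x))
        (∈-map⁺ (f •_) (near (f ⁻ᴬ • g • f • v₀) (close (subst (T (f ⁻ᴬ ∘ᴬ g ∘ᴬ f ⁻ᴬ ⁻ᴬ)) (b≡0 refl) s))))
    where
    close : ∀ {g} → T g 0ℤ → Ball v₀ (rad + rad) (g • v₀)
    close {g} t = by-contradiction λ far → displaced-shift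
      (displaced λ x b b′ → far (Ball-trans b′ (Ball-sym (Ball-• g b)))) t refl

  T-power : ∀ {g a} z → T g a → ∃[ h ] T h (z ℤ.* a)
  T-power {g} {a} (+ n)    t = iter n g , T-iter n t
  T-power {g} {a} -[1+ n ] t = iter (suc n) g ⁻ᴬ ,
    subst (T (iter (suc n) g ⁻ᴬ)) (ℤ.neg-distribˡ-* (+ suc n) a) (T-inv (T-iter (suc n) t))

  minimal : ∃[ k ] ((∃[ g ] T g (+ suc k)) × (∀ j → j < k → ¬ (∃[ g ] T g (+ suc j))))
  minimal = least em (λ k → ∃[ g ] T g (+ suc k)) (let (g , k , _ , t) = positive in k , g , t)

  module Normalise (k : ℕ) (unit : ∃[ g ] T g (+ suc k)) (min : ∀ j → j < k → ¬ (∃[ g ] T g (+ suc j))) where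

    m : ℕ
    m = suc k

    divisible : ∀ {g a} → T g a → ∃[ z ] a ≡ z ℤ.* + m
    divisible {g} {a} t = go (a ℤ.%ℕ m) (a ℤ./ℕ m) (ℤ.a≡a%ℕn+[a/ℕn]*n a m) (ℤ.n%ℕd<d a m)
      where
      cancel : ∀ r q → r ℤ.+ q ℤ.+ ℤ.- q ≡ r
      cancel = solve-∀
      go : ∀ r q → a ≡ + r ℤ.+ q ℤ.* + m → r < m → ∃[ z ] a ≡ z ℤ.* + m
      go zero    q eq lt = q , trans eq (ℤ.+-identityˡ _)
      -- A non-zero remainder would itself be a positive length smaller than the least one.
      go (suc r) q eq lt = let (h , s) = T-power q (proj₂ unit) in
        ⊥-elim (min r (s≤s⁻¹ lt) (g ∘ᴬ h ⁻ᴬ ,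
          subst (T (g ∘ᴬ h ⁻ᴬ)) (trans (cong (ℤ._+ ℤ.- (q ℤ.* + m)) eq) (cancel (+ suc r) (q ℤ.* + m)))
            (T-∘ t (T-inv s))))

    normalised-structure : ShiftStructure G
    normalised-structure = record
      { Sh        = λ g z → T g (z ℤ.* + m)
      ; Flip      = Flip
      ; dich      = λ f → normalised f (dich f)
      ; Sh-∘      = λ {f} {g} {a} {b} s t → subst (T (f ∘ᴬ g)) (sym (ℤ.*-distribʳ-+ (+ m) a b)) (T-∘ s t)
      ; Sh-inv    = λ {f} {a} s → subst (T (f ⁻ᴬ)) (ℤ.neg-distribˡ-* a (+ m)) (T-inv s)
      ; Sh-ext    = λ h → T-ext h
      ; Sh-stab   = λ {f} {a} s fix → cancel-m a (T-stab s fix)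
      ; Sh-unit   = let (g , t) = unit in g , subst (T g) (sym (ℤ.*-identityˡ (+ m))) t
      ; Sh-fin    = T-fin
      ; Flip-∘    = λ {f} {g} s t → let (a , u) = Flip-∘ {f} {g} s t ; (z , eq) = divisible u in z , subst (T (f ∘ᴬ g)) eq u
      ; Flip-inv  = λ {f} → Flip-inv {f}
      ; Flip-conj = λ {f} {g} {a} fl t → subst (T (f ∘ᴬ g ∘ᴬ f ⁻ᴬ)) (ℤ.neg-distribˡ-* a (+ m)) (Flip-conj {f} fl t) }
      where
      cancel-m : ∀ a → a ℤ.* + m ≡ 0ℤ → a ≡ 0ℤ
      cancel-m a eq with ℤ.i*j≡0⇒i≡0∨j≡0 a eq
      ... | inj₁ p = p
      ... | inj₂ ()
      normalised : ∀ f → Pos f ⊎ Flip f → (∃[ z ] T f (z ℤ.* + m)) ⊎ Flip f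
      normalised f (inj₂ fl) = inj₂ fl
      normalised f (inj₁ (a , t)) = let (z , eq) = divisible t in inj₁ (z , subst (T f) eq t)

  shift-structure : ShiftStructure G
  shift-structure = let (k , unit , min) = minimal in Normalise.normalised-structure k unit min

-- Heights

-- To derive x ≡ y from the linear hypothesis a ≡ b it suffices that x − y = a − b identically.
linear : ∀ {x y a b} → x ℤ.+ b ≡ y ℤ.+ a → a ≡ b → x ≡ y
linear {x} {y} {a} {b} eq refl = +ℤ-cancelˡ a (trans (ℤ.+-comm a x) (trans eq (ℤ.+-comm y a)))

≡-neg⇒≡0 : ∀ {z} → ℤ.- z ≡ z → z ≡ 0ℤ
≡-neg⇒≡0 {+ zero}     _ = refl
≡-neg⇒≡0 {+ suc n}    ()
≡-neg⇒≡0 { -[1+ n ]} ()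

abs-≤ : ∀ {i n} → i ℤ.≤ + n → ℤ.- + n ℤ.≤ i → ∣ i ∣ ≤ n
abs-≤ {+ k}      le _  = ℤ.drop‿+≤+ le
abs-≤ { -[1+ k ]} {n} _ ge = ℤ.drop‿+≤+ (subst (ℤ._≤_ (+ suc k)) (ℤ.neg-involutive (+ n)) (ℤ.neg-mono-≤ ge))

abs-cases : ∀ i → i ≡ + ∣ i ∣ ⊎ i ≡ ℤ.- + ∣ i ∣
abs-cases (+ n)          = inj₁ refl
abs-cases -[1+ n ]       = inj₂ refl

abs-difference : ∀ {a b c d} → a ℤ.+ d ≡ b ℤ.+ c ⊎ a ℤ.+ c ≡ b ℤ.+ d → ∣ a ℤ.- b ∣ ≡ ∣ c ℤ.- d ∣
abs-difference {a} {b} {c} {d} (inj₁ eq) = cong ∣_∣ (linear {a ℤ.- b} {c ℤ.- d} (lemma a b c d) eq)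
  where
  lemma : ∀ a b c d → a ℤ.- b ℤ.+ (b ℤ.+ c) ≡ c ℤ.- d ℤ.+ (a ℤ.+ d)
  lemma = solve-∀
abs-difference {a} {b} {c} {d} (inj₂ eq) =
  trans (cong ∣_∣ (linear {a ℤ.- b} {ℤ.- (c ℤ.- d)} (lemma a b c d) eq)) (ℤ.∣-i∣≡∣i∣ (c ℤ.- d))
  where
  lemma : ∀ a b c d → a ℤ.- b ℤ.+ (b ℤ.+ d) ≡ ℤ.- (c ℤ.- d) ℤ.+ (a ℤ.+ c)
  lemma = solve-∀

-- `_∼_` is the relation of lying in one orbit of Γ⁺, and `∼-two` says that there are at most two.
-- The disjunction in `balanced` stands outside the quantifier: the rising edges must be of one kind
-- throughout, so that their numbers can be compared between levels.
record HeightStructure (G : Graph) : Set₁ where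
  open Automorphisms G
  infix 4 _∼_
  field
    _∼_      : V G → V G → Set
    ∼-refl   : ∀ {u} → u ∼ u
    ∼-sym    : ∀ {u v} → u ∼ v → v ∼ u
    ∼-trans  : ∀ {u v w} → u ∼ v → v ∼ w → u ∼ w
    ∼-•      : ∀ f {u v} → u ∼ v → (f • u) ∼ (f • v)
    ∼-two    : ∀ {u v w} → ¬ u ∼ v → ¬ v ∼ w → u ∼ w
    h        : V G → ℤ
    moves    : ∀ {u v} → u ∼ v →
               ∃[ g ] (g • u ≡ v × (∀ x → h (g • x) ℤ.+ h u ≡ h x ℤ.+ h v) × (∀ x → x ∼ (g • x)))
    aut-h    : ∀ f → (∀ x y → h (f • x) ℤ.+ h y ≡ h (f • y) ℤ.+ h x)
                   ⊎ (∀ x y → h (f • x) ℤ.+ h x ≡ h (f • y) ℤ.+ h y)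
    attained     : ∀ i → ∃[ v ] h v ≡ i
    level-finite : ∀ i → Finite (λ v → h v ≡ i)
    t        : ℕ
    t≥1      : 1 ≤ t
    edge-≤   : ∀ {x y} → E G x y → ∣ h y ℤ.- h x ∣ ≤ t
    balanced : (∀ x → ∃[ y ] (E G x y × h y ≡ h x ℤ.+ + t × x ∼ y))
             ⊎ (∀ x → ∃[ y ] (E G x y × h y ≡ h x ℤ.+ + t × ¬ x ∼ y))

module Heights (em : ExcludedMiddle 0ℓ) (G : Graph) (lf : LocallyFinite G) (conn : Connected G)
               (vt : VertexTransitive G) (v₀ : V G) (S : ShiftStructure G) where
  open Counting em
  open Automorphisms G
  open ShiftStructure S

  Sh-det : ∀ {f g a b x} → Sh f a → Sh g b → f • x ≡ g • x → a ≡ b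
  Sh-det {f} {g} {a} {b} {x} s t eq = linear {a} {b} {ℤ.- b ℤ.+ a} {0ℤ} (lemma a b)
    (Sh-stab (Sh-∘ (Sh-inv t) s) (trans (cong (g ⁻ᴬ •_) eq) (invʳ g x)))
    where
    lemma : ∀ a b → a ℤ.+ 0ℤ ≡ b ℤ.+ (ℤ.- b ℤ.+ a)
    lemma = solve-∀

  Sh-id : Sh idᴬ 0ℤ
  Sh-id = let (u , s) = Sh-unit in Sh-ext (λ x → invˡ u x) (Sh-∘ s (Sh-inv s))

  Sh-iter : ∀ n → ∃[ g ] Sh g (+ n)
  Sh-iter zero    = idᴬ , Sh-id
  Sh-iter (suc n) = let (u , s) = Sh-unit ; (g , r) = Sh-iter n in u ∘ᴬ g , Sh-∘ s r

  Sh-any : ∀ z → ∃[ g ] Sh g z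
  Sh-any (+ n)    = Sh-iter n
  Sh-any -[1+ n ] = let (g , r) = Sh-iter (suc n) in g ⁻ᴬ , Sh-inv r

  Sh-conj : ∀ {f g a b} → Sh f a → Sh g b → Sh (f ∘ᴬ g ∘ᴬ f ⁻ᴬ) b
  Sh-conj {f} {g} {a} {b} s t = subst (Sh (f ∘ᴬ g ∘ᴬ f ⁻ᴬ)) (lemma a b) (Sh-∘ s (Sh-∘ t (Sh-inv s)))
    where
    lemma : ∀ a b → a ℤ.+ (b ℤ.+ ℤ.- a) ≡ b
    lemma = solve-∀

  -- `f` commutes with its square, while conjugation by `f` negates lengths; so the length of the
  -- square equals its own negative.
  Flip-square : ∀ {f} → Flip f → Sh (f ∘ᴬ f) 0ℤ
  Flip-square {f} fl = let (z , s) = Flip-∘ fl fl in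
    subst (Sh (f ∘ᴬ f)) (≡-neg⇒≡0 (Sh-det {x = v₀} (Flip-conj fl s) s (cong (λ x → f • f • x) (invˡ f v₀)))) s

  infix 4 _∼_
  _∼_ : V G → V G → Set
  u ∼ v = ∃[ g ] ∃[ z ] (Sh g z × g • u ≡ v)

  ∼-refl : ∀ {u} → u ∼ u
  ∼-refl = idᴬ , 0ℤ , Sh-id , refl

  ∼-sym : ∀ {u v} → u ∼ v → v ∼ u
  ∼-sym (g , z , s , refl) = g ⁻ᴬ , ℤ.- z , Sh-inv s , invʳ g _

  ∼-trans : ∀ {u v w} → u ∼ v → v ∼ w → u ∼ w
  ∼-trans (g , a , s , refl) (f , b , r , refl) = f ∘ᴬ g , b ℤ.+ a , Sh-∘ r s , refl

  ∼-• : ∀ f {u v} → u ∼ v → (f • u) ∼ (f • v)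
  ∼-• f (g , a , s , refl) with dich f
  ... | inj₁ (b , r) = f ∘ᴬ g ∘ᴬ f ⁻ᴬ , a , Sh-conj r s , cong (λ x → f • g • x) (invʳ f _)
  ... | inj₂ fl      = f ∘ᴬ g ∘ᴬ f ⁻ᴬ , ℤ.- a , Flip-conj fl s , cong (λ x → f • g • x) (invʳ f _)

  ∼-two : ∀ {u v w} → ¬ u ∼ v → ¬ v ∼ w → u ∼ w
  ∼-two {u} {v} {w} ¬p ¬q with vt u v | vt v w
  ... | f , refl | g , refl with dich f | dich g
  ... | inj₁ (a , s) | _            = ⊥-elim (¬p (f , a , s , refl))
  ... | inj₂ _       | inj₁ (a , s) = ⊥-elim (¬q (g , a , s , refl))
  ... | inj₂ fl      | inj₂ fl′     = let (z , s) = Flip-∘ fl′ fl in g ∘ᴬ f , z , s , refl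

  other : Dec (∃[ w ] ¬ v₀ ∼ w)
  other = em

  base : V G → V G
  base v with em {v₀ ∼ v} | other
  ... | yes _ | _            = v₀
  ... | no _  | yes (w , _)  = w
  ... | no _  | no _         = v₀

  base-∼ : ∀ v → base v ∼ v
  base-∼ v with em {v₀ ∼ v} | other
  ... | yes p | _            = p
  ... | no ¬p | yes (w , ¬q) = ∼-two (¬q ∘ ∼-sym) ¬p
  ... | no ¬p | no none      = ⊥-elim (none (v , ¬p))

  base-cong : ∀ {u v} → u ∼ v → base u ≡ base v
  base-cong {u} {v} uv with em {v₀ ∼ u} | em {v₀ ∼ v} | other
  ... | yes _ | yes _ | _      = refl
  ... | yes p | no ¬q | _      = ⊥-elim (¬q (∼-trans p uv))
  ... | no ¬p | yes q | _      = ⊥-elim (¬p (∼-trans q (∼-sym uv)))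
  ... | no _  | no _  | yes _  = refl
  ... | no _  | no _  | no _   = refl

  -- The length of an element of Γ⁺ that carries the representative of the orbit to `v`; by `Sh-det`
  -- it does not depend on the element.
  h₀ : V G → ℤ
  h₀ v = proj₁ (proj₂ (base-∼ v))

  h₀-shift : ∀ {g z} → Sh g z → ∀ v → h₀ (g • v) ≡ h₀ v ℤ.+ z
  h₀-shift {g} {z} s v = let (a , k , r , eq) = base-∼ v ; (b , l , q , eq′) = base-∼ (g • v) in
    trans (Sh-det q (Sh-∘ s r) (trans (cong (b •_) (base-cong (g , z , s , refl))) (trans eq′ (cong (g •_) (sym eq)))))
          (ℤ.+-comm z k)

  argmax : (P : V G → Set) (f : V G → ℤ) → ∀ L → (∃[ x ] (x ∈ L × P x)) →
           ∃[ x ] (P x × (∀ y → y ∈ L → P y → f y ℤ.≤ f x))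
  argmax P f []      (_ , () , _)
  argmax P f (z ∷ L) ex with em {∃[ x ] (x ∈ L × P x)} | em {P z}
  argmax P f (z ∷ L) (_ , here refl , p) | _ | no ¬p = ⊥-elim (¬p p)
  argmax P f (z ∷ L) (x , there x∈ , p)  | no ne | _ = ⊥-elim (ne (x , x∈ , p))
  argmax P f (z ∷ L) (x , here refl , _) | no ne | yes pz =
    z , pz , λ { y (here refl) _ → ℤ.≤-refl ; y (there m) p → ⊥-elim (ne (y , m , p)) }
  ... | yes ex′ | no ¬pz = let (x , p , mx) = argmax P f L ex′ in
    x , p , λ { y (here refl) q → ⊥-elim (¬pz q) ; y (there m) q → mx y m q }
  ... | yes ex′ | yes pz with argmax P f L ex′
  ...   | x , p , mx with ℤ.≤-total (f x) (f z)
  ...     | inj₁ le = z , pz , λ { y (here refl) _ → ℤ.≤-refl ; y (there m) q → ℤ.≤-trans (mx y m q) le }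
  ...     | inj₂ ge = x , p , λ { y (here refl) _ → ge ; y (there m) q → mx y m q }

  Cross : V G → Set
  Cross y = E G v₀ y × ¬ v₀ ∼ y

  -- κ is chosen so that the doubled heights of the cross neighbours of v₀ range symmetrically around 0.
  record Centred (κ : ℤ) : Set where
    field
      M    : ℕ
      hi   : ∀ y → Cross y → h₀ y ℤ.+ h₀ y ℤ.+ κ ℤ.≤ + M
      lo   : ∀ y → Cross y → ℤ.- + M ℤ.≤ h₀ y ℤ.+ h₀ y ℤ.+ κ
      y₊   : ∃[ y ] (Cross y × h₀ y ℤ.+ h₀ y ℤ.+ κ ≡ + M)
      y₋   : ∃[ y ] (Cross y × h₀ y ℤ.+ h₀ y ℤ.+ κ ≡ ℤ.- + M)

  centre : (∃[ y ] Cross y) → ∃[ κ ] Centred κ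
  centre (y , e , c) = κ , record
    { M  = ∣ a ℤ.- b ∣
    ; hi = λ y c → subst₂ ℤ._≤_ refl (trans (top-value a b) (sym M≡))
                     (ℤ.+-monoˡ-≤ κ (ℤ.+-mono-≤ (mx y (in-list c) c) (mx y (in-list c) c)))
    ; lo = λ y c → subst₂ ℤ._≤_ (trans (bottom-value a b) (cong (λ z → ℤ.- z) (sym M≡))) refl
                     (ℤ.+-monoˡ-≤ κ (ℤ.+-mono-≤ (mn y c) (mn y c)))
    ; y₊ = p , cp , trans (top-value a b) (sym M≡)
    ; y₋ = q , cq , trans (bottom-value a b) (cong (λ z → ℤ.- z) (sym M≡)) }
    where
    in-list : ∀ {y} → Cross y → y ∈ proj₁ (lf v₀)
    in-list (e , _) = proj₂ (lf v₀) _ e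
    top : ∃[ x ] (Cross x × (∀ y → y ∈ proj₁ (lf v₀) → Cross y → h₀ y ℤ.≤ h₀ x))
    top = argmax Cross h₀ (proj₁ (lf v₀)) (y , in-list (e , c) , e , c)
    bot : ∃[ x ] (Cross x × (∀ y → y ∈ proj₁ (lf v₀) → Cross y → ℤ.- h₀ y ℤ.≤ ℤ.- h₀ x))
    bot = argmax Cross (λ x → ℤ.- h₀ x) (proj₁ (lf v₀)) (y , in-list (e , c) , e , c)
    p q : V G
    p = proj₁ top
    q = proj₁ bot
    cp : Cross p
    cp = proj₁ (proj₂ top)
    cq : Cross q
    cq = proj₁ (proj₂ bot)
    mx : ∀ y → y ∈ proj₁ (lf v₀) → Cross y → h₀ y ℤ.≤ h₀ p
    mx = proj₂ (proj₂ top)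
    mn : ∀ y → Cross y → h₀ q ℤ.≤ h₀ y
    mn y c = subst₂ ℤ._≤_ (ℤ.neg-involutive _) (ℤ.neg-involutive _) (ℤ.neg-mono-≤ (proj₂ (proj₂ bot) y (in-list c) c))
    a b κ : ℤ
    a = h₀ p
    b = h₀ q
    -- Half of `κ` moves the midpoint of the extremes `a` and `b` to 0. Since the midpoint may be
    -- half an integer, it is the doubled heights that are shifted; their extremes become a - b and
    -- b - a.
    κ = ℤ.- (a ℤ.+ b)
    M≡ : + ∣ a ℤ.- b ∣ ≡ a ℤ.- b
    M≡ = ℤ.0≤i⇒+∣i∣≡i (ℤ.i≤j⇒0≤j-i (mx q (in-list cq) cq))
    top-value : ∀ a b → a ℤ.+ a ℤ.+ ℤ.- (a ℤ.+ b) ≡ a ℤ.- b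
    top-value = solve-∀
    bottom-value : ∀ a b → b ℤ.+ b ℤ.+ ℤ.- (a ℤ.+ b) ≡ ℤ.- (a ℤ.- b)
    bottom-value = solve-∀

  offset : ∃[ κ ] ((¬ (∃[ y ] Cross y)) ⊎ Centred κ)
  offset with em {∃[ y ] Cross y}
  -- Without cross neighbours the steepest edge at `v₀` stays in its orbit and any offset serves; 0
  -- is a default.
  ... | no ne  = 0ℤ , inj₁ ne
  ... | yes ex = let (κ , c) = centre ex in κ , inj₂ c

  module Doubled (κ : ℤ) where

    part : V G → ℤ
    part v with em {v₀ ∼ v}
    ... | yes _ = 0ℤ
    ... | no _  = κ

    part-cong : ∀ {u v} → u ∼ v → part u ≡ part v
    part-cong {u} {v} uv with em {v₀ ∼ u} | em {v₀ ∼ v}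
    ... | yes _ | yes _ = refl
    ... | yes p | no ¬q = ⊥-elim (¬q (∼-trans p uv))
    ... | no ¬p | yes q = ⊥-elim (¬p (∼-trans q (∼-sym uv)))
    ... | no _  | no _  = refl

    part-other : ∀ {v} → ¬ v₀ ∼ v → part v ≡ κ
    part-other {v} ¬p with em {v₀ ∼ v}
    ... | yes p = ⊥-elim (¬p p)
    ... | no _  = refl

    H : V G → ℤ
    H v = h₀ v ℤ.+ h₀ v ℤ.+ part v

    H-shift : ∀ {g z} → Sh g z → ∀ v → H (g • v) ≡ H v ℤ.+ (z ℤ.+ z)
    H-shift {g} {z} s v = trans (cong₂ (λ a b → a ℤ.+ a ℤ.+ b) (h₀-shift s v) (sym (part-cong (g , z , s , refl))))
                            (lemma (h₀ v) z (part v))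
      where
      lemma : ∀ a z p → a ℤ.+ z ℤ.+ (a ℤ.+ z) ℤ.+ p ≡ a ℤ.+ a ℤ.+ p ℤ.+ (z ℤ.+ z)
      lemma = solve-∀

    H-v₀ : H v₀ ≡ 0ℤ
    H-v₀ = cong₂ (λ a b → a ℤ.+ a ℤ.+ b) h₀-v₀ part-v₀
      where
      h₀-v₀ : h₀ v₀ ≡ 0ℤ
      h₀-v₀ = let (a , k , r , eq) = base-∼ v₀ in Sh-stab r (trans (cong (a •_) (sym base-v₀)) eq)
        where
        base-v₀ : base v₀ ≡ v₀
        base-v₀ with em {v₀ ∼ v₀} | other
        ... | yes _ | _ = refl
        ... | no ¬p | _ = ⊥-elim (¬p ∼-refl)
      part-v₀ : part v₀ ≡ 0ℤ
      part-v₀ with em {v₀ ∼ v₀}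
      ... | yes _ = refl
      ... | no ¬p = ⊥-elim (¬p ∼-refl)

    -- The sum is invariant under Γ⁺, because `f` reverses its translations. For a vertex in the
    -- orbit of `f • v₀` it therefore equals the sum of the heights of `f • f • v₀` and `f • v₀`,
    -- which is the value at `v₀` since the square of `f` has length 0. This works for every offset
    -- `κ`.
    H-flip : ∀ {f} → Flip f → ∀ v → H (f • v) ℤ.+ H v ≡ H (f • v₀) ℤ.+ H v₀
    H-flip {f} fl v = go (vt v₀ v)
      where
      conj-point : ∀ g x → (f ∘ᴬ g ∘ᴬ f ⁻ᴬ) • f • x ≡ f • g • x
      conj-point g x = cong (λ y → f • g • y) (invʳ f x)
      lemma : ∀ a b z → a ℤ.+ (ℤ.- z ℤ.+ ℤ.- z) ℤ.+ (b ℤ.+ (z ℤ.+ z)) ≡ a ℤ.+ b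
      lemma = solve-∀
      reflected : ∀ {g z} → Sh g z → ∀ x → H (f • g • x) ℤ.+ H (g • x) ≡ H (f • x) ℤ.+ H x
      reflected {g} {z} s x = trans
        (cong₂ ℤ._+_ (trans (cong H (sym (conj-point g x))) (H-shift (Flip-conj fl s) (f • x))) (H-shift s x))
        (lemma (H (f • x)) (H x) z)
      square : H (f • f • v₀) ≡ H v₀
      square = trans (H-shift (Flip-square fl) v₀) (ℤ.+-identityʳ (H v₀))
      go : (Σ (Aut G) λ k → k • v₀ ≡ v) → H (f • v) ℤ.+ H v ≡ H (f • v₀) ℤ.+ H v₀
      go (k , refl) with dich k
      ... | inj₁ (z , s) = reflected s v₀
      ... | inj₂ fl′ = let (z , s) = Flip-∘ fl′ (Flip-inv fl) in
        trans (cong₂ (λ x y → H (f • x) ℤ.+ H y) (sym (through v₀)) (sym (through v₀)))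
          (trans (reflected s (f • v₀)) (trans (cong (ℤ._+ H (f • v₀)) square) (ℤ.+-comm (H v₀) _)))
        where
        through : ∀ x → (k ∘ᴬ f ⁻ᴬ) • f • x ≡ k • x
        through x = cong (k •_) (invʳ f x)

    module Scaled (e : ℕ) (h : V G → ℤ) (H≡ : ∀ v → H v ≡ h v ℤ.* + suc e)
                  (attained : ∀ i → ∃[ v ] h v ≡ i)
                  (centred : (¬ (∃[ y ] Cross y)) ⊎ Centred κ) where

      unscale : ∀ {a b c d} → a ℤ.* + suc e ℤ.+ b ℤ.* + suc e ≡ c ℤ.* + suc e ℤ.+ d ℤ.* + suc e →
                a ℤ.+ b ≡ c ℤ.+ d
      unscale {a} {b} {c} {d} eq = ℤ.*-cancelʳ-≡ (a ℤ.+ b) (c ℤ.+ d) (+ suc e)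
        (trans (ℤ.*-distribʳ-+ (+ suc e) a b) (trans eq (sym (ℤ.*-distribʳ-+ (+ suc e) c d))))

      scaled-sum : ∀ {u v w x} → H u ℤ.+ H v ≡ H w ℤ.+ H x → h u ℤ.+ h v ≡ h w ℤ.+ h x
      scaled-sum {u} {v} {w} {x} eq = unscale {h u} {h v} {h w} {h x}
        (trans (cong₂ ℤ._+_ (sym (H≡ u)) (sym (H≡ v))) (trans eq (cong₂ ℤ._+_ (H≡ w) (H≡ x))))

      moves : ∀ {u v} → u ∼ v →
        ∃[ g ] (g • u ≡ v × (∀ x → h (g • x) ℤ.+ h u ≡ h x ℤ.+ h v) × (∀ x → x ∼ (g • x)))
      moves {u} (g , z , s , refl) = g , refl ,
        (λ x → scaled-sum (trans (cong (ℤ._+ H u) (H-shift s x))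
          (trans (lemma (H x) (H u) z) (cong (ℤ._+_ (H x)) (sym (H-shift s u)))))) ,
        λ x → g , z , s , refl
        where
        lemma : ∀ x u z → x ℤ.+ (z ℤ.+ z) ℤ.+ u ≡ x ℤ.+ (u ℤ.+ (z ℤ.+ z))
        lemma = solve-∀

      aut-h : ∀ f → (∀ x y → h (f • x) ℤ.+ h y ≡ h (f • y) ℤ.+ h x)
                  ⊎ (∀ x y → h (f • x) ℤ.+ h x ≡ h (f • y) ℤ.+ h y)
      aut-h f with dich f
      ... | inj₁ (z , s) = inj₁ λ x y → scaled-sum
            (trans (cong (ℤ._+ H y) (H-shift s x)) (trans (lemma (H x) (H y) z) (cong (ℤ._+ H x) (sym (H-shift s y)))))
        where
        lemma : ∀ x y z → x ℤ.+ (z ℤ.+ z) ℤ.+ y ≡ y ℤ.+ (z ℤ.+ z) ℤ.+ x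
        lemma = solve-∀
      ... | inj₂ fl = inj₂ λ x y → scaled-sum (trans (H-flip fl x) (sym (H-flip fl y)))

      same-height : ∀ {u x} → u ∼ x → h u ≡ h x → ∃[ g ] (Sh g 0ℤ × g • u ≡ x)
      same-height {u} (g , z , s , refl) eq = g , subst (Sh g) (halve z (linear {z ℤ.+ z} {0ℤ} (lemma (H u) (z ℤ.+ z))
          (trans (sym (H-shift s u)) (trans (H≡ (g • u)) (trans (cong (ℤ._* + suc e) (sym eq)) (sym (H≡ u))))))) s , refl
        where
        lemma : ∀ u z → z ℤ.+ u ≡ 0ℤ ℤ.+ (u ℤ.+ z)
        lemma = solve-∀
        halve : ∀ z → z ℤ.+ z ≡ 0ℤ → z ≡ 0ℤ
        halve (+ zero) _ = refl

      level-finite : ∀ i → Finite (λ v → h v ≡ i)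
      level-finite i = go em
        where
        u : V G
        u = proj₁ (attained i)
        u-orbit : ∀ {x} → u ∼ x → h x ≡ i → x ∈ proj₁ (Sh-fin u)
        u-orbit {x} p eq = proj₂ (Sh-fin u) x (same-height p (trans (proj₂ (attained i)) (sym eq)))
        go : Dec (∃[ w ] (h w ≡ i × ¬ u ∼ w)) → Finite (λ v → h v ≡ i)
        go (no ne) = proj₁ (Sh-fin u) , λ x eq → u-orbit (by-contradiction λ ¬p → ne (x , eq , ¬p)) eq
        go (yes (w , eq , ¬p)) = proj₁ (Sh-fin u) ++ proj₁ (Sh-fin w) , λ x eq′ → pick x eq′ em
          where
          pick : ∀ x → h x ≡ i → Dec (u ∼ x) → x ∈ proj₁ (Sh-fin u) ++ proj₁ (Sh-fin w)
          pick x eq′ (yes q) = ∈-++⁺ˡ (u-orbit q eq′)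
          pick x eq′ (no ¬q) = ∈-++⁺ʳ (proj₁ (Sh-fin u)) (proj₂ (Sh-fin w) x
            (same-height (∼-two (¬p ∘ ∼-sym) ¬q) (trans eq (sym eq′))))

      h-v₀ : h v₀ ≡ 0ℤ
      h-v₀ = ℤ.*-cancelʳ-≡ (h v₀) 0ℤ (+ suc e) (trans (sym (H≡ v₀)) H-v₀)

      diff-abs : ∀ f x y → ∣ h (f • y) ℤ.- h (f • x) ∣ ≡ ∣ h y ℤ.- h x ∣
      diff-abs f x y with aut-h f
      ... | inj₁ iso  = abs-difference {h (f • y)} (inj₁ (iso y x))
      ... | inj₂ anti = abs-difference {h (f • y)} (inj₂ (anti y x))

      neighbour : ∃[ y ] E G v₀ y
      neighbour = first (proj₂ (conn v₀ (proj₁ (attained 1ℤ)))) (proj₂ (attained 1ℤ))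
        where
        first : ∀ {v n} → Walk (E G) v₀ v n → h v ≡ 1ℤ → ∃[ y ] E G v₀ y
        first here           eq with trans (sym eq) h-v₀
        ... | ()
        first (step {b = b} e _) _  = b , e

      far : ∃[ y ] (E G v₀ y × (∀ z → z ∈ proj₁ (lf v₀) → E G v₀ z → + ∣ h z ∣ ℤ.≤ + ∣ h y ∣))
      far = argmax (E G v₀) (λ z → + ∣ h z ∣) (proj₁ (lf v₀))
              (proj₁ neighbour , proj₂ (lf v₀) _ (proj₂ neighbour) , proj₂ neighbour)

      y★ : V G
      y★ = proj₁ far

      t : ℕ
      t = ∣ h y★ ∣

      far-max : ∀ {z} → E G v₀ z → ∣ h z ∣ ≤ t
      far-max {z} e = ℤ.drop‿+≤+ (proj₂ (proj₂ far) z (proj₂ (lf v₀) z e) e)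

      minus-h-v₀ : ∀ z → h z ℤ.- h v₀ ≡ h z
      minus-h-v₀ z = trans (cong (ℤ._-_ (h z)) h-v₀) (ℤ.+-identityʳ (h z))

      edge-≤ : ∀ {x y} → E G x y → ∣ h y ℤ.- h x ∣ ≤ t
      edge-≤ {x} {y} e = go (vt v₀ x)
        where
        go : (Σ (Aut G) λ f → f • v₀ ≡ x) → ∣ h y ℤ.- h x ∣ ≤ t
        go (f , refl) = subst (_≤ t)
          (trans (cong ∣_∣ (sym (minus-h-v₀ (f ⁻ᴬ • y))))
            (trans (sym (diff-abs f v₀ (f ⁻ᴬ • y))) (cong (λ z → ∣ h z ℤ.- h (f • v₀) ∣) (invˡ f y))))
          (far-max (subst (λ z → E G z (f ⁻ᴬ • y)) (invʳ f v₀) (E-pres (f ⁻ᴬ) e)))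

      t≥1 : 1 ≤ t
      t≥1 = n≢0⇒n>0 λ t≡0 → contra (λ e → n≤0⇒n≡0 (subst (_ ≤_) t≡0 (edge-≤ e)))
        where
        contra : (∀ {x y} → E G x y → ∣ h y ℤ.- h x ∣ ≡ 0) → ⊥
        contra flat with trans (constant (proj₂ (conn v₀ (proj₁ (attained 1ℤ))))) h-v₀
          where
          constant : ∀ {x n} → Walk (E G) x (proj₁ (attained 1ℤ)) n → 1ℤ ≡ h x
          constant here       = sym (proj₂ (attained 1ℤ))
          constant (step e p) = trans (constant p) (ℤ.i-j≡0⇒i≡j _ _ (ℤ.∣i∣≡0⇒i≡0 (flat e)))
        ... | ()

      balanced-same : v₀ ∼ y★ → ∀ x → ∃[ y ] (E G x y × h y ≡ h x ℤ.+ + t × x ∼ y)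
      balanced-same p x = go (vt v₀ x)
        where
        go : (Σ (Aut G) λ f → f • v₀ ≡ x) → ∃[ y ] (E G x y × h y ≡ h x ℤ.+ + t × x ∼ y)
        go (f , refl) with abs-cases (h (f • y★) ℤ.- h (f • v₀))
        ... | inj₁ eq = f • y★ , E-pres f (proj₁ (proj₂ far)) ,
              linear (lemma (h (f • y★)) (h (f • v₀)) (+ t)) (trans eq (cong +_ abs≡t)) , ∼-• f p
          where
          abs≡t : ∣ h (f • y★) ℤ.- h (f • v₀) ∣ ≡ t
          abs≡t = trans (diff-abs f v₀ y★) (cong ∣_∣ (minus-h-v₀ y★))
          lemma : ∀ a b t → a ℤ.+ t ≡ b ℤ.+ t ℤ.+ (a ℤ.- b)
          lemma = solve-∀
        -- The image of the steepest edge descends from this vertex. The translation that carries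
        -- its lower end up to this vertex turns it into an ascending edge there.
        ... | inj₂ eq = let (g , gy≡ , hg , g∼) = moves (∼-sym (∼-• f p)) in
              g • f • v₀ , subst (λ z → E G z (g • f • v₀)) gy≡ (E-pres g (E-sym G (E-pres f (proj₁ (proj₂ far))))) ,
              linear (lemma (h (g • f • v₀)) (h (f • y★)) (h (f • v₀)) (+ t))
                     (cong₂ ℤ._+_ (hg (f • v₀)) (sym (trans eq (cong (λ n → ℤ.- + n) abs≡t)))) , g∼ (f • v₀)
          where
          abs≡t : ∣ h (f • y★) ℤ.- h (f • v₀) ∣ ≡ t
          abs≡t = trans (diff-abs f v₀ y★) (cong ∣_∣ (minus-h-v₀ y★))
          lemma : ∀ g y x t → g ℤ.+ (x ℤ.+ x ℤ.+ (y ℤ.- x)) ≡ x ℤ.+ t ℤ.+ (g ℤ.+ y ℤ.+ ℤ.- t)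
          lemma = solve-∀

      module _ (¬p : ¬ v₀ ∼ y★) (c : Centred κ) where
        open Centred c

        H-cross : ∀ {y} → ¬ v₀ ∼ y → H y ≡ h₀ y ℤ.+ h₀ y ℤ.+ κ
        H-cross {y} ¬q = cong (ℤ._+_ (h₀ y ℤ.+ h₀ y)) (part-other ¬q)

        scaled-abs : ∀ z → ∣ h z ∣ * suc e ≡ ∣ H z ∣
        scaled-abs z = trans (sym (ℤ.abs-* (h z) (+ suc e))) (cong ∣_∣ (sym (H≡ z)))

        -- If the steepest edge at `v₀` leaves the orbit, the extreme cross neighbours are as steep
        -- as it; centring then makes both a rise and a fall by exactly `t` occur among the cross
        -- edges at `v₀`.
        M≡t : M ≡ t * suc e
        M≡t = ≤-antisym
          (subst (_≤ t * suc e) (trans (scaled-abs p) (cong ∣_∣ (trans (H-cross cross₂) eq))) (*-monoˡ-≤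
              (suc e) (far-max cross₁)))
          (subst (_≤ M) (sym (scaled-abs y★)) (abs-≤
            (subst (ℤ._≤ + M) (sym (H-cross ¬p)) (hi y★ (proj₁ (proj₂ far) , ¬p)))
            (subst (ℤ._≤_ (ℤ.- + M)) (sym (H-cross ¬p)) (lo y★ (proj₁ (proj₂ far) , ¬p)))))
          where
          p : V G
          p = proj₁ y₊
          cross₁ : E G v₀ p
          cross₁ = proj₁ (proj₁ (proj₂ y₊))
          cross₂ : ¬ v₀ ∼ p
          cross₂ = proj₂ (proj₁ (proj₂ y₊))
          eq : h₀ p ℤ.+ h₀ p ℤ.+ κ ≡ + M
          eq = proj₂ (proj₂ y₊)

        +M≡ : + M ≡ + t ℤ.* + suc e
        +M≡ = trans (cong +_ M≡t) (ℤ.pos-* t (suc e))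

        h-y₊ : h (proj₁ y₊) ≡ + t
        h-y₊ = let (y , (_ , ¬q) , eq) = y₊ in
          ℤ.*-cancelʳ-≡ (h y) (+ t) (+ suc e) (trans (sym (H≡ y)) (trans (H-cross ¬q) (trans eq +M≡)))

        h-y₋ : h (proj₁ y₋) ≡ ℤ.- + t
        h-y₋ = let (y , (_ , ¬q) , eq) = y₋ in
          ℤ.*-cancelʳ-≡ (h y) (ℤ.- + t) (+ suc e) (trans (sym (H≡ y)) (trans (H-cross ¬q) (trans eq
            (trans (cong (λ z → ℤ.- z) +M≡) (ℤ.neg-distribˡ-* (+ t) (+ suc e))))))

        -- In the orbit of `v₀` the edge to the highest cross neighbour is translated to `x`. In the
        -- other orbit the edge to the lowest one is used, read upwards from that neighbour to `v₀`.
        balanced-cross : ∀ x → ∃[ y ] (E G x y × h y ≡ h x ℤ.+ + t × ¬ x ∼ y)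
        balanced-cross x = go em
          where
          go : Dec (v₀ ∼ x) → ∃[ y ] (E G x y × h y ≡ h x ℤ.+ + t × ¬ x ∼ y)
          go (yes q) = let (y , (ed , ¬r) , _) = y₊ ; (g , gv≡ , hg , g∼) = moves q in
            g • y , subst (λ z → E G z (g • y)) gv≡ (E-pres g ed) ,
            linear (lemma (h (g • y)) (h v₀) (h y) (h x) (+ t)) (cong₂ ℤ._+_ (hg y) (cong₂ ℤ._+_ h-y₊ (sym h-v₀))) ,
            λ r → ¬r (∼-trans q (∼-trans r (∼-sym (g∼ y))))
            where
            lemma : ∀ g v y x t → g ℤ.+ (y ℤ.+ x ℤ.+ (t ℤ.+ v)) ≡ x ℤ.+ t ℤ.+ (g ℤ.+ v ℤ.+ (y ℤ.+ 0ℤ))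
            lemma = solve-∀
          go (no ¬q) = let (y , (ed , ¬r) , _) = y₋ ; (g , gy≡ , hg , g∼) = moves (∼-two (¬r ∘ ∼-sym) ¬q) in
            g • v₀ , subst (λ z → E G z (g • v₀)) gy≡ (E-pres g (E-sym G ed)) ,
            linear (lemma (h (g • v₀)) (h v₀) (h y) (h x) (+ t)) (cong₂ ℤ._+_ (hg v₀) (cong₂ ℤ._+_ (sym h-y₋) h-v₀)) ,
            λ r → ¬q (∼-trans (g∼ v₀) (∼-sym r))
            where
            lemma : ∀ g v y x t → g ℤ.+ (v ℤ.+ x ℤ.+ (y ℤ.+ 0ℤ)) ≡ x ℤ.+ t ℤ.+ (g ℤ.+ y ℤ.+ (ℤ.- t ℤ.+ v))
            lemma = solve-∀

      balanced : (∀ x → ∃[ y ] (E G x y × h y ≡ h x ℤ.+ + t × x ∼ y))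
               ⊎ (∀ x → ∃[ y ] (E G x y × h y ≡ h x ℤ.+ + t × ¬ x ∼ y))
      balanced = go em centred
        where
        go : Dec (v₀ ∼ y★) → (¬ (∃[ y ] Cross y)) ⊎ Centred κ → _
        go (yes p) _         = inj₁ (balanced-same p)
        go (no ¬p) (inj₁ ne) = ⊥-elim (ne (y★ , proj₁ (proj₂ far) , ¬p))
        go (no ¬p) (inj₂ c)  = inj₂ (balanced-cross ¬p c)

      structure : HeightStructure G
      structure = record
        { _∼_ = _∼_ ; ∼-refl = ∼-refl ; ∼-sym = ∼-sym ; ∼-trans = ∼-trans ; ∼-• = ∼-• ; ∼-two = ∼-two
        ; h = h ; moves = moves ; aut-h = aut-h ; attained = attained ; level-finite = level-finite
        ; t = t ; t≥1 = t≥1 ; edge-≤ = edge-≤ ; balanced = balanced }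

    H-even : ∀ i → ∃[ v ] H v ≡ i ℤ.+ i
    H-even i = let (g , s) = Sh-any i in
      g • v₀ , trans (H-shift s v₀) (trans (cong (ℤ._+ (i ℤ.+ i)) H-v₀) (ℤ.+-identityˡ _))

    halves : ∀ z → (∃[ k ] z ≡ k ℤ.+ k) ⊎ (∃[ k ] z ≡ 1ℤ ℤ.+ (k ℤ.+ k))
    halves z = go (z ℤ.%ℕ 2) (ℤ.n%ℕd<d z 2) (ℤ.a≡a%ℕn+[a/ℕn]*n z 2)
      where
      double : ∀ k → k ℤ.* + 2 ≡ k ℤ.+ k
      double k = trans (ℤ.*-comm k (+ 2)) (trans (ℤ.suc-* (+ 1) k) (cong (ℤ._+_ k) (ℤ.*-identityˡ k)))
      go : ∀ r → r < 2 → z ≡ + r ℤ.+ (z ℤ./ℕ 2) ℤ.* + 2 →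
           (∃[ k ] z ≡ k ℤ.+ k) ⊎ (∃[ k ] z ≡ 1ℤ ℤ.+ (k ℤ.+ k))
      go 0 _ eq = inj₁ (z ℤ./ℕ 2 , trans eq (trans (ℤ.+-identityˡ _) (double (z ℤ./ℕ 2))))
      go 1 _ eq = inj₂ (z ℤ./ℕ 2 , trans eq (cong (ℤ._+_ 1ℤ) (double (z ℤ./ℕ 2))))
      go (suc (suc _)) (s≤s (s≤s ())) _

    -- On the orbit of `v₀` the doubled height takes every even value. If some vertex has an odd
    -- value, its translates take all odd ones; otherwise all values are halved. Either way the
    -- height is onto ℤ, so no level is empty.
    height-structure : (¬ (∃[ y ] Cross y)) ⊎ Centred κ → HeightStructure G
    height-structure centred = go em
      where
      go : Dec (∃[ w ] ∃[ k ] H w ≡ 1ℤ ℤ.+ (k ℤ.+ k)) → HeightStructure G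
      go (no none) = Scaled.structure 1 (λ v → proj₁ (half v)) (λ v → trans (proj₂ (half v)) (double (proj₁ (half v))))
        (λ i → let (v , eq) = H-even i in v , cancel-double (trans (sym (proj₂ (half v))) eq)) centred
        where
        half : ∀ v → ∃[ k ] H v ≡ k ℤ.+ k
        half v with halves (H v)
        ... | inj₁ p       = p
        ... | inj₂ (k , o) = ⊥-elim (none (v , k , o))
        double : ∀ k → k ℤ.+ k ≡ k ℤ.* + 2
        double = solve-∀
        cancel-double : ∀ {a b} → a ℤ.+ a ≡ b ℤ.+ b → a ≡ b
        cancel-double {a} {b} eq = ℤ.*-cancelʳ-≡ a b (+ 2) (trans (sym (double a)) (trans eq (double b)))
      go (yes (w , k , odd)) = Scaled.structure 0 H (λ v → sym (ℤ.*-identityʳ (H v))) onto centred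
        where
        onto : ∀ i → ∃[ v ] H v ≡ i
        onto i with halves i
        ... | inj₁ (l , refl) = H-even l
        ... | inj₂ (l , refl) = let (g , s) = Sh-any (l ℤ.- k) in
              g • w , trans (H-shift s w) (trans (cong (ℤ._+ _) odd) (lemma k l))
          where
          lemma : ∀ k l → 1ℤ ℤ.+ (k ℤ.+ k) ℤ.+ (l ℤ.- k ℤ.+ (l ℤ.- k)) ≡ 1ℤ ℤ.+ (l ℤ.+ l)
          lemma = solve-∀

  heights : HeightStructure G
  heights = let (κ , c) = offset in Doubled.height-structure κ c

-- Levels and their expansion

∑-const : {A : Set} (c : ℕ) → ∀ (xs : List A) → ∑ (λ _ → c) xs ≡ length xs * c
∑-const c []       = refl
∑-const c (x ∷ xs) = cong (_+_ c) (∑-const c xs)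

module Levels (em : ExcludedMiddle 0ℓ) (G : Graph) (lf : LocallyFinite G) (conn : Connected G)
              (vt : VertexTransitive G) (HS : HeightStructure G) where
  open Counting em
  open Automorphisms G
  open HeightStructure HS

  diff-abs : ∀ f x y → ∣ h (f • y) ℤ.- h (f • x) ∣ ≡ ∣ h y ℤ.- h x ∣
  diff-abs f x y with aut-h f
  ... | inj₁ iso  = abs-difference {h (f • y)} (inj₁ (iso y x))
  ... | inj₂ anti = abs-difference {h (f • y)} (inj₂ (anti y x))

  abs-diff≡0 : ∀ {a b} → ∣ a ℤ.- b ∣ ≡ 0 → a ≡ b
  abs-diff≡0 {a} {b} eq = ℤ.i-j≡0⇒i≡j a b (ℤ.∣i∣≡0⇒i≡0 eq)

  aut-level : ∀ f {x y} → h x ≡ h y → h (f • x) ≡ h (f • y)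
  aut-level f {x} {y} eq = abs-diff≡0 (trans (diff-abs f y x) (cong ∣_∣ (ℤ.i≡j⇒i-j≡0 {h x} eq)))

  aut-level⁻ : ∀ f {x y} → h (f • x) ≡ h (f • y) → h x ≡ h y
  aut-level⁻ f {x} {y} eq = abs-diff≡0 (trans (sym (diff-abs f y x)) (cong ∣_∣ (ℤ.i≡j⇒i-j≡0 {h (f • x)} eq)))

  level : ℤ → List (V G)
  level i = proj₁ (enumerate (level-finite i))

  level-unique : ∀ i → Unique (level i)
  level-unique i = proj₁ (proj₂ (enumerate (level-finite i)))

  level⁻ : ∀ {i v} → v ∈ level i → h v ≡ i
  level⁻ {i} = proj₁ (proj₂ (proj₂ (enumerate (level-finite i)))) _

  level⁺ : ∀ {i v} → h v ≡ i → v ∈ level i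
  level⁺ {i} = proj₂ (proj₂ (proj₂ (enumerate (level-finite i)))) _

  level-≤ : ∀ i j → length (level i) ≤ length (level j)
  level-≤ i j = let (u , hu) = attained i ; (w , hw) = attained j ; (f , fu≡w) = vt u w in
    subst (_≤ length (level j)) (length-map (f •_) (level i))
      (length-⊆ (Unique.map⁺ (•-injective f) (level-unique i)) λ x x∈ →
        let (y , y∈ , eq) = ∈-map⁻ (f •_) x∈ in
        level⁺ (trans (cong h eq) (trans (aut-level f (trans (level⁻ y∈) (sym hu))) (trans (cong h fu≡w) hw))))

  s : ℕ
  s = length (level 0ℤ)

  level-length : ∀ i → length (level i) ≡ s
  level-length i = ≤-antisym (level-≤ i 0ℤ) (level-≤ 0ℤ i)

  nonempty : ∀ {x : V G} {L} → x ∈ L → 1 ≤ length L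
  nonempty (here _)  = s≤s z≤n
  nonempty (there _) = s≤s z≤n

  s≥1 : 1 ≤ s
  s≥1 = nonempty (level⁺ (proj₂ (attained 0ℤ)))

  nb : V G → List (V G)
  nb x = proj₁ (enumerate {P = E G x} (lf x))

  nb-unique : ∀ x → Unique (nb x)
  nb-unique x = proj₁ (proj₂ (enumerate {P = E G x} (lf x)))

  nb⁺ : ∀ {x y} → E G x y → y ∈ nb x
  nb⁺ {x} = proj₂ (proj₂ (proj₂ (enumerate {P = E G x} (lf x)))) _

  degree : (V G → V G → Set) → V G → ℕ
  degree R x = ♯ (R x) (nb x)

  degree-≤ : ∀ {R : V G → V G → Set} → (∀ {x y} → R x y → E G x y) → ∀ {x} f →
    (∀ {y} → R x y → R (f • x) (f • y)) → degree R x ≤ degree R (f • x)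
  degree-≤ {R} R⊆E {x} f pres = begin
    ♯ (R x) (nb x)                          ≤⟨ ♯-mono (nb x) (λ _ _ → pres) ⟩
    ♯ (λ y → R (f • x) (f • y)) (nb x)      ≡⟨ ∑-map (λ y → ι (R (f • x) y)) (f •_) (nb x) ⟨
    ♯ (R (f • x)) (map (f •_) (nb x))       ≤⟨ ♯-⊆ (Unique.map⁺ (•-injective f) (nb-unique x)) (λ y _ r → nb⁺ (R⊆E r) , r) ⟩
    ♯ (R (f • x)) (nb (f • x))              ∎
    where open ≤-Reasoning

  degree-on : ∀ {R : V G → V G → Set} → (∀ {x y} → R x y → E G x y) → ∀ {x L} → Unique L →
    (∀ {y} → R x y → y ∈ L) → ♯ (R x) L ≡ degree R x
  degree-on R⊆E uL all = ≤-antisym (♯-⊆ uL (λ y _ r → nb⁺ (R⊆E r) , r)) (♯-⊆ (nb-unique _) (λ y _ r → all r , r))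

  degree-bound : ∀ {R : V G → V G → Set} → (∀ {x y} → R x y → E G x y) → ∀ {x L} → Unique L →
    ♯ (R x) L ≤ degree R x
  degree-bound R⊆E uL = ♯-⊆ uL (λ y _ r → nb⁺ (R⊆E r) , r)

  -- Q is ∼ or its negation; in both cases the arcs leaving one class all enter one class, and
  -- arcs entering one class all leave one class.
  module Arcs (Q : V G → V G → Set)
    (Q-resp : ∀ {u u′ w w′} → u ∼ u′ → w ∼ w′ → Q u w → Q u′ w′)
    (Q-inj  : ∀ {u u′ w} → Q u w → Q u′ w → u ∼ u′)
    (Q-fun  : ∀ {u w w′} → Q u w → Q u w′ → w ∼ w′)
    (rise   : ∀ x → ∃[ y ] (E G x y × h y ≡ h x ℤ.+ + t × Q x y)) where

    Arc Arc⁻ : V G → V G → Set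
    Arc x y  = E G x y × h y ≡ h x ℤ.+ + t × Q x y
    Arc⁻ y x = Arc x y

    out inn : V G → ℕ
    out = degree Arc
    inn = degree Arc⁻

    Arc-moves : ∀ {u v} → u ∼ v → ∃[ g ] (g • u ≡ v × (∀ {x y} → Arc x y → Arc (g • x) (g • y)))
    Arc-moves {u} {v} p = let (g , gu≡v , hg , g∼) = moves p in
      g , gu≡v , λ {x} {y} (e , hy , q) → E-pres g e ,
        linear (lemma (h (g • x)) (h (g • y)) (h x) (h y) (h u) (h v) (+ t))
               (cong₂ ℤ._+_ (cong₂ ℤ._+_ (hg y) (sym (hg x))) hy) ,
        Q-resp (g∼ x) (g∼ y) q
      where
      lemma : ∀ gx gy x y u v t → gy ℤ.+ (y ℤ.+ v ℤ.+ (gx ℤ.+ u) ℤ.+ (x ℤ.+ t))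
                                ≡ gx ℤ.+ t ℤ.+ (gy ℤ.+ u ℤ.+ (x ℤ.+ v) ℤ.+ y)
      lemma = solve-∀

    out-≤ : ∀ {u v} → u ∼ v → out u ≤ out v
    out-≤ {u} p = let (g , gu≡v , pres) = Arc-moves p in
      subst (λ z → out u ≤ out z) gu≡v (degree-≤ {Arc} proj₁ g pres)

    inn-≤ : ∀ {u v} → u ∼ v → inn u ≤ inn v
    inn-≤ {u} p = let (g , gu≡v , pres) = Arc-moves p in
      subst (λ z → inn u ≤ inn z) gu≡v (degree-≤ {Arc⁻} (E-sym G ∘ proj₁) g pres)

    out-≡ : ∀ {u v} → u ∼ v → out u ≡ out v
    out-≡ p = ≤-antisym (out-≤ p) (out-≤ (∼-sym p))

    inn-≡ : ∀ {u v} → u ∼ v → inn u ≡ inn v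
    inn-≡ p = ≤-antisym (inn-≤ p) (inn-≤ (∼-sym p))

    out≥1 : ∀ x → 1 ≤ out x
    out≥1 x = let (y , a) = rise x in ♯-positive {P = Arc x} (nb⁺ (proj₁ a)) a

    Cell : V G → V G → Set
    Cell u x = x ∼ u × h x ≡ h u

    cells : ∀ u → ∃[ L ] (Unique L × (∀ x → x ∈ L → Cell u x) × (∀ x → Cell u x → x ∈ L))
    cells u = enumerate (level (h u) , λ x (_ , eq) → level⁺ eq)

    cell : V G → List (V G)
    cell u = proj₁ (cells u)

    cell-≤ : ∀ u w → length (cell u) ≤ length (cell w)
    cell-≤ u w = let (_ , uu , all , _) = cells u ; (_ , _ , _ , in-w) = cells w ; (f , fu≡w) = vt u w in
      subst (_≤ length (cell w)) (length-map (f •_) (cell u))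
        (length-⊆ (Unique.map⁺ (•-injective f) uu) λ x x∈ →
          let (y , y∈ , eq) = ∈-map⁻ (f •_) x∈ ; (y∼u , hy) = all y y∈ in
          in-w x (subst₂ (λ a b → Cell b a) (sym eq) fu≡w (∼-• f y∼u , aut-level f hy)))

    -- Double counting of the arcs between two cells. All arcs leaving the cell of `u` enter the
    -- cell of `w` and conversely, and the two cells have the same size because automorphisms embed
    -- each in the other.
    inn≡out : ∀ {u w} → Arc u w → inn w ≡ out u
    inn≡out {u} {w} arc@(e , hw , q) = sym (*-cancelˡ-≡ (out u) (inn w) (length (cell u)) {{>-nonZero cell≥1}} (begin
      length (cell u) * out u                      ≡⟨ ∑-const (out u) (cell u) ⟨
      ∑ (λ _ → out u) (cell u)                     ≡⟨ ∑-cong (cell u) outs ⟨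
      ∑ (λ x → ♯ (Arc x) (cell w)) (cell u)        ≡⟨ ∑-swap (λ x y → ι (Arc x y)) (cell u) (cell w) ⟩
      ∑ (λ y → ♯ (Arc⁻ y) (cell u)) (cell w)       ≡⟨ ∑-cong (cell w) inns ⟩
      ∑ (λ _ → inn w) (cell w)                     ≡⟨ ∑-const (inn w) (cell w) ⟩
      length (cell w) * inn w                      ≡⟨ cong (_* inn w) (≤-antisym (cell-≤ w u) (cell-≤ u w)) ⟩
      length (cell u) * inn w                      ∎))
      where
      open ≡-Reasoning
      cell≥1 : 1 ≤ length (cell u)
      cell≥1 = nonempty (proj₂ (proj₂ (proj₂ (cells u))) u (∼-refl , refl))
      outs : ∀ x → x ∈ cell u → ♯ (Arc x) (cell w) ≡ out u
      outs x x∈ = let (x∼u , hx) = proj₁ (proj₂ (proj₂ (cells u))) x x∈ in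
        trans (degree-on {Arc} proj₁ (proj₁ (proj₂ (cells w))) λ {y} (_ , hy , q′) →
                proj₂ (proj₂ (proj₂ (cells w))) y (Q-fun (Q-resp x∼u ∼-refl q′) q ,
                  trans hy (trans (cong (ℤ._+ + t) hx) (sym hw))))
              (out-≡ x∼u)
      inns : ∀ y → y ∈ cell w → ♯ (Arc⁻ y) (cell u) ≡ inn w
      inns y y∈ = let (y∼w , hy) = proj₁ (proj₂ (proj₂ (cells w))) y y∈ in
        trans (degree-on {Arc⁻} (E-sym G ∘ proj₁) (proj₁ (proj₂ (cells u))) λ {x} (_ , hy′ , q′) →
                proj₂ (proj₂ (proj₂ (cells u))) x (Q-inj (Q-resp ∼-refl y∼w q′) q ,
                  linear (lemma (h x) (h u) (+ t)) (trans (sym hy′) (trans hy hw))))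
              (inn-≡ y∼w)
        where
        lemma : ∀ x u t → x ℤ.+ (u ℤ.+ t) ≡ u ℤ.+ (x ℤ.+ t)
        lemma = solve-∀

    Succ : List (V G) → V G → Set
    Succ A y = ∃[ x ] (x ∈ A × Arc x y)

    successors : ∀ A → ∃[ M ] (Unique M × (∀ y → y ∈ M → Succ A y) × (∀ y → Succ A y → y ∈ M))
    successors A = enumerate (concatMap nb A , λ y (x , x∈ , a) → collect A x∈ (nb⁺ (proj₁ a)))
      where
      collect : ∀ A {x y} → x ∈ A → y ∈ nb x → y ∈ concatMap nb A
      collect (x ∷ A) (here refl) y∈ = ∈-++⁺ˡ y∈
      collect (x ∷ A) (there x∈)  y∈ = ∈-++⁺ʳ (nb x) (collect A x∈ y∈)

    -- Each vertex of `A` sends `out u` arcs to its successors, and by `inn≡out` each successor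
    -- receives at most that many from `A`.
    expand-class : ∀ u A → Unique A → (∀ x → x ∈ A → x ∼ u) → length A ≤ length (proj₁ (successors A))
    expand-class u A uA same = *-cancelʳ-≤ (length A) (length M) (out u) {{>-nonZero (out≥1 u)}} (begin
      length A * out u                        ≡⟨ ∑-const (out u) A ⟨
      ∑ (λ _ → out u) A                       ≡⟨ ∑-cong A (λ x x∈ → sym (trans (degree-on {Arc} proj₁ uM
          (λ a → M-all _ (x , x∈ , a))) (out-≡ (same x x∈)))) ⟩
      ∑ (λ x → ♯ (Arc x) M) A                 ≡⟨ ∑-swap (λ x y → ι (Arc x y)) A M ⟩
      ∑ (λ y → ♯ (Arc⁻ y) A) M                ≤⟨ ∑-mono-≤ M (λ y y∈ → let (x , x∈ , a) = M-succ y y∈ in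
                                                   ≤-trans (degree-bound {Arc⁻} (E-sym G ∘ proj₁) uA)
                                                     (≤-reflexive (trans (inn≡out a) (out-≡ (same x x∈))))) ⟩
      ∑ (λ _ → out u) M                       ≡⟨ ∑-const (out u) M ⟩
      length M * out u                        ∎)
      where
      open ≤-Reasoning
      M : List (V G)
      M = proj₁ (successors A)
      uM : Unique M
      uM = proj₁ (proj₂ (successors A))
      M-succ : ∀ y → y ∈ M → Succ A y
      M-succ = proj₁ (proj₂ (proj₂ (successors A)))
      M-all : ∀ y → Succ A y → y ∈ M
      M-all = proj₂ (proj₂ (proj₂ (successors A)))

    -- The number of outgoing arcs may depend on the orbit, so the counting is done in each orbit
    -- separately; `Q-inj` makes the two sets of successors disjoint.
    expand : ∀ A → Unique A → ∃[ M ] (Unique M × length A ≤ length M ×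
             (∀ w → w ∈ M → ∃[ u ] (u ∈ A × E G u w × h w ≡ h u ℤ.+ + t)))
    expand A uA = M₁ ++ M₂ , Unique.++⁺ (proj₁ (proj₂ (successors A₁))) (proj₁ (proj₂ (successors A₂))) disj , size , pred-of
      where
      o : V G
      o = proj₁ (attained 0ℤ)
      A₁ A₂ M₁ M₂ : List (V G)
      A₁ = select (_∼ o) A
      A₂ = select (λ x → ¬ x ∼ o) A
      M₁ = proj₁ (successors A₁)
      M₂ = proj₁ (successors A₂)
      in₁ : ∀ {x} → x ∈ A₁ → x ∈ A × x ∼ o
      in₁ {x} = ∈-select⁻ {P = _∼ o} {x} {A}
      in₂ : ∀ {x} → x ∈ A₂ → x ∈ A × ¬ x ∼ o
      in₂ {x} = ∈-select⁻ {P = λ z → ¬ z ∼ o} {x} {A}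
      disj : ∀ {y} → y ∈ M₁ × y ∈ M₂ → ⊥
      disj {y} (p , q) = let (x , x∈ , (_ , _ , qx)) = proj₁ (proj₂ (proj₂ (successors A₁))) y p
                             (z , z∈ , (_ , _ , qz)) = proj₁ (proj₂ (proj₂ (successors A₂))) y q in
        proj₂ (in₂ z∈) (∼-trans (Q-inj qz qx) (proj₂ (in₁ x∈)))
      class₂ : ∃[ u ] (∀ x → x ∈ A₂ → x ∼ u)
      class₂ = go em
        where
        go : Dec (∃[ u ] ¬ u ∼ o) → ∃[ u ] (∀ x → x ∈ A₂ → x ∼ u)
        go (yes (u , ¬p)) = u , λ x x∈ → ∼-two (proj₂ (in₂ x∈)) (¬p ∘ ∼-sym)
        go (no ne)        = o , λ x x∈ → ⊥-elim (ne (x , proj₂ (in₂ x∈)))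
      size : length A ≤ length (M₁ ++ M₂)
      size = begin
        length A                                            ≡⟨ ♯-all A (λ _ → id) ⟨
        ♯ (_∈ A) A                                          ≡⟨ ♯-split (_∈ A) (_∼ o) A ⟩
        ♯ (λ x → x ∈ A × x ∼ o) A + ♯ (λ x → x ∈ A × ¬ x ∼ o) A
          ≤⟨ +-mono-≤ (♯-mono A (λ _ _ → proj₂)) (♯-mono A (λ _ _ → proj₂)) ⟩
        ♯ (_∼ o) A + ♯ (λ x → ¬ x ∼ o) A                    ≡⟨ cong₂ _+_ (length-select _ A) (length-select _ A) ⟨
        length A₁ + length A₂
          ≤⟨ +-mono-≤ (expand-class o A₁ (select-unique _ uA) (λ x x∈ → proj₂ (in₁ x∈)))
                      (expand-class (proj₁ class₂) A₂ (select-unique _ uA) (proj₂ class₂)) ⟩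
        length M₁ + length M₂                               ≡⟨ length-++ M₁ ⟨
        length (M₁ ++ M₂)                                   ∎
        where open ≤-Reasoning
      pred-of : ∀ w → w ∈ M₁ ++ M₂ → ∃[ u ] (u ∈ A × E G u w × h w ≡ h u ℤ.+ + t)
      pred-of w w∈ with ∈-++⁻ M₁ w∈
      ... | inj₁ p = let (x , x∈ , (e , hw , _)) = proj₁ (proj₂ (proj₂ (successors A₁))) w p in x , proj₁ (in₁ x∈) , e , hw
      ... | inj₂ p = let (x , x∈ , (e , hw , _)) = proj₁ (proj₂ (proj₂ (successors A₂))) w p in x , proj₁ (in₂ x∈) , e , hw

  expansion : ∀ A → Unique A → ∃[ M ] (Unique M × length A ≤ length M ×
              (∀ w → w ∈ M → ∃[ u ] (u ∈ A × E G u w × h w ≡ h u ℤ.+ + t)))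
  expansion = go balanced
    where
    go : (∀ x → ∃[ y ] (E G x y × h y ≡ h x ℤ.+ + t × x ∼ y)) ⊎ (∀ x → ∃[ y ] (E G x y × h y ≡ h x ℤ.+ + t × ¬ x ∼ y)) → _
    go (inj₁ rise) = Arcs.expand _∼_ (λ p q r → ∼-trans (∼-sym p) (∼-trans r q)) (λ p q → ∼-trans p (∼-sym q))
                       (λ p q → ∼-trans (∼-sym p) q) rise
    go (inj₂ rise) = Arcs.expand (λ x y → ¬ x ∼ y) (λ p q r r′ → r (∼-trans p (∼-trans r′ (∼-sym q))))
                       (λ p q → ∼-two p (q ∘ ∼-sym)) (λ p q → ∼-two (p ∘ ∼-sym) q) rise

-- Cohesion: a steep edge inside an orbit

module Windows (em : ExcludedMiddle 0ℓ) (G : Graph) (lf : LocallyFinite G) (conn : Connected G)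
               (vt : VertexTransitive G) (HS : HeightStructure G) where
  open Counting em
  open Automorphisms G
  open HeightStructure HS
  open Levels em G lf conn vt HS

  window : ℤ → ℕ → List (V G)
  window a zero    = []
  window a (suc n) = window a n ++ level (a ℤ.+ + n)

  window⁺ : ∀ {a v} n j → j < n → h v ≡ a ℤ.+ + j → v ∈ window a n
  window⁺ (suc n) j (s≤s j≤n) eq with m≤n⇒m<n∨m≡n j≤n
  ... | inj₁ j<n  = ∈-++⁺ˡ (window⁺ n j j<n eq)
  ... | inj₂ refl = ∈-++⁺ʳ (window _ n) (level⁺ eq)

  window⁻ : ∀ {a v} n → v ∈ window a n → ∃[ j ] (j < n × h v ≡ a ℤ.+ + j)
  window⁻ {a} (suc n) v∈ with ∈-++⁻ (window a n) v∈
  ... | inj₁ p = let (j , lt , eq) = window⁻ n p in j , m≤n⇒m≤1+n lt , eq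
  ... | inj₂ q = n , ≤-refl , level⁻ q

  window-unique : ∀ a n → Unique (window a n)
  window-unique a zero    = []
  window-unique a (suc n) = Unique.++⁺ (window-unique a n) (level-unique _) λ (p , q) →
    let (j , lt , eq) = window⁻ n p in
    <⇒≢ lt (ℤ.+-injective (+ℤ-cancelˡ a (trans (sym eq) (level⁻ q))))

  window-length : ∀ a n → length (window a n) ≡ n * s
  window-length a zero    = refl
  window-length a (suc n) = trans (length-++ (window a n))
    (trans (cong₂ _+_ (window-length a n) (level-length _)) (+-comm (n * s) s))

  walk-height : ∀ {x y n} → Walk (E G) x y n → ∣ h y ℤ.- h x ∣ ≤ n * t
  walk-height {x} here = ≤-reflexive (cong ∣_∣ (ℤ.i≡j⇒i-j≡0 {h x} refl))
  walk-height {x} {y} (step {b = b} e p) = ≤-trans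
    (≤-trans (≤-reflexive (cong ∣_∣ (lemma (h x) (h b) (h y))))
             (ℤ.∣i+j∣≤∣i∣+∣j∣ (h b ℤ.- h x) (h y ℤ.- h b)))
    (+-mono-≤ (edge-≤ e) (walk-height p))
    where
    lemma : ∀ x b y → y ℤ.- x ≡ b ℤ.- x ℤ.+ (y ℤ.- b)
    lemma = solve-∀

  exit : ∀ {R : V G → V G → Set} {P : V G → Set} {x y n} → Walk R x y n → P x → ¬ P y →
         ∃[ a ] ∃[ b ] ∃[ k ] (Walk R x a k × R a b × P a × ¬ P b)
  exit here px ¬py = ⊥-elim (¬py px)
  exit {P = P} {x} (step {b = b} r p) px ¬py with em {P b}
  ... | no ¬pb = x , b , 0 , here , r , px , ¬pb
  ... | yes pb = let (a , c , k , w , r′ , pa , ¬pc) = exit p pb ¬py in a , c , suc k , step r w , r′ , pa , ¬pc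

  iter-height : ∀ f c → (∀ x → h (f • x) ≡ h x ℤ.+ c) → ∀ n x → h (iter n f • x) ≡ h x ℤ.+ + n ℤ.* c
  iter-height f c sh zero    x = sym (trans (cong (ℤ._+_ (h x)) (ℤ.*-zeroˡ c)) (ℤ.+-identityʳ (h x)))
  iter-height f c sh (suc n) x = trans (sh (iter n f • x)) (trans (cong (ℤ._+ c) (iter-height f c sh n x))
    (trans (lemma (h x) c (+ n ℤ.* c)) (cong (ℤ._+_ (h x)) (sym (ℤ.suc-* (+ n) c)))))
    where
    lemma : ∀ x c nc → x ℤ.+ nc ℤ.+ c ≡ x ℤ.+ (c ℤ.+ nc)
    lemma = solve-∀

  iter-comm : ∀ f n x → iter n f • f • x ≡ f • iter n f • x
  iter-comm f zero    x = refl
  iter-comm f (suc n) x = cong (f •_) (iter-comm f n x)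

  iter-walk : ∀ f {v l} → Walk (E G) v (f • v) l → ∀ n → Walk (E G) v (iter n f • v) (n * l)
  iter-walk f w zero    = here
  iter-walk f {v} w (suc n) = w ++ʷ mapʷ (f •_) (E-pres f) (iter-walk f w n)

  Invariant : (V G → V G → Set) → Set
  Invariant R = ∀ f {x y} → R x y → R (f • x) (f • y)

  inv-≤ : ∀ {i j d : ℕ} → i * suc d ≤ j * suc d → i ≤ j
  inv-≤ {i} {j} {d} = *-cancelʳ-≤ i j (suc d)

  -- Walks modulo a translation

  module Cyclic (g : Aut G) (δ : ℕ) (δ≥1 : 1 ≤ δ) (shift : ∀ x → h (g • x) ≡ h x ℤ.+ + δ) where

    shift⁻ : ∀ x → h (g ⁻ᴬ • x) ≡ h x ℤ.+ ℤ.- + δ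
    shift⁻ x = linear (lemma (h (g ⁻ᴬ • x)) (h x) (+ δ)) (sym (trans (cong h (sym (invˡ g x))) (shift (g ⁻ᴬ • x))))
      where
      lemma : ∀ y x d → y ℤ.+ x ≡ x ℤ.+ ℤ.- d ℤ.+ (y ℤ.+ d)
      lemma = solve-∀

    -- Lying in one orbit of ⟨g⟩, generated by single steps so that invariant relations lift along
    -- it by induction; `straight` recovers the power of `g`.
    data Orb : V G → V G → Set where
      stop : ∀ {x} → Orb x x
      fwd  : ∀ {x y} → Orb (g • x) y → Orb x y
      bwd  : ∀ {x y} → Orb (g ⁻ᴬ • x) y → Orb x y

    Orb-trans : ∀ {x y z} → Orb x y → Orb y z → Orb x z
    Orb-trans stop    q = q
    Orb-trans (fwd p) q = fwd (Orb-trans p q)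
    Orb-trans (bwd p) q = bwd (Orb-trans p q)

    Orb-sym : ∀ {x y} → Orb x y → Orb y x
    Orb-sym stop            = stop
    Orb-sym {x} (fwd p) = Orb-trans (Orb-sym p) (bwd (subst (λ z → Orb z x) (sym (invʳ g x)) stop))
    Orb-sym {x} (bwd p) = Orb-trans (Orb-sym p) (fwd (subst (λ z → Orb z x) (sym (invˡ g x)) stop))

    Orb-lift : ∀ {R} → Invariant R → ∀ {x y x′} → Orb x y → R x x′ → ∃[ y′ ] (Orb x′ y′ × R y y′)
    Orb-lift inv stop    r = _ , stop , r
    Orb-lift {R} inv (fwd p) r = let (y′ , q , r′) = Orb-lift {R} inv p (inv g r) in y′ , fwd q , r′
    Orb-lift {R} inv (bwd p) r = let (y′ , q , r′) = Orb-lift {R} inv p (inv (g ⁻ᴬ) r) in y′ , bwd q , r′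

    Orb-lift-walk : ∀ {R} → Invariant R → ∀ {x y x′ n} → Orb x y → Walk R x x′ n →
                    ∃[ y′ ] (Orb x′ y′ × Walk R y y′ n)
    Orb-lift-walk {R} inv p w = Orb-lift {λ a b → Walk R a b _} (λ f → mapʷ (f •_) (inv f)) p w

    straight : ∀ {x y} → Orb x y → ∃[ n ] (iter n g • x ≡ y ⊎ iter n (g ⁻ᴬ) • x ≡ y)
    straight stop = 0 , inj₁ refl
    straight {x} (fwd p) with straight p
    ... | n , inj₁ refl     = suc n , inj₁ (sym (iter-comm g n x))
    ... | zero , inj₂ refl  = 1 , inj₁ refl
    ... | suc n , inj₂ refl = n , inj₂ (sym (trans (sym (iter-comm (g ⁻ᴬ) n (g • x))) (cong (iter n (g ⁻ᴬ) •_) (invʳ g x))))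
    straight {x} (bwd p) with straight p
    ... | n , inj₂ refl     = suc n , inj₂ (sym (iter-comm (g ⁻ᴬ) n x))
    ... | zero , inj₁ refl  = 1 , inj₂ refl
    ... | suc n , inj₁ refl = n , inj₁ (sym (trans (sym (iter-comm g n (g ⁻ᴬ • x))) (cong (iter n g •_) (invˡ g x))))

    Orb-move : ∀ z x → ∃[ y ] (Orb x y × h y ≡ h x ℤ.+ z ℤ.* + δ)
    Orb-move (+ n) x = iter n g • x , go n , iter-height g (+ δ) shift n x
      where
      go : ∀ n → Orb x (iter n g • x)
      go zero    = stop
      go (suc n) = Orb-trans (go n) (fwd stop)
    Orb-move -[1+ n ] x = iter (suc n) (g ⁻ᴬ) • x , go (suc n) ,
      trans (iter-height (g ⁻ᴬ) (ℤ.- + δ) shift⁻ (suc n) x) (cong (ℤ._+_ (h x)) (lemma (+ suc n) (+ δ)))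
      where
      go : ∀ n → Orb x (iter n (g ⁻ᴬ) • x)
      go zero    = stop
      go (suc n) = Orb-trans (go n) (bwd stop)
      lemma : ∀ n d → n ℤ.* ℤ.- d ≡ ℤ.- n ℤ.* d
      lemma = solve-∀

    Q : List (V G)
    Q = window 0ℤ δ

    Q-length : length Q ≡ δ * s
    Q-length = window-length 0ℤ δ

    rep : ∀ x → ∃[ q ] (q ∈ Q × Orb x q)
    rep x = let instance _ = >-nonZero δ≥1
                k = h x ℤ./ℕ δ ; r = h x ℤ.%ℕ δ
                (y , o , hy) = Orb-move (ℤ.- k) x in
      y , window⁺ δ r (ℤ.n%ℕd<d (h x) δ) (trans hy (trans (cong (ℤ._+ (ℤ.- k ℤ.* + δ)) (ℤ.a≡a%ℕn+[a/ℕn]*n (h x) δ))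
            (lemma (+ r) k (+ δ)))) , o
      where
      lemma : ∀ r k d → r ℤ.+ k ℤ.* d ℤ.+ ℤ.- k ℤ.* d ≡ 0ℤ ℤ.+ r
      lemma = solve-∀

    iter-distance : ∀ n x → ∣ h (iter n g • x) ℤ.- h x ∣ ≡ n * δ
    iter-distance n x = trans (cong ∣_∣ (trans (cong (ℤ._- h x) (iter-height g (+ δ) shift n x)) (lemma (h x)
        (+ n ℤ.* + δ))))
                          (ℤ.abs-* (+ n) (+ δ))
      where
      lemma : ∀ x d → x ℤ.+ d ℤ.- x ≡ d
      lemma = solve-∀

    iter⁻-distance : ∀ n x → ∣ h (iter n (g ⁻ᴬ) • x) ℤ.- h x ∣ ≡ n * δ
    iter⁻-distance n x = trans (cong ∣_∣ (trans (cong (ℤ._- h x) (iter-height (g ⁻ᴬ) (ℤ.- + δ) shift⁻ n x))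
        (lemma (h x) (+ n ℤ.* ℤ.- + δ))))
                          (trans (ℤ.abs-* (+ n) (ℤ.- + δ)) (cong (n *_) (ℤ.∣-i∣≡∣i∣ (+ δ))))
      where
      lemma : ∀ x d → x ℤ.+ d ℤ.- x ≡ d
      lemma = solve-∀

    return : ∀ {v l} → Walk (E G) v (g • v) l → ∀ {w} → Orb v w → ∃[ n ] (Walk (E G) w v (n * l) × n * δ ≡ ∣ h w ℤ.- h v ∣)
    return {v} p o with straight o
    ... | n , inj₁ refl = n , reverseʷ (E-sym G) (iter-walk g p n) , sym (iter-distance n v)
    ... | n , inj₂ refl = n , reverseʷ (E-sym G) (iter-walk (g ⁻ᴬ) back n) , sym (iter⁻-distance n v)
      where
      back : Walk (E G) v (g ⁻ᴬ • v) _
      back = reverseʷ (E-sym G) (subst (λ z → Walk (E G) (g ⁻ᴬ • v) z _) (invʳ g v) (mapʷ (g ⁻ᴬ •_) (E-pres (g ⁻ᴬ)) p))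

    module _ (u : V G) where

      Reached : ℕ → V G → Set
      Reached i x = ∃[ y ] (Orb x y × Within (E G) i u y)

      -- An edge leaving the reached set can be moved by a power of `g` to the end of a walk already
      -- found. So every stage that misses a vertex is followed by one with a new representative in
      -- the period `Q`.
      reach-all : ∀ x → Reached (pred (length Q)) x
      reach-all x = let (q , q∈ , o) = rep x ; (y , o′ , w) = growth Reached Q start up grow q q∈ in
        y , Orb-trans o o′ , w
        where
        start : ∃[ q ] (q ∈ Q × Reached 0 q)
        start = let (q , q∈ , o) = rep u in q , q∈ , u , Orb-sym o , 0 , z≤n , here
        up : ∀ i x → Reached i x → Reached (suc i) x
        up i x (y , o , k , le , w) = y , o , k , m≤n⇒m≤1+n le , w
        grow : ∀ i → (∀ x → x ∈ Q → Reached i x) ⊎ ∃[ x ] (x ∈ Q × Reached (suc i) x × ¬ Reached i x)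
        grow i = decide em
          where
          decide : Dec (∃[ x ] ¬ Reached i x) → _
          decide (no ne) = inj₁ λ x _ → by-contradiction λ n → ne (x , n)
          decide (yes (x , ¬r)) =
            let (a , b , _ , _ , e , (y , o , k , le , w) , ¬rb) = exit {P = Reached i} (proj₂ (conn u x))
                    (u , stop , 0 , z≤n , here) ¬r
                (y′ , o′ , e′) = Orb-lift {E G} E-pres o e
                (q , q∈ , oq) = rep b in
            inj₂ (q , q∈ , (y′ , Orb-trans (Orb-sym oq) o′ , suc k , s≤s le , snocʷ w e′) ,
                  λ (z , oz , wz) → ¬rb (z , Orb-trans oq oz , wz))

  height-sum : ∀ {u v y l} → ∣ h u ℤ.- h v ∣ ≤ 1 → Walk (E G) u y l → ∣ h y ℤ.- h v ∣ ≤ l * t + 1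
  height-sum {u} {v} {y} {l} close w = ≤-trans
    (≤-trans (≤-reflexive (cong ∣_∣ (lemma (h y) (h u) (h v)))) (ℤ.∣i+j∣≤∣i∣+∣j∣ (h y ℤ.- h u) (h u ℤ.- h v)))
    (+-mono-≤ (walk-height w) close)
    where
    lemma : ∀ y u v → y ℤ.- v ≡ y ℤ.- u ℤ.+ (u ℤ.- v)
    lemma = solve-∀

  -- The search needs one step less than `k`, and the height `t` saved by this absorbs the
  -- difference of at most 1 between the heights of `u` and `v`.
  slack : ∀ {l k} → l ≤ pred k → 1 ≤ k → l * t + 1 ≤ k * t
  slack {l} {suc k} le _ = ≤-trans (+-mono-≤ (*-monoˡ-≤ t le) t≥1) (≤-reflexive (+-comm (k * t) t))

  cohesive-steep : ∀ {a b} → E G a b → a ∼ b → h a ≢ h b → ∀ u v → ∣ h u ℤ.- h v ∣ ≤ 1 → Within (E G) (2 * s * t) u v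
  cohesive-steep {a} {b} e a∼b a≢b u v close = start (vt a v)
    where
    finish : ∀ g k → (∀ x → h (g • x) ≡ h x ℤ.+ + suc k) → E G v (g • v) → Within (E G) (2 * s * t) u v
    finish g k shift edge = l + n * 1 , total , w ++ʷ back
      where
      open Cyclic g (suc k) (s≤s z≤n) shift
      reached = reach-all u v
      y = proj₁ reached
      l = proj₁ (proj₂ (proj₂ reached))
      l≤ : l ≤ pred (suc k * s)
      l≤ = subst (λ n → l ≤ pred n) Q-length (proj₁ (proj₂ (proj₂ (proj₂ reached))))
      w = proj₂ (proj₂ (proj₂ (proj₂ reached)))
      returned = return (step edge here) (proj₁ (proj₂ reached))
      n = proj₁ returned
      back = proj₁ (proj₂ returned)
      δ≤t : suc k ≤ t
      δ≤t = subst (_≤ t) (trans (iter-distance 1 v) (+-identityʳ (suc k))) (edge-≤ edge)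
      -- A search of fewer than δ s steps ends less than δ s of the largest rises away, and every
      -- returning step changes the height by δ; so δ cancels.
      n≤ : n ≤ s * t
      n≤ = inv-≤ {d = k} (begin
        n * suc k             ≡⟨ proj₂ (proj₂ returned) ⟩
        ∣ h y ℤ.- h v ∣       ≤⟨ height-sum close w ⟩
        l * t + 1             ≤⟨ slack l≤ (*-mono-≤ {1} {suc k} (s≤s z≤n) s≥1) ⟩
        suc k * s * t         ≡⟨ *-assoc (suc k) s t ⟩
        suc k * (s * t)       ≡⟨ *-comm (suc k) (s * t) ⟩
        s * t * suc k         ∎)
        where open ≤-Reasoning
      total : l + n * 1 ≤ 2 * s * t
      total = begin
        l + n * 1             ≤⟨ +-mono-≤ (≤-trans l≤ (≤-trans pred[n]≤n (≤-trans (*-monoˡ-≤ s δ≤t)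
            (≤-reflexive (*-comm t s)))))
                                          (≤-trans (≤-reflexive (*-identityʳ n)) n≤) ⟩
        s * t + s * t         ≡⟨ cong (_+_ (s * t)) (+-identityʳ (s * t)) ⟨
        2 * (s * t)           ≡⟨ *-assoc 2 s t ⟨
        2 * s * t             ∎
        where open ≤-Reasoning
    orient : ∀ g → E G v (g • v) → h (g • v) ≢ h v → (∀ x → h (g • x) ℤ.+ h v ≡ h x ℤ.+ h (g • v)) → Within
        (E G) (2 * s * t) u v
    orient g edge ≢ hg = go (h (g • v) ℤ.- h v) refl
      where
      lemma : ∀ gx x gv v → gx ℤ.+ (x ℤ.+ gv) ≡ x ℤ.+ (gv ℤ.- v) ℤ.+ (gx ℤ.+ v)
      lemma = solve-∀
      by : ∀ x → h (g • x) ≡ h x ℤ.+ (h (g • v) ℤ.- h v)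
      by x = linear (lemma (h (g • x)) (h x) (h (g • v)) (h v)) (hg x)
      go : ∀ D → h (g • v) ℤ.- h v ≡ D → Within (E G) (2 * s * t) u v
      go (+ zero)    eq = ⊥-elim (≢ (ℤ.i-j≡0⇒i≡j _ _ eq))
      go (+ suc k)   eq = finish g k (λ x → trans (by x) (cong (ℤ._+_ (h x)) eq)) edge
      go (-[1+ k ])  eq = finish (g ⁻ᴬ) k
        (λ x → linear (lemma′ (h (g ⁻ᴬ • x)) (h x) (+ suc k))
          (sym (trans (cong h (sym (invˡ g x))) (trans (by (g ⁻ᴬ • x)) (cong (ℤ._+_ (h (g ⁻ᴬ • x))) eq)))))
        (subst (λ z → E G z (g ⁻ᴬ • v)) (invʳ g v) (E-pres (g ⁻ᴬ) (E-sym G edge)))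
        where
        lemma′ : ∀ y x d → y ℤ.+ x ≡ x ℤ.+ d ℤ.+ (y ℤ.+ ℤ.- d)
        lemma′ = solve-∀
    start : (Σ (Aut G) λ f → f • a ≡ v) → Within (E G) (2 * s * t) u v
    start (f , refl) = let (g , gv≡ , hg , _) = moves (∼-• f a∼b) in
      orient g (subst (E G (f • a)) (sym gv≡) (E-pres f e))
        (λ eq → a≢b (aut-level⁻ f (trans (sym eq) (cong h gv≡))))
        (λ x → trans (hg x) (cong (λ z → h x ℤ.+ h z) (sym gv≡)))

-- Cohesion: only horizontal edges inside the orbits

abs-bound : ∀ {a b n} → ∣ a ℤ.- b ∣ ≤ n → a ℤ.≤ b ℤ.+ + n
abs-bound {a} {b} {n} le = subst (ℤ._≤ b ℤ.+ + n) (lemma a b)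
  (ℤ.+-monoʳ-≤ b (ℤ.≤-trans (i≤∣i∣ (a ℤ.- b)) (ℤ.+≤+ le)))
  where
  i≤∣i∣ : ∀ i → i ℤ.≤ + ∣ i ∣
  i≤∣i∣ (+ n)    = ℤ.≤-refl
  i≤∣i∣ -[1+ n ] = ℤ.-≤+
  lemma : ∀ a b → b ℤ.+ (a ℤ.- b) ≡ a
  lemma = solve-∀

module Flat (em : ExcludedMiddle 0ℓ) (G : Graph) (lf : LocallyFinite G) (conn : Connected G)
            (vt : VertexTransitive G) (HS : HeightStructure G)
            (flat : ∀ {x y} → E G x y → HeightStructure._∼_ HS x y → HeightStructure.h HS x ≡ HeightStructure.h HS y)
            (rise : ∀ x → ∃[ y ] (E G x y × HeightStructure.h HS y ≡ HeightStructure.h HS x ℤ.+ + HeightStructure.t HS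
                                  × ¬ HeightStructure._∼_ HS x y)) where
  open Counting em
  open Automorphisms G
  open HeightStructure HS
  open Levels em G lf conn vt HS
  open Windows em G lf conn vt HS

  ∼-•⁻ : ∀ f {x y} → f • x ∼ f • y → x ∼ y
  ∼-•⁻ f p = subst₂ _∼_ (invʳ f _) (invʳ f _) (∼-• (f ⁻ᴬ) p)

  Cross Hor HC : V G → V G → Set
  Cross x y = E G x y × ¬ x ∼ y
  Hor x y   = E G x y × x ∼ y
  HC x y    = ∃[ n ] Walk Hor x y n

  Cross-inv : Invariant Cross
  Cross-inv f (e , n) = E-pres f e , n ∘ ∼-•⁻ f

  Cross-sym : ∀ {x y} → Cross x y → Cross y x
  Cross-sym (e , n) = E-sym G e , n ∘ ∼-sym

  Hor-inv : Invariant Hor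
  Hor-inv f (e , p) = E-pres f e , ∼-• f p

  HC-inv : Invariant HC
  HC-inv f (n , w) = n , mapʷ (f •_) (Hor-inv f) w

  HC-refl : ∀ x → HC x x
  HC-refl x = 0 , here

  HC-sym : ∀ {x y} → HC x y → HC y x
  HC-sym (n , w) = n , reverseʷ (λ (e , p) → E-sym G e , ∼-sym p) w

  HC-trans : ∀ {x y z} → HC x y → HC y z → HC x z
  HC-trans (m , w) (n , w′) = m + n , w ++ʷ w′

  Hor-level : ∀ {x y n} → Walk Hor x y n → h x ≡ h y
  Hor-level here             = refl
  Hor-level (step (e , p) w) = trans (flat e p) (Hor-level w)

  Hor-∼ : ∀ {x y n} → Walk Hor x y n → x ∼ y
  Hor-∼ here             = ∼-refl
  Hor-∼ (step (e , p) w) = ∼-trans p (Hor-∼ w)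

  classes : ∀ x → ∃[ L ] (Unique L × (∀ y → y ∈ L → HC x y) × (∀ y → HC x y → y ∈ L))
  classes x = enumerate (level (h x) , λ y (n , w) → level⁺ (sym (Hor-level w)))

  class : V G → List (V G)
  class x = proj₁ (classes x)

  class⁻ : ∀ {x y} → y ∈ class x → HC x y
  class⁻ {x} = proj₁ (proj₂ (proj₂ (classes x))) _

  class⁺ : ∀ {x y} → HC x y → y ∈ class x
  class⁺ {x} = proj₂ (proj₂ (proj₂ (classes x))) _

  class-unique : ∀ x → Unique (class x)
  class-unique x = proj₁ (proj₂ (classes x))

  class-≤ : ∀ x y → length (class x) ≤ length (class y)
  class-≤ x y = let (f , fx≡y) = vt x y in
    subst (_≤ length (class y)) (length-map (f •_) (class x))
      (length-⊆ (Unique.map⁺ (•-injective f) (class-unique x)) λ z z∈ →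
        let (z′ , z′∈ , eq) = ∈-map⁻ (f •_) z∈ in
        class⁺ (subst₂ HC fx≡y (sym eq) (HC-inv f (class⁻ z′∈))))

  o : V G
  o = proj₁ (attained 0ℤ)

  m d : ℕ
  m = length (class o)
  d = degree Cross o

  class-length : ∀ x → length (class x) ≡ m
  class-length x = ≤-antisym (class-≤ x o) (class-≤ o x)

  m≥1 : 1 ≤ m
  m≥1 = nonempty (class⁺ (HC-refl o))

  degree-≡ : ∀ x → degree Cross x ≡ d
  degree-≡ x = ≤-antisym (go x o) (go o x)
    where
    go : ∀ x y → degree Cross x ≤ degree Cross y
    go x y = let (f , fx≡y) = vt x y in
      subst (λ z → degree Cross x ≤ degree Cross z) fx≡y (degree-≤ {Cross} proj₁ f (Cross-inv f))

  d≥1 : 1 ≤ d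
  d≥1 = let (y , e , _ , n) = rise o in ♯-positive {P = Cross o} (nb⁺ e) (e , n)

  class-diameter : ∀ {x y} → HC x y → Within Hor (pred m) x y
  class-diameter {x} {y} p = subst (λ n → Within Hor (pred n) x y) (class-length x)
    (growth (λ i z → Within Hor i x z) (class x) (x , class⁺ (HC-refl x) , 0 , z≤n , here)
      (λ i z (k , le , w) → k , m≤n⇒m≤1+n le , w) grow y (class⁺ p))
    where
    grow : ∀ i → (∀ z → z ∈ class x → Within Hor i x z) ⊎
                 ∃[ z ] (z ∈ class x × Within Hor (suc i) x z × ¬ Within Hor i x z)
    grow i = decide em
      where
      decide : Dec (∃[ z ] (z ∈ class x × ¬ Within Hor i x z)) → _
      decide (no ne) = inj₁ λ z z∈ → by-contradiction λ n → ne (z , z∈ , n)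
      decide (yes (z , z∈ , ¬r)) =
        let (a , b , k , w , r , (l , le , w′) , ¬rb) = exit {P = Within Hor i x} (proj₂ (class⁻ z∈)) (0 , z≤n , here) ¬r in
        inj₂ (b , class⁺ (suc k , snocʷ w r) , (suc l , s≤s le , snocʷ w′ r) , ¬rb)

  -- The search modulo a translation along two rising cross edges

  module Line (v v⁺ v⁺⁺ : V G) (e₁ : E G v v⁺) (h₁ : h v⁺ ≡ h v ℤ.+ + t) (n₁ : ¬ v ∼ v⁺)
              (e₂ : E G v⁺ v⁺⁺) (h₂ : h v⁺⁺ ≡ h v⁺ ℤ.+ + t)
              (g : Aut G) (gv≡ : g • v ≡ v⁺⁺) (hg : ∀ x → h (g • x) ℤ.+ h v ≡ h x ℤ.+ h v⁺⁺)
              (g∼ : ∀ x → x ∼ g • x) (u : V G) where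

    δ : ℕ
    δ = t + t

    shift : ∀ x → h (g • x) ≡ h x ℤ.+ + δ
    shift x = linear (lemma (h (g • x)) (h x) (h v) (h v⁺) (h v⁺⁺) (+ t)) (cong₂ ℤ._+_ (hg x) (cong₂ ℤ._+_ h₁ h₂))
      where
      lemma : ∀ gx x v v′ v″ t → gx ℤ.+ (x ℤ.+ v″ ℤ.+ (v ℤ.+ t ℤ.+ (v′ ℤ.+ t))) ≡ x ℤ.+ (t ℤ.+ t) ℤ.+
          (gx ℤ.+ v ℤ.+ (v′ ℤ.+ v″))
      lemma = solve-∀

    open Cyclic g δ (≤-trans t≥1 (m≤m+n t t)) shift

    Orb-∼ : ∀ {x y} → Orb x y → x ∼ y
    Orb-∼ stop        = ∼-refl
    Orb-∼ {x} (fwd p) = ∼-trans (g∼ x) (Orb-∼ p)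
    Orb-∼ {x} (bwd p) = ∼-trans (∼-sym (subst (_ ∼_) (invˡ g x) (g∼ (g ⁻ᴬ • x)))) (Orb-∼ p)

    -- The stages of a search modulo g in which a cross edge costs one step and each of the
    -- horizontal classes passed at most m − 1.
    A : ℕ → V G → Set
    A zero    x = ∃[ y ] (Orb x y × HC u y)
    A (suc j) x = ∃[ a ] ∃[ w ] ∃[ y ] (A j a × Cross a w × HC w y × Orb x y)

    A-Orb : ∀ j {x y} → Orb x y → A j x → A j y
    A-Orb zero    o (y , p , q)             = y , Orb-trans (Orb-sym o) p , q
    A-Orb (suc j) o (a , w , y , p , c , q , r) = a , w , y , p , c , q , Orb-trans (Orb-sym o) r

    A-HC : ∀ j {x y} → HC x y → A j x → A j y
    A-HC zero    hc (y , p , q) = let (z , oz , hc′) = Orb-lift {HC} HC-inv p hc in z , oz , HC-trans q hc′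
    A-HC (suc j) hc (a , w , y , p , c , q , r) =
      let (z , oz , hc′) = Orb-lift {HC} HC-inv r hc in a , w , z , p , c , HC-trans q hc′ , oz

    A-cross : ∀ j {x y} → Cross x y → A j x → A (suc j) y
    A-cross j {x} {y} c p = x , y , y , p , c , HC-refl y , stop

    A-∼ : ∀ j {x y} → A j x → A j y → x ∼ y
    A-∼ zero    (x′ , p , _ , w) (y′ , q , _ , w′) =
      ∼-trans (∼-trans (Orb-∼ p) (∼-sym (Hor-∼ w))) (∼-trans (Hor-∼ w′) (∼-sym (Orb-∼ q)))
    A-∼ (suc j) (a , w , _ , p , (_ , c) , (_ , q) , r) (a′ , w′ , _ , p′ , (_ , c′) , (_ , q′) , r′) =
      ∼-trans (∼-trans (Orb-∼ r) (∼-sym (Hor-∼ q)))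
        (∼-trans (∼-two (c ∘ ∼-sym) λ s → c′ (∼-trans (∼-sym (A-∼ j p p′)) s)) (∼-trans (Hor-∼ q′) (∼-sym (Orb-∼ r′))))

    A-alternate : ∀ j {x y} → A j x → A (suc j) y → ¬ x ∼ y
    A-alternate j p (a , w , _ , p′ , (_ , c) , (_ , q) , r) xy =
      c (∼-trans (A-∼ j p′ p) (∼-trans xy (∼-trans (Orb-∼ r) (∼-sym (Hor-∼ q)))))

    A-inhabited : ∀ j → ∃[ x ] A j x
    A-inhabited zero    = u , u , stop , HC-refl u
    A-inhabited (suc j) = let (x , p) = A-inhabited j ; (y , e , _ , n) = rise x in y , A-cross j (e , n) p

    A-reach : ∀ j {x} → A j x → ∃[ y ] (Orb x y × Within (E G) (pred m + j * m) u y)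
    A-reach zero (y , p , hc) = let (k , le , w) = class-diameter hc in
      y , p , k , ≤-trans le (m≤m+n (pred m) 0) , mapʷ id proj₁ w
    A-reach (suc j) (a , w , y , p , c , hc , r) =
      let (a′ , oa , k , le , wk) = A-reach j p
          (w′ , ow , c′) = Orb-lift {Cross} Cross-inv oa c
          (l , le′ , wl) = class-diameter hc
          (y′ , oy , wl′) = Orb-lift-walk {Hor} Hor-inv ow wl in
      y′ , Orb-trans r oy , k + suc l , bound k l le le′ , wk ++ʷ step (proj₁ c′) (mapʷ id proj₁ wl′)
      where
      bound : ∀ k l → k ≤ pred m + j * m → l ≤ pred m → k + suc l ≤ pred m + suc j * m
      bound k l le le′ = begin
        k + suc l                      ≤⟨ +-mono-≤ le (≤-trans (s≤s le′) (≤-reflexive (suc-pred m {{>-nonZero m≥1}}))) ⟩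
        pred m + j * m + m             ≡⟨ +-assoc (pred m) (j * m) m ⟩
        pred m + (j * m + m)           ≡⟨ cong (_+_ (pred m)) (+-comm (j * m) m) ⟩
        pred m + suc j * m             ∎
        where open ≤-Reasoning

    c : ℕ → ℕ
    c j = ♯ (A j) Q

    Q⁻ : ∀ {x} → x ∈ Q → ∃[ k ] (k < δ × h x ≡ + k)
    Q⁻ x∈ = let (k , lt , eq) = window⁻ δ x∈ in k , lt , trans eq (ℤ.+-identityˡ (+ k))

    Q⁺ : ∀ {x k} → k < δ → h x ≡ + k → x ∈ Q
    Q⁺ {k = k} lt eq = window⁺ δ k lt (trans eq (sym (ℤ.+-identityˡ (+ k))))

    -- Three consecutive periods. An edge changes the height by at most `t`, half of the period, so
    -- all cross neighbours of vertices in `Q` lie in `W`.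
    W : List (V G)
    W = map (g ⁻ᴬ •_) Q ++ Q ++ map (g •_) Q

    W-unique : Unique W
    W-unique = Unique.++⁺ (Unique.map⁺ (•-injective (g ⁻ᴬ)) uQ)
                 (Unique.++⁺ uQ (Unique.map⁺ (•-injective g) uQ) λ (p , q) → above p q)
                 λ (p , q) → below p (∈-++⁻ Q q)
      where
      uQ : Unique Q
      uQ = window-unique 0ℤ δ
      above : ∀ {x} → x ∈ Q → x ∈ map (g •_) Q → ⊥
      above p q = let (y , y∈ , eq) = ∈-map⁻ (g •_) q ; (k , lt , hk) = Q⁻ p ; (l , _ , hl) = Q⁻ y∈ in
        <⇒≱ lt (≤-trans (m≤n+m δ l) (≤-reflexive (ℤ.+-injective
          (trans (ℤ.pos-+ l δ) (trans (cong (ℤ._+ + δ) (sym hl)) (trans (sym (shift y)) (trans (cong h (sym eq)) hk)))))))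
      lowered : ∀ {x} → x ∈ map (g ⁻ᴬ •_) Q → ∃[ k ] (k < δ × h (g • x) ≡ + k)
      lowered p = let (y , y∈ , eq) = ∈-map⁻ (g ⁻ᴬ •_) p ; (k , lt , hk) = Q⁻ y∈ in
        k , lt , trans (cong (λ z → h (g • z)) eq) (trans (cong h (invˡ g y)) hk)
      below : ∀ {x} → x ∈ map (g ⁻ᴬ •_) Q → x ∈ Q ⊎ x ∈ map (g •_) Q → ⊥
      below {x} p (inj₁ q) = let (k , lt , hk) = lowered p ; (l , _ , hl) = Q⁻ q in
        <⇒≱ lt (≤-trans (m≤n+m δ l) (≤-reflexive (ℤ.+-injective
          (trans (ℤ.pos-+ l δ) (trans (cong (ℤ._+ + δ) (sym hl)) (trans (sym (shift x)) hk))))))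
      below {x} p (inj₂ q) = let (k , lt , hk) = lowered p ; (y , y∈ , eq) = ∈-map⁻ (g •_) q ; (l , _ , hl) = Q⁻ y∈ in
        <⇒≱ lt (≤-trans (m≤n+m δ (l + δ)) (≤-reflexive (ℤ.+-injective
          (trans (trans (ℤ.pos-+ (l + δ) δ) (cong (ℤ._+ + δ) (trans (ℤ.pos-+ l δ)
                   (trans (cong (ℤ._+ + δ) (sym hl)) (trans (sym (shift y)) (cong h (sym eq)))))))
                 (trans (sym (shift x)) hk)))))

    W-covers : ∀ {x y} → x ∈ Q → Cross x y → y ∈ W
    W-covers {x} {y} x∈ (e , _) = go (h y) refl
      where
      k : ℕ
      k = proj₁ (Q⁻ x∈)
      k<δ : k < δ
      k<δ = proj₁ (proj₂ (Q⁻ x∈))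
      hx : h x ≡ + k
      hx = proj₂ (proj₂ (Q⁻ x∈))
      upper : h y ℤ.≤ + k ℤ.+ + t
      upper = subst (λ z → h y ℤ.≤ z ℤ.+ + t) hx (abs-bound {h y} {h x} (edge-≤ e))
      lower : + k ℤ.≤ h y ℤ.+ + t
      lower = subst (λ z → z ℤ.≤ h y ℤ.+ + t) hx (abs-bound {h x} {h y} (edge-≤ (E-sym G e)))
      go : ∀ i → h y ≡ i → y ∈ W
      go (+ l) hy with l <? δ
      ... | yes l<δ = ∈-++⁺ʳ (map (g ⁻ᴬ •_) Q) (∈-++⁺ˡ (Q⁺ l<δ hy))
      ... | no l≮δ  = ∈-++⁺ʳ (map (g ⁻ᴬ •_) Q) (∈-++⁺ʳ Q (subst (_∈ map (g •_) Q) (invˡ g y)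
              (∈-map⁺ (g •_) (Q⁺ {k = l ∸ δ} small (trans (shift⁻ y) (trans (cong (ℤ._+ ℤ.- + δ) hy)
                (trans (ℤ.m-n≡m⊖n l δ) (ℤ.⊖-≥ (≮⇒≥ l≮δ)))))))))
        where
        l≤ : l ≤ k + t
        l≤ = ℤ.drop‿+≤+ (subst (ℤ._≤ + k ℤ.+ + t) hy upper)
        small : l ∸ δ < δ
        small = +-cancelʳ-< δ (l ∸ δ) δ (begin-strict
          l ∸ δ + δ   ≡⟨ m∸n+n≡m (≮⇒≥ l≮δ) ⟩
          l           ≤⟨ l≤ ⟩
          k + t       <⟨ +-mono-<-≤ k<δ (m≤m+n t t) ⟩
          δ + δ       ∎)
          where open ≤-Reasoning
      go -[1+ l ] hy = ∈-++⁺ˡ (subst (_∈ map (g ⁻ᴬ •_) Q) (invʳ g y)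
          (∈-map⁺ (g ⁻ᴬ •_) (Q⁺ {k = δ ∸ suc l} (∸-monoʳ-< {δ} {suc l} {0} (s≤s z≤n) sl≤δ)
            (trans (shift y) (trans (cong (ℤ._+ + δ) hy) (ℤ.⊖-≥ sl≤δ))))))
        where
        sl≤t : suc l ≤ t
        sl≤t = ℤ.drop‿+≤+ (ℤ.0≤i-j⇒j≤i (ℤ.≤-trans (ℤ.+≤+ z≤n) (subst (λ z → + k ℤ.≤ z ℤ.+ + t) hy lower)))
        sl≤δ : suc l ≤ δ
        sl≤δ = ≤-trans sl≤t (m≤m+n t t)

    flow : ∀ j → V G → V G → Set
    flow j x y = A j x × Cross x y

    flow-out : ∀ j x → x ∈ Q → ♯ (flow j x) W ≡ ι (A j x) * d
    flow-out j x x∈ = go em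
      where
      go : Dec (A j x) → ♯ (flow j x) W ≡ ι (A j x) * d
      go (yes p) = begin
        ♯ (flow j x) W       ≡⟨ ♯-cong W (λ _ _ → proj₂) (λ _ _ c → p , c) ⟩
        ♯ (Cross x) W        ≡⟨ degree-on {Cross} proj₁ W-unique (W-covers x∈) ⟩
        degree Cross x       ≡⟨ degree-≡ x ⟩
        d                    ≡⟨ *-identityˡ d ⟨
        1 * d                ≡⟨ cong (_* d) (ι-yes p) ⟨
        ι (A j x) * d        ∎
        where open ≡-Reasoning
      go (no ¬p) = trans (♯-none W (λ _ _ (p , _) → ¬p p)) (cong (_* d) (sym (ι-no ¬p)))

    into : ∀ j → V G → V G → Set
    into j y x = flow j x y

    into-≤ : ∀ j y → ♯ (into j y) W ≤ ι (A (suc j) y) * d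
    into-≤ j y = go em
      where
      go : Dec (A (suc j) y) → ♯ (into j y) W ≤ ι (A (suc j) y) * d
      go (yes p) = begin
        ♯ (into j y) W       ≤⟨ ♯-mono W (λ _ _ (_ , c) → Cross-sym c) ⟩
        ♯ (Cross y) W        ≤⟨ degree-bound {Cross} proj₁ W-unique ⟩
        degree Cross y       ≡⟨ degree-≡ y ⟩
        d                    ≡⟨ *-identityˡ d ⟨
        1 * d                ≡⟨ cong (_* d) (ι-yes p) ⟨
        ι (A (suc j) y) * d  ∎
        where open ≤-Reasoning
      go (no ¬p) = ≤-trans (≤-reflexive (♯-none W (λ _ _ (p , c) → ¬p (A-cross j c p)))) z≤n

    into-< : ∀ j {y x} → y ∈ Q → A (suc j) y → Cross y x → ¬ A j x → ♯ (into j y) W < ι (A (suc j) y) * d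
    into-< j {y} {x} y∈ p c ¬a = begin-strict
      ♯ (into j y) W       <⟨ ♯-mono-< W (λ _ _ (_ , c) → Cross-sym c) (W-covers y∈ c) (λ (a , _) → ¬a a) c ⟩
      ♯ (Cross y) W        ≤⟨ degree-bound {Cross} proj₁ W-unique ⟩
      degree Cross y       ≡⟨ degree-≡ y ⟩
      d                    ≡⟨ *-identityˡ d ⟨
      1 * d                ≡⟨ cong (_* d) (ι-yes p) ⟨
      ι (A (suc j) y) * d  ∎
      where open ≤-Reasoning

    flow-inv : ∀ j f → (∀ {x} → A j x → A j (f • x)) → ∀ {x y} → flow j x y → flow j (f • x) (f • y)
    flow-inv j f cl (a , c) = cl a , Cross-inv f c

    -- Counting the flow modulo g: the arcs from the period Q into W are moved to arcs from W into Q.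
    conservation : ∀ j → c j * d ≡ ∑ (λ y → ♯ (into j y) W) Q
    conservation j = begin
      c j * d                                        ≡⟨ ∑-*ʳ (λ x → ι (A j x)) d Q ⟨
      ∑ (λ x → ι (A j x) * d) Q                      ≡⟨ ∑-cong Q (flow-out j) ⟨
      ∑ (λ x → ♯ (flow j x) W) Q                     ≡⟨ ∑-swap (λ x y → ι (flow j x y)) Q W ⟩
      ∑ φ W                                          ≡⟨ ∑-++ φ (map (g ⁻ᴬ •_) Q) (Q ++ map (g •_) Q) ⟩
      ∑ φ (map (g ⁻ᴬ •_) Q) + ∑ φ (Q ++ map (g •_) Q)
        ≡⟨ cong₂ _+_ (∑-map φ (g ⁻ᴬ •_) Q) (trans (∑-++ φ Q (map (g •_) Q)) (cong (_+_ (∑ φ Q)) (∑-map φ (g •_) Q))) ⟩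
      ∑ (λ y → φ (g ⁻ᴬ • y)) Q + (∑ φ Q + ∑ (λ y → φ (g • y)) Q)
        ≡⟨ cong (_+_ (∑ (λ y → φ (g ⁻ᴬ • y)) Q)) (∑-+ φ (λ y → φ (g • y)) Q) ⟨
      ∑ (λ y → φ (g ⁻ᴬ • y)) Q + ∑ (λ y → φ y + φ (g • y)) Q
        ≡⟨ ∑-+ (λ y → φ (g ⁻ᴬ • y)) (λ y → φ y + φ (g • y)) Q ⟨
      ∑ (λ y → φ (g ⁻ᴬ • y) + (φ y + φ (g • y))) Q   ≡⟨ ∑-cong Q (λ y _ → regroup y) ⟩
      ∑ (λ y → ♯ (into j y) W) Q                     ∎
      where
      open ≡-Reasoning
      φ : V G → ℕ
      φ y = ♯ (into j y) Q
      up : ∀ {x} → A j x → A j (g • x)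
      up = A-Orb j (fwd stop)
      down : ∀ {x} → A j x → A j (g ⁻ᴬ • x)
      down = A-Orb j (bwd stop)
      φ-up : ∀ y → φ (g • y) ≡ ♯ (into j y) (map (g ⁻ᴬ •_) Q)
      φ-up y = trans (♯-cong Q
          (λ x _ fl → subst (flow j (g ⁻ᴬ • x)) (invʳ g y) (flow-inv j (g ⁻ᴬ) down fl))
          (λ x _ fl → subst (λ z → flow j z (g • y)) (invˡ g x) (flow-inv j g up fl)))
        (sym (∑-map (λ x → ι (into j y x)) (g ⁻ᴬ •_) Q))
      φ-down : ∀ y → φ (g ⁻ᴬ • y) ≡ ♯ (into j y) (map (g •_) Q)
      φ-down y = trans (♯-cong Q
          (λ x _ fl → subst (flow j (g • x)) (invˡ g y) (flow-inv j g up fl))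
          (λ x _ fl → subst (λ z → flow j z (g ⁻ᴬ • y)) (invʳ g x) (flow-inv j (g ⁻ᴬ) down fl)))
        (sym (∑-map (λ x → ι (into j y x)) (g •_) Q))
      regroup : ∀ y → φ (g ⁻ᴬ • y) + (φ y + φ (g • y)) ≡ ♯ (into j y) W
      regroup y = begin
        φ (g ⁻ᴬ • y) + (φ y + φ (g • y))     ≡⟨ cong₂ _+_ (φ-down y) (cong (_+_ (φ y)) (φ-up y)) ⟩
        n₊ + (φ y + n₋)                      ≡⟨ +-comm n₊ (φ y + n₋) ⟩
        φ y + n₋ + n₊                        ≡⟨ cong (_+ n₊) (+-comm (φ y) n₋) ⟩
        n₋ + φ y + n₊                        ≡⟨ +-assoc n₋ (φ y) n₊ ⟩
        n₋ + (φ y + n₊)                      ≡⟨ cong (_+_ n₋) (∑-++ ψ Q (map (g •_) Q)) ⟨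
        n₋ + ♯ (into j y) (Q ++ map (g •_) Q)  ≡⟨ ∑-++ ψ (map (g ⁻ᴬ •_) Q) (Q ++ map (g •_) Q) ⟨
        ♯ (into j y) W                       ∎
        where
        ψ : V G → ℕ
        ψ x = ι (into j y x)
        n₊ n₋ : ℕ
        n₊ = ♯ (into j y) (map (g •_) Q)
        n₋ = ♯ (into j y) (map (g ⁻ᴬ •_) Q)

    -- All cross neighbours of stage `j` lie in the next stage. Modulo `g`, every vertex of stage
    -- `j` sends `d` arcs there and every vertex of the next stage receives at most `d`.
    c-mono : ∀ j → c j ≤ c (suc j)
    c-mono j = *-cancelʳ-≤ (c j) (c (suc j)) d {{>-nonZero d≥1}} (begin
      c j * d                             ≡⟨ conservation j ⟩
      ∑ (λ y → ♯ (into j y) W) Q          ≤⟨ ∑-mono-≤ Q (λ y _ → into-≤ j y) ⟩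
      ∑ (λ y → ι (A (suc j) y) * d) Q     ≡⟨ ∑-*ʳ (λ y → ι (A (suc j) y)) d Q ⟩
      c (suc j) * d                       ∎)
      where open ≤-Reasoning

    -- A vertex of the next stage with a cross neighbour outside stage `j` receives fewer than `d`
    -- arcs from it.
    c-mono-< : ∀ j {y x} → A (suc j) y → Cross y x → ¬ A j x → c j < c (suc j)
    c-mono-< j {y} p cr ¬a = let (q , q∈ , oq) = rep y ; (x′ , ox , cr′) = Orb-lift {Cross} Cross-inv oq cr in
      *-cancelʳ-< d (c j) (c (suc j)) (begin-strict
        c j * d                             ≡⟨ conservation j ⟩
        ∑ (λ y → ♯ (into j y) W) Q
          <⟨ ∑-mono-< Q (λ y _ → into-≤ j y) q∈ (into-< j q∈ (A-Orb (suc j) oq p) cr′ (¬a ∘ A-Orb j (Orb-sym ox))) ⟩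
        ∑ (λ y → ι (A (suc j) y) * d) Q     ≡⟨ ∑-*ʳ (λ y → ι (A (suc j) y)) d Q ⟩
        c (suc j) * d                       ∎)
      where open ≤-Reasoning

    -- A stage is closed under horizontal connectivity, and `Q` consists of whole levels, so every
    -- horizontal class that meets their intersection lies in it.
    c-multiple : ∀ j → ∃[ k ] c j ≡ k * m
    c-multiple j = let (k , eq) = equal-classes HC HC-refl HC-sym HC-trans m L size in
        k , trans (sym (length-select (A j) Q)) eq
      where
      L : List (V G)
      L = select (A j) Q
      L⁻ : ∀ {x} → x ∈ L → x ∈ Q × A j x
      L⁻ {x} = ∈-select⁻ {P = A j} {x} {Q}
      size : ∀ x → x ∈ L → ♯ (HC x) L ≡ m
      size x x∈ = trans (≤-antisym
          (♯≤length-⊆ {P = HC x} (select-unique (A j) (window-unique 0ℤ δ)) (λ y _ → class⁺))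
          (length≤♯ {P = HC x} (class-unique x) λ y y∈ → let (n , w) = class⁻ y∈ ; (q , a) = L⁻ x∈ ; (k , lt , hx) = Q⁻ q in
            ∈-select⁺ {P = A j} (Q⁺ lt (trans (sym (Hor-level w)) hx)) (A-HC j (n , w) a) , (n , w)))
        (class-length x)

    Full : ℕ → Set
    Full j = ∀ x → A j x ⊎ A (suc j) x

    -- Some edge leaves the union of the two stages. It is not horizontal, as both stages are closed
    -- under horizontal steps, and it does not start in stage `j`, whose cross neighbours lie in the
    -- next one. So it is a cross edge from the next stage and the increase is strict; between
    -- multiples of `m` this means at least `m`.
    c-grow : ∀ j → ¬ Full j → c j + m ≤ c (suc j)
    c-grow j ¬full = multiples (c-multiple j) (c-multiple (suc j)) (strict missing)
      where
      missing : ∃[ x ] ¬ (A j x ⊎ A (suc j) x)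
      missing = ¬∀⇒∃¬ ¬full
      strict : (∃[ x ] ¬ (A j x ⊎ A (suc j) x)) → c j < c (suc j)
      strict (x , n) = let (a₀ , p₀) = A-inhabited j
                           (a , b , _ , _ , e , pa , ¬pb) = exit {P = λ z → A j z ⊎ A (suc j) z} (proj₂
                               (conn a₀ x)) (inj₁ p₀) n in
        cases e pa ¬pb em
        where
        cases : ∀ {a b} → E G a b → A j a ⊎ A (suc j) a → ¬ (A j b ⊎ A (suc j) b) → Dec (a ∼ b) → c j < c (suc j)
        cases e (inj₁ p) ¬pb (yes s) = ⊥-elim (¬pb (inj₁ (A-HC j (1 , step (e , s) here) p)))
        cases e (inj₂ p) ¬pb (yes s) = ⊥-elim (¬pb (inj₂ (A-HC (suc j) (1 , step (e , s) here) p)))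
        cases e (inj₁ p) ¬pb (no ¬s) = ⊥-elim (¬pb (inj₂ (A-cross j (e , ¬s) p)))
        cases e (inj₂ p) ¬pb (no ¬s) = c-mono-< j p (e , ¬s) (¬pb ∘ inj₁)
      multiples : (∃[ k ] c j ≡ k * m) → (∃[ k ] c (suc j) ≡ k * m) → c j < c (suc j) → c j + m ≤ c (suc j)
      multiples (k , eq) (k′ , eq′) lt = subst₂ _≤_ (trans (+-comm m (k * m)) (cong (_+ m) (sym eq))) (sym eq′)
        (*-monoˡ-≤ m (*-cancelʳ-< m k k′ (subst₂ _<_ eq eq′ lt)))

    c-disjoint : ∀ j → c j + c (suc j) ≤ length Q
    c-disjoint j = begin
      c j + c (suc j)                 ≤⟨ +-mono-≤ (♯-mono Q (λ _ x∈ p → x∈ , p)) (♯-mono Q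
          (λ _ x∈ p → x∈ , λ q → A-alternate j q p ∼-refl)) ⟩
      ♯ (λ x → x ∈ Q × A j x) Q + ♯ (λ x → x ∈ Q × ¬ A j x) Q    ≡⟨ ♯-split (_∈ Q) (A j) Q ⟨
      ♯ (_∈ Q) Q                      ≡⟨ ♯-all Q (λ _ → id) ⟩
      length Q                        ∎
      where open ≤-Reasoning

    c-start : m ≤ c 0
    c-start = from (c-multiple 0) (let (q , q∈ , oq) = rep u in ♯-positive {P = A 0} q∈ (A-Orb 0 oq (u , stop , HC-refl u)))
      where
      from : (∃[ k ] c 0 ≡ k * m) → 1 ≤ c 0 → m ≤ c 0
      from (zero , eq)  pos = ⊥-elim (<⇒≱ pos (≤-reflexive eq))
      from (suc k , eq) pos = ≤-trans (m≤m+n m (k * m)) (≤-reflexive (sym eq))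

    -- As long as no stage is full the counts grow by at least `m` at a time, whereas they never
    -- exceed `length Q`.
    full-stage : ∃[ i ] (Full i × suc i * m ≤ c i)
    full-stage = finish (claim (length Q))
      where
      claim : ∀ j → (∃[ i ] (Full i × suc i * m ≤ c i)) ⊎ suc j * m ≤ c j
      claim zero = inj₂ (≤-trans (≤-reflexive (*-identityˡ m)) c-start)
      claim (suc j) = next (claim j) em
        where
        next : (∃[ i ] (Full i × suc i * m ≤ c i)) ⊎ suc j * m ≤ c j → Dec (Full j) → (∃[ i ]
            (Full i × suc i * m ≤ c i)) ⊎ suc (suc j) * m ≤ c (suc j)
        next (inj₁ p)  _         = inj₁ p
        next (inj₂ le) (yes f)   = inj₁ (j , f , le)
        next (inj₂ le) (no ¬f)   = inj₂ (≤-trans (≤-reflexive (+-comm m (suc j * m))) (≤-trans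
            (+-monoˡ-≤ m le) (c-grow j ¬f)))
      finish : (∃[ i ] (Full i × suc i * m ≤ c i)) ⊎ suc (length Q) * m ≤ c (length Q) → ∃[ i ] (Full i × suc i * m ≤ c i)
      finish (inj₁ p)  = p
      finish (inj₂ le) = ⊥-elim (<⇒≱ {length Q} {suc (length Q) * m}
        (≤-trans (≤-reflexive (sym (*-identityʳ (suc (length Q))))) (*-monoʳ-≤ (suc (length Q)) m≥1))
        (≤-trans le (♯≤length (A (length Q)) Q)))

    -- Stage `i` is disjoint from the next one and no larger, so it occupies at most half of the 2 s
    -- t vertices of a period.
    stage-bound : ∀ i → suc i * m ≤ c i → suc i * m ≤ s * t
    stage-bound i le = *-cancelʳ-≤ (suc i * m) (s * t) 2 (begin
      suc i * m * 2                 ≡⟨ *-comm (suc i * m) 2 ⟩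
      suc i * m + (suc i * m + 0)   ≤⟨ +-mono-≤ le (≤-trans (≤-reflexive (+-identityʳ (suc i * m)))
          (≤-trans le (c-mono i))) ⟩
      c i + c (suc i)               ≤⟨ c-disjoint i ⟩
      length Q                      ≡⟨ Q-length ⟩
      (t + t) * s                   ≡⟨ *-comm (t + t) s ⟩
      s * (t + t)                   ≡⟨ *-distribˡ-+ s t t ⟩
      s * t + s * t                 ≡⟨ cong (_+_ (s * t)) (+-identityʳ (s * t)) ⟨
      2 * (s * t)                   ≡⟨ *-comm 2 (s * t) ⟩
      s * t * 2                     ∎)
      where open ≤-Reasoning

    edge-walk : Walk (E G) v (g • v) 2
    edge-walk = step e₁ (step (subst (E G v⁺) (sym gv≡) e₂) here)

    edge-walk⁺ : Walk (E G) v⁺ (g • v⁺) 2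
    edge-walk⁺ = step (subst (E G v⁺) (sym gv≡) e₂) (step (E-pres g e₁) here)

    return-v : ∀ {y} → Orb v y → ∃[ n ] (Walk (E G) y v n × n * t ≤ ∣ h y ℤ.- h v ∣)
    return-v p = let (n , w , eq) = return edge-walk p in
      n * 2 , w , ≤-reflexive (trans (double n) eq)
      where
      double : ∀ n → n * 2 * t ≡ n * (t + t)
      double n = trans (*-assoc n 2 t) (cong (λ k → n * (t + k)) (+-identityʳ t))

    -- The walk follows the line ..., `g ⁻ᴬ • v⁺`, `v`, `v⁺`, `g • v`, ..., on which each step
    -- changes the height by exactly `t`; its length is the height difference divided by `t`.
    return-v⁺ : ∀ {y} → Orb v⁺ y → ∃[ n ] (Walk (E G) y v n × n * t ≤ ∣ h y ℤ.- h v ∣)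
    return-v⁺ p = go (straight p)
      where
      odd : ∀ n → suc (n * 2) * t ≡ t + n * δ
      odd n = cong (_+_ t) (trans (*-assoc n 2 t) (cong (λ k → n * (t + k)) (+-identityʳ t)))
      go : ∀ {y} → ∃[ n ] (iter n g • v⁺ ≡ y ⊎ iter n (g ⁻ᴬ) • v⁺ ≡ y) → ∃[ n ] (Walk (E G) y v n × n * t ≤ ∣ h y ℤ.- h v ∣)
      go (n , inj₁ refl) = suc (n * 2) ,
        snocʷ (reverseʷ (E-sym G) (iter-walk g edge-walk⁺ n)) (E-sym G e₁) ,
        ≤-reflexive (trans (odd n) (sym (trans (cong ∣_∣ (trans (cong (ℤ._- h v) (trans (iter-height g
            (+ δ) shift n v⁺) (cong (ℤ._+ + n ℤ.* + δ) h₁)))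
          (lemma (h v) (+ t) (+ n ℤ.* + δ)))) (cong (λ z → ∣ + t ℤ.+ z ∣) (sym (ℤ.pos-* n δ))))))
        where
        lemma : ∀ v t d → v ℤ.+ t ℤ.+ d ℤ.- v ≡ t ℤ.+ d
        lemma = solve-∀
      go (zero , inj₂ refl) = go (zero , inj₁ refl)
      -- A negative power puts the vertex below `v`, so one factor is split off: the way back ends
      -- with the edge from `g ⁻ᴬ • v⁺` up to `v` and does not go on to `v⁺`.
      go (suc n , inj₂ refl) = suc (n * 2) ,
        snocʷ (reverseʷ (E-sym G) (subst (λ z → Walk (E G) x z (n * 2)) (iter-comm (g ⁻ᴬ) n v⁺) (iter-walk
            (g ⁻ᴬ) back n))) x—v ,
        ≤-reflexive (trans (odd n) (sym (trans (cong ∣_∣ (trans (cong (ℤ._- h v) height)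
          (lemma (h v) (+ t) (+ n)))) (trans (ℤ.∣-i∣≡∣i∣ (+ t ℤ.+ + n ℤ.* + δ)) (cong (λ z → ∣ + t ℤ.+ z ∣)
              (sym (ℤ.pos-* n δ)))))))
        where
        x : V G
        x = g ⁻ᴬ • v⁺
        x—v : E G x v
        x—v = subst (E G x) (trans (cong (g ⁻ᴬ •_) (sym gv≡)) (invʳ g v)) (E-pres (g ⁻ᴬ) e₂)
        back : Walk (E G) x (g ⁻ᴬ • x) 2
        back = reverseʷ (E-sym G) (mapʷ (g ⁻ᴬ •_) (E-pres (g ⁻ᴬ)) (subst (λ z → Walk (E G) x z 2) (invˡ g v⁺) edge-walk-x))
          where
          edge-walk-x : Walk (E G) x (g • x) 2
          edge-walk-x = step x—v (step (subst (E G v) (sym (invˡ g v⁺)) e₁) here)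
        height : h (iter (suc n) (g ⁻ᴬ) • v⁺) ≡ h v ℤ.+ + t ℤ.+ (ℤ.- + δ ℤ.+ + n ℤ.* ℤ.- + δ)
        height = trans (iter-height (g ⁻ᴬ) (ℤ.- + δ) shift⁻ (suc n) v⁺)
          (cong₂ ℤ._+_ h₁ (ℤ.suc-* (+ n) (ℤ.- + δ)))
        lemma : ∀ v t n → v ℤ.+ t ℤ.+ (ℤ.- (t ℤ.+ t) ℤ.+ n ℤ.* ℤ.- (t ℤ.+ t)) ℤ.- v ≡ ℤ.- (t ℤ.+ n ℤ.* (t ℤ.+ t))
        lemma = solve-∀

    -- v and v⁺ lie in different classes, so a full stage contains one of them.
    target : ∃[ y ] ((Orb v y ⊎ Orb v⁺ y) × Within (E G) (pred (s * t)) u y)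
    target = go (proj₁ (proj₂ full-stage) v)
      where
      i : ℕ
      i = proj₁ full-stage
      shorten : ∀ {y} → Within (E G) (pred m + i * m) u y → Within (E G) (pred (s * t)) u y
      -- The cost of stage `i` is (m - 1) + i m = (i + 1) m - 1, hence at most s t - 1.
      shorten (k , le , w) = k , ≤-trans le (≤-trans (≤-reflexive (pred-sum m≥1)) (pred-mono-≤ (stage-bound i
          (proj₂ (proj₂ full-stage))))) , w
        where
        pred-sum : ∀ {m k} → 1 ≤ m → pred m + k ≡ pred (m + k)
        pred-sum (s≤s _) = refl
      go : A i v ⊎ A (suc i) v → _
      go (inj₁ p) = let (y , o , w) = A-reach i p in y , inj₁ o , shorten w
      go (inj₂ p) = go⁺ (proj₁ (proj₂ full-stage) v⁺)
        where
        go⁺ : A i v⁺ ⊎ A (suc i) v⁺ → _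
        go⁺ (inj₁ q) = let (y , o , w) = A-reach i q in y , inj₂ o , shorten w
        go⁺ (inj₂ q) = ⊥-elim (n₁ (A-∼ (suc i) p q))

    within : ∣ h u ℤ.- h v ∣ ≤ 1 → Within (E G) (2 * s * t) u v
    within close = let (y , o , l , l≤ , w) = target ; (n , back , n≤) = homeward o in
      l + n , (begin
        l + n                 ≤⟨ +-mono-≤ (≤-trans l≤ pred[n]≤n)
                                   (*-cancelʳ-≤ n (s * t) t {{>-nonZero t≥1}} (≤-trans n≤ (≤-trans
                                       (height-sum close w) (slack l≤ (*-mono-≤ s≥1 t≥1))))) ⟩
        s * t + s * t         ≡⟨ cong (_+_ (s * t)) (+-identityʳ (s * t)) ⟨
        2 * (s * t)           ≡⟨ *-assoc 2 s t ⟨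
        2 * s * t             ∎) , w ++ʷ back
      where
      open ≤-Reasoning
      homeward : ∀ {y} → Orb v y ⊎ Orb v⁺ y → ∃[ n ] (Walk (E G) y v n × n * t ≤ ∣ h y ℤ.- h v ∣)
      homeward (inj₁ p) = return-v p
      homeward (inj₂ p) = return-v⁺ p

  cohesive-flat : ∀ u v → ∣ h u ℤ.- h v ∣ ≤ 1 → Within (E G) (2 * s * t) u v
  cohesive-flat u v = let (v⁺ , e₁ , h₁ , n₁) = rise v ; (v⁺⁺ , e₂ , h₂ , n₂) = rise v⁺
                          (g , gv≡ , hg , g∼) = moves (∼-two n₁ n₂) in
    Line.within v v⁺ v⁺⁺ e₁ h₁ n₁ e₂ h₂ g gv≡ hg g∼ u

-- The cyclic system

module RingStructure (em : ExcludedMiddle 0ℓ) (G : Graph) (lf : LocallyFinite G) (conn : Connected G)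
                     (vt : VertexTransitive G) (HS : HeightStructure G) where
  open Counting em
  open Automorphisms G
  open HeightStructure HS
  open Levels em G lf conn vt HS
  open Windows em G lf conn vt HS

  ascent-≢ : ∀ {a b} → b ≡ a ℤ.+ + t → a ≢ b
  ascent-≢ {a} refl eq = <⇒≢ t≥1 (ℤ.+-injective (+ℤ-cancelˡ a (trans (ℤ.+-identityʳ a) eq)))

  cohesive : ∀ u v → ∣ h u ℤ.- h v ∣ ≤ 1 → Within (E G) (2 * s * t) u v
  cohesive = go em balanced
    where
    go : Dec (∃[ a ] ∃[ b ] (E G a b × a ∼ b × h a ≢ h b)) →
         (∀ x → ∃[ y ] (E G x y × h y ≡ h x ℤ.+ + t × x ∼ y)) ⊎ (∀ x → ∃[ y ] (E G x y × h y ≡ h x ℤ.+ + t × ¬ x ∼ y)) →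
         ∀ u v → ∣ h u ℤ.- h v ∣ ≤ 1 → Within (E G) (2 * s * t) u v
    go (yes (a , b , e , p , ne)) _ = cohesive-steep e p ne
    go (no none) (inj₁ rise) = let (x , _) = attained 0ℤ ; (y , e , hy , p) = rise x in
      ⊥-elim (none (x , y , e , p , ascent-≢ hy))
    go (no none) (inj₂ rise) = Flat.cohesive-flat em G lf conn vt HS
      (λ {x} {y} e p → by-contradiction λ ne → none (x , y , e , p , ne)) rise

  Next : ℤ → ℤ → Set
  Next a b = b ≡ a ℤ.+ 1ℤ ⊎ a ≡ b ℤ.+ 1ℤ

  next⇒abs : ∀ {a b} → Next a b → ∣ b ℤ.- a ∣ ≡ 1
  next⇒abs {a} (inj₁ refl) = cong ∣_∣ (lemma a)
    where
    lemma : ∀ a → a ℤ.+ 1ℤ ℤ.- a ≡ 1ℤ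
    lemma = solve-∀
  next⇒abs {b = b} (inj₂ refl) = cong ∣_∣ (lemma b)
    where
    lemma : ∀ b → b ℤ.- (b ℤ.+ 1ℤ) ≡ ℤ.- 1ℤ
    lemma = solve-∀

  abs⇒next : ∀ {a b} → ∣ b ℤ.- a ∣ ≡ 1 → Next a b
  abs⇒next {a} {b} eq with abs-cases (b ℤ.- a)
  ... | inj₁ p = inj₁ (linear (lemma a b) (trans p (cong +_ eq)))
    where
    lemma : ∀ a b → b ℤ.+ 1ℤ ≡ a ℤ.+ 1ℤ ℤ.+ (b ℤ.- a)
    lemma = solve-∀
  ... | inj₂ p = inj₂ (linear (lemma a b) (sym (trans p (cong (λ n → ℤ.- + n) eq))))
    where
    lemma : ∀ a b → a ℤ.+ (b ℤ.- a) ≡ b ℤ.+ 1ℤ ℤ.+ ℤ.- 1ℤ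
    lemma = solve-∀

  system : CyclicSystem G
  system = record
    { B = ℤ ; block = h ; surj = attained ; R = Next
    ; cyc = inj₂ (↔-id ℤ , λ a b → mk⇔ id id)
    ; imprim = λ f u v → aut-level f
    ; presR = λ f u v → mk⇔ (λ r → abs⇒next (trans (diff-abs f u v) (next⇒abs r)))
                            (λ r → abs⇒next (trans (sym (diff-abs f u v)) (next⇒abs r))) }

  Next-walk : ∀ n a → Walk Next a (a ℤ.+ + n) n
  Next-walk zero    a = subst (λ z → Walk Next a z 0) (sym (ℤ.+-identityʳ a)) here
  Next-walk (suc n) a = step (inj₁ refl) (subst (λ z → Walk Next (a ℤ.+ 1ℤ) z n) (ℤ.+-assoc a 1ℤ (+ n))
      (Next-walk n (a ℤ.+ 1ℤ)))

  Next-sym : ∀ {a b} → Next a b → Next b a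
  Next-sym (inj₁ p) = inj₂ p
  Next-sym (inj₂ p) = inj₁ p

  Next-walk-between : ∀ a b → Walk Next a b ∣ b ℤ.- a ∣
  Next-walk-between a b with abs-cases (b ℤ.- a)
  ... | inj₁ p = subst (λ z → Walk Next a z ∣ b ℤ.- a ∣) (linear (lemma a b (+ ∣ b ℤ.- a ∣)) (sym p))
      (Next-walk ∣ b ℤ.- a ∣ a)
    where
    lemma : ∀ a b n → a ℤ.+ n ℤ.+ (b ℤ.- a) ≡ b ℤ.+ n
    lemma = solve-∀
  ... | inj₂ p = reverseʷ Next-sym (subst (λ z → Walk Next b z ∣ b ℤ.- a ∣) (linear (lemma a b
      (+ ∣ b ℤ.- a ∣)) p) (Next-walk ∣ b ℤ.- a ∣ b))
    where
    lemma : ∀ a b n → b ℤ.+ n ℤ.+ ℤ.- n ≡ a ℤ.+ (b ℤ.- a)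
    lemma = solve-∀

  ring-like : RingLike G system s t
  ring-like = (λ b → level b , level-unique b , level-length b , λ v → mk⇔ level⁻ level⁺) ,
              λ u v e → ∣ h v ℤ.- h u ∣ , edge-≤ e , Next-walk-between (h u) (h v)

  cohesive-system : Cohesive G system (2 * s * t)
  cohesive-system u v (inj₁ eq) = cohesive u v (≤-trans (≤-reflexive (cong ∣_∣ (ℤ.i≡j⇒i-j≡0 {h u} eq))) z≤n)
  cohesive-system u v (inj₂ r)  = cohesive u v (≤-reflexive (next⇒abs (Next-sym r)))

  -- Components outside a finite set and the value of κ∞

  height-bound : ∀ L → ∃[ N ] (∀ x → x ∈ L → ∣ h x ∣ ≤ N)
  height-bound []      = 0 , λ x ()
  height-bound (y ∷ L) = let (N , b) = height-bound L in ∣ h y ∣ ⊔ N , λ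
    { x (here refl) → m≤m⊔n ∣ h y ∣ N
    ; x (there m)   → ≤-trans (b x m) (m≤n⊔m ∣ h y ∣ N) }

  -- `X` has heights at most `N` in absolute value. A walk given by cohesion has at most 2 s t
  -- edges, each changing the height by at most `t`; started at height `K` or beyond, on either
  -- side, it cannot come down to `X`.
  module Sides (X : List (V G)) (N K : ℕ) (bounded : ∀ x → x ∈ X → ∣ h x ∣ ≤ N) (N<K : N + 2 * s * t * t < K) where

    high : ∀ {x} → N < ∣ h x ∣ → x ∉ X
    high lt x∈ = <⇒≱ lt (bounded _ x∈)

    K>0 : 0 < K
    K>0 = ≤-trans (s≤s z≤n) N<K

    edge-height : ∀ {x y} → E G x y → ∣ h x ∣ ≤ t + ∣ h y ∣
    edge-height {x} {y} e = ≤-trans (≤-trans (≤-reflexive (cong ∣_∣ (lemma (h x) (h y)))) (ℤ.∣i+j∣≤∣i∣+∣j∣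
        (h x ℤ.- h y) (h y)))
                              (+-monoˡ-≤ ∣ h y ∣ (edge-≤ (E-sym G e)))
      where
      lemma : ∀ x y → x ≡ x ℤ.- y ℤ.+ y
      lemma = solve-∀

    avoid : ∀ {x y n} → Walk (E G) x y n → N + n * t < ∣ h x ∣ → ConnAvoid G X x y
    avoid {x} here lt = x∉ , x∉ , 0 , here
      where
      x∉ : x ∉ X
      x∉ = high (≤-trans (s≤s (m≤m+n N 0)) lt)
    avoid {x} {n = suc n} (step {b = b} e p) lt =
      let (b∉ , y∉ , k , w) = avoid p lt′ in x∉ , y∉ , suc k , step (x∉ , b∉ , e) w
      where
      x∉ : x ∉ X
      x∉ = high (≤-trans (s≤s (m≤m+n N (suc n * t))) lt)
      lt′ : N + n * t < ∣ h b ∣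
      lt′ = +-cancelˡ-< t (N + n * t) ∣ h b ∣ (begin-strict
        t + (N + n * t)   ≡⟨ +-comm t (N + n * t) ⟩
        N + n * t + t     ≡⟨ +-assoc N (n * t) t ⟩
        N + (n * t + t)   ≡⟨ cong (_+_ N) (+-comm (n * t) t) ⟩
        N + suc n * t     <⟨ lt ⟩
        ∣ h x ∣           ≤⟨ edge-height e ⟩
        t + ∣ h b ∣       ∎)
        where open ≤-Reasoning

    ConnAvoid-sym : ∀ {x y} → ConnAvoid G X x y → ConnAvoid G X y x
    ConnAvoid-sym (p , q , n , w) = q , p , n , reverseʷ (λ (a , b , e) → b , a , E-sym G e) w

    ConnAvoid-trans : ∀ {x y z} → ConnAvoid G X x y → ConnAvoid G X y z → ConnAvoid G X x z
    ConnAvoid-trans (p , _ , m , w) (_ , q , n , w′) = p , q , m + n , w ++ʷ w′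

    near : ∀ {x y} → K ≤ ∣ h x ∣ → ∣ h x ℤ.- h y ∣ ≤ 1 → ConnAvoid G X x y
    near far close = let (n , le , w) = cohesive _ _ close in
      avoid w (≤-trans (s≤s (+-monoʳ-≤ N (*-monoˡ-≤ t le))) (≤-trans N<K far))

    module Side (ε : ℤ) (ε-unit : ∣ ε ∣ ≡ 1) where

      ε-abs : ∀ z → ∣ ε ℤ.* z ∣ ≡ ∣ z ∣
      ε-abs z = trans (ℤ.abs-* ε z) (trans (cong (_* ∣ z ∣) ε-unit) (*-identityˡ ∣ z ∣))

      origin : V G
      origin = proj₁ (attained (ε ℤ.* + K))

      h-origin : h origin ≡ ε ℤ.* + K
      h-origin = proj₂ (attained (ε ℤ.* + K))

      far-≤ : ∀ {x} a → K ≤ a → h x ≡ ε ℤ.* + a → K ≤ ∣ h x ∣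
      far-≤ a le eq = ≤-trans le (≤-reflexive (sym (trans (cong ∣_∣ eq) (ε-abs (+ a)))))

      to-origin : ∀ i {x} → h x ≡ ε ℤ.* + (i + K) → ConnAvoid G X x origin
      to-origin zero {x} eq = near (far-≤ K ≤-refl eq)
        (≤-trans (≤-reflexive (cong ∣_∣ (ℤ.i≡j⇒i-j≡0 {h x} (trans eq (sym h-origin))))) z≤n)
      to-origin (suc i) {x} eq = let (y , hy) = attained (ε ℤ.* + (i + K)) in
        ConnAvoid-trans (near (far-≤ (suc i + K) (m≤n+m K (suc i)) eq)
          (≤-reflexive (trans (cong ∣_∣ (trans (cong₂ ℤ._-_ eq hy) (lemma ε (+ (i + K))))) (ε-abs 1ℤ)))) (to-origin i hy)
        where
        lemma : ∀ e k → e ℤ.* (1ℤ ℤ.+ k) ℤ.- e ℤ.* k ≡ e ℤ.* 1ℤ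
        lemma = solve-∀

      infinite : InfiniteComponent G X origin
      infinite = high (≤-trans (s≤s (m≤m+n N _)) (≤-trans N<K (far-≤ K ≤-refl h-origin))) , λ (L , all) →
        let (M , b) = height-bound L ; (x , hx) = attained (ε ℤ.* + (suc M + K)) in
        <⇒≱ {M} {suc M + K} (m≤m+n (suc M) K) (≤-trans (≤-reflexive (sym (trans (cong ∣_∣ hx) (ε-abs _))))
          (b x (all x (ConnAvoid-sym (to-origin (suc M) hx)))))

    module Left  = Side (ℤ.- 1ℤ) refl
    module Right = Side 1ℤ refl

    left right : V G
    left  = Left.origin
    right = Right.origin

    far-side : ∀ {x} → K ≤ ∣ h x ∣ → ConnAvoid G X left x ⊎ ConnAvoid G X right x
    far-side {x} le = go (h x) refl
      where
      go : ∀ i → h x ≡ i → ConnAvoid G X left x ⊎ ConnAvoid G X right x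
      go i eq with abs-cases i
      ... | inj₁ p = inj₂ (ConnAvoid-sym (Right.to-origin (∣ i ∣ ∸ K)
            (trans eq (trans p (trans (cong +_ (sym (m∸n+n≡m (subst (λ z → K ≤ ∣ z ∣) eq le)))) (sym (ℤ.*-identityˡ _)))))))
      ... | inj₂ p = inj₁ (ConnAvoid-sym (Left.to-origin (∣ i ∣ ∸ K)
            (trans eq (trans p (trans (cong (λ n → ℤ.- + n) (sym (m∸n+n≡m (subst (λ z → K ≤ ∣ z ∣) eq le))))
                (sym (ℤ.-1*i≡-i _)))))))

    -- The heights strictly between -K and K contain finitely many vertices, so an infinite
    -- component has a vertex farther out, which is joined level by level to one of the two origins.
    infinite-far : ∀ {w} → InfiniteComponent G X w → ConnAvoid G X left w ⊎ ConnAvoid G X right w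
    infinite-far {w} (w∉ , ¬fin) = by (by-contradiction λ ne → ¬fin (window (ℤ.- + K) (K + K) , λ x c →
        low x (≰⇒> λ le → ne (x , c , le))))
      where
      by : ∃[ x ] (ConnAvoid G X w x × K ≤ ∣ h x ∣) → ConnAvoid G X left w ⊎ ConnAvoid G X right w
      by (x , c , le) with far-side le
      ... | inj₁ p = inj₁ (ConnAvoid-trans p (ConnAvoid-sym c))
      ... | inj₂ p = inj₂ (ConnAvoid-trans p (ConnAvoid-sym c))
      low : ∀ x → ∣ h x ∣ < K → x ∈ window (ℤ.- + K) (K + K)
      low x lt with abs-cases (h x)
      ... | inj₁ p = window⁺ (K + K) (K + ∣ h x ∣) (+-monoʳ-< K lt) (trans p (lemma (+ K) (+ ∣ h x ∣)))
        where
        lemma : ∀ k n → n ≡ ℤ.- k ℤ.+ (k ℤ.+ n)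
        lemma = solve-∀
      ... | inj₂ p = window⁺ (K + K) (K ∸ ∣ h x ∣) (≤-<-trans (m∸n≤m K ∣ h x ∣) (m<m+n K K>0))
            (trans p (trans (lemma (+ K) (+ ∣ h x ∣)) (cong (ℤ._+_ (ℤ.- + K)) (trans (ℤ.m-n≡m⊖n K ∣ h x ∣)
                (ℤ.⊖-≥ (<⇒≤ lt))))))
        where
        lemma : ∀ k n → ℤ.- n ≡ ℤ.- k ℤ.+ (k ℤ.- n)
        lemma = solve-∀

  slab : List (V G)
  slab = window 1ℤ t

  module Slab (N K : ℕ) (bounded : ∀ x → x ∈ slab → ∣ h x ∣ ≤ N) (N<K : N + 2 * s * t * t < K) where
    open Sides slab N K bounded N<K

    separates : Separates G slab
    separates = left , right , Left.infinite , Right.infinite , λ (_ , _ , _ , w) →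
      let (a , b , _ , _ , (_ , b∉ , e) , ha , hb) = exit {P = λ x → h x ℤ.≤ 0ℤ} w left≤0 right≰0 in crossing a b b∉ e ha hb (h b) refl
      where
      left≤0 : h left ℤ.≤ 0ℤ
      left≤0 = subst (ℤ._≤ 0ℤ) (sym (trans Left.h-origin (ℤ.-1*i≡-i (+ K)))) ℤ.neg-≤-pos
      right≰0 : ¬ h right ℤ.≤ 0ℤ
      right≰0 le = <⇒≱ {0} {K} K>0 (ℤ.drop‿+≤+ (subst (ℤ._≤ 0ℤ) (trans Right.h-origin (ℤ.*-identityˡ (+ K))) le))
      crossing : ∀ a b → b ∉ slab → E G a b → h a ℤ.≤ 0ℤ → ¬ h b ℤ.≤ 0ℤ → ∀ i → h b ≡ i → ⊥
      crossing a b b∉ e ha hb -[1+ j ] eq = hb (subst (ℤ._≤ 0ℤ) (sym eq) ℤ.-≤+)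
      crossing a b b∉ e ha hb (+ zero) eq = hb (ℤ.≤-reflexive eq)
      crossing a b b∉ e ha hb (+ suc j) eq = b∉ (window⁺ t j (ℤ.drop‿+≤+ (ℤ.≤-trans
        (subst (ℤ._≤ h a ℤ.+ + t) eq (abs-bound {h b} {h a} (edge-≤ e))) (ℤ.+-monoˡ-≤ (+ t) ha))) eq)

  module Lower (S : List (V G)) (N K : ℕ) (bounded : ∀ x → x ∈ S → ∣ h x ∣ ≤ N) (N<K : N + 2 * s * t * t < K)
               {u v : V G} (iu : InfiniteComponent G S u) (iv : InfiniteComponent G S v) (¬uv : ¬ ConnAvoid G S u v) where
    open Sides S N K bounded N<K

    -- `P` is the part of the lower component from height -K upwards. The expansion of the t full
    -- levels below -K together with `P` falls into `S` or `P`, so `P` cancels and the s t vertices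
    -- of these levels are left as a lower bound for `S`.
    size : s * t ≤ length S
    size = +-cancelʳ-≤ (length P) (s * t) (length S) (begin
      s * t + length P                 ≡⟨ cong (_+ length P) (trans (*-comm s t) (sym (window-length α t))) ⟩
      length (window α t) + length P   ≡⟨ length-++ (window α t) ⟨
      length (window α t ++ P)         ≤⟨ proj₁ (proj₂ (proj₂ expanded)) ⟩
      length M                         ≤⟨ length-⊆ (proj₁ (proj₂ expanded)) M-⊆ ⟩
      length (S ++ P)                  ≡⟨ length-++ S ⟩
      length S + length P              ∎)
      where
      open ≤-Reasoning
      C : V G → Set
      C = ConnAvoid G S left
      apart : ¬ C right
      apart lr with infinite-far iu | infinite-far iv
      ... | inj₁ p | inj₁ q = ¬uv (ConnAvoid-trans (ConnAvoid-sym p) q)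
      ... | inj₂ p | inj₂ q = ¬uv (ConnAvoid-trans (ConnAvoid-sym p) q)
      ... | inj₁ p | inj₂ q = ¬uv (ConnAvoid-trans (ConnAvoid-sym p) (ConnAvoid-trans lr q))
      ... | inj₂ p | inj₁ q = ¬uv (ConnAvoid-trans (ConnAvoid-sym p) (ConnAvoid-trans (ConnAvoid-sym lr) q))
      -- The lowest of the t levels just below -K. A rise by `t` from them ends at height -K or
      -- above, so no vertex of the expansion lands back in these levels.
      α : ℤ
      α = ℤ.- (+ K ℤ.+ + t)
      middle P A M : List (V G)
      middle = window (ℤ.- + K) (K + K)
      P = select C middle
      A = window α t ++ P
      P⁻ : ∀ {x} → x ∈ P → x ∈ middle × C x
      P⁻ {x} = ∈-select⁻ {P = C} {x} {middle}
      α+t : ∀ j → α ℤ.+ + j ℤ.+ + t ≡ ℤ.- + K ℤ.+ + j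
      α+t j = lemma (+ K) (+ t) (+ j)
        where
        lemma : ∀ k t j → ℤ.- (k ℤ.+ t) ℤ.+ j ℤ.+ t ≡ ℤ.- k ℤ.+ j
        lemma = solve-∀
      A-unique : Unique A
      A-unique = Unique.++⁺ (window-unique α t) (select-unique C (window-unique (ℤ.- + K) (K + K))) λ (p , q) →
        let (j , j<t , hj) = window⁻ t p ; (l , _ , hl) = window⁻ (K + K) (proj₁ (P⁻ q)) in
        <⇒≱ j<t (≤-trans (m≤n+m t l) (≤-reflexive (ℤ.+-injective (sym (linear {+ j} {+ (l + t)} (lemma (+ K)
            (+ t) (+ j) (+ l)) (trans (sym hj) hl))))))
        where
        lemma : ∀ k t j l → j ℤ.+ (ℤ.- k ℤ.+ l) ≡ l ℤ.+ t ℤ.+ (ℤ.- (k ℤ.+ t) ℤ.+ j)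
        lemma = solve-∀
      expanded : ∃[ M ] (Unique M × length A ≤ length M × (∀ w → w ∈ M → ∃[ u ] (u ∈ A × E G u w × h w ≡ h u ℤ.+ + t)))
      expanded = expansion A A-unique
      M = proj₁ expanded
      below : ∀ {x} j → j < t → h x ≡ α ℤ.+ + j → C x
      below {x} j j<t eq = ConnAvoid-sym (Left.to-origin (t ∸ j) (trans eq (trans (lemma (+ K) (+ t) (+ j))
          (trans (cong (λ z → ℤ.- (z ℤ.+ + K)) (trans (ℤ.m-n≡m⊖n t j) (ℤ.⊖-≥ (<⇒≤ j<t)))) (sym (ℤ.-1*i≡-i (+
              (t ∸ j + K))))))))
        where
        lemma : ∀ k t j → ℤ.- (k ℤ.+ t) ℤ.+ j ≡ ℤ.- (t ℤ.- j ℤ.+ k)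
        lemma = solve-∀
      in-middle : ∀ {w} j → C w → h w ≡ ℤ.- + K ℤ.+ + j → w ∈ P
      -- At height `K` or above `w` would be joined to `right`, which lies in a different component;
      -- so the truncation at `K` loses no vertex of the component from height -K upwards.
      in-middle {w} j c eq = ∈-select⁺ {P = C} (window⁺ (K + K) j (≰⇒> λ 2K≤j → apart (ConnAvoid-trans c
          (Right.to-origin (j ∸ (K + K))
          (trans eq (trans (cong (λ n → ℤ.- + K ℤ.+ + n) (sym (m∸n+n≡m 2K≤j))) (trans (lemma (+ K) (+ (j ∸
              (K + K)))) (sym (ℤ.*-identityˡ (+ (j ∸ (K + K) + K)))))))))) eq) c
        where
        lemma : ∀ k n → ℤ.- k ℤ.+ (n ℤ.+ (k ℤ.+ k)) ≡ n ℤ.+ k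
        lemma = solve-∀
      extend : ∀ {x w} → C x → E G x w → w ∉ S → C w
      extend (l∉ , x∉ , n , p) e w∉ = l∉ , w∉ , suc n , snocʷ p (x∉ , w∉ , e)
      M-⊆ : ∀ w → w ∈ M → w ∈ S ++ P
      M-⊆ w w∈ = let (x , x∈ , e , hw) = proj₂ (proj₂ (proj₂ expanded)) w w∈ in place em x∈ e hw
        where
        place : ∀ {x} → Dec (w ∈ S) → x ∈ A → E G x w → h w ≡ h x ℤ.+ + t → w ∈ S ++ P
        place (yes w∈S) _ _ _ = ∈-++⁺ˡ w∈S
        place (no w∉) x∈ e hw with ∈-++⁻ (window α t) x∈
        ... | inj₁ p = let (j , j<t , hx) = window⁻ t p in ∈-++⁺ʳ S (in-middle j (extend (below j j<t hx) e w∉)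
                (trans hw (trans (cong (ℤ._+ + t) hx) (α+t j))))
        ... | inj₂ p = let (j , _ , hx) = window⁻ (K + K) (proj₁ (P⁻ p)) in ∈-++⁺ʳ S (in-middle (j + t)
                (extend (proj₂ (P⁻ p)) e w∉)
                (trans hw (trans (cong (ℤ._+ + t) hx) (trans (ℤ.+-assoc (ℤ.- + K) (+ j) (+ t)) (cong (ℤ._+_
                    (ℤ.- + K)) (sym (ℤ.pos-+ j t)))))))

  kappa : KappaInfEq G (s * t)
  kappa = (slab , window-unique 1ℤ t , trans (window-length 1ℤ t) (*-comm t s) , Slab.separates N (suc
      (N + 2 * s * t * t)) bd ≤-refl) ,
    λ S _ (u , v , iu , iv , ¬uv) → let (M , b) = height-bound S in Lower.size S M (suc
            (M + 2 * s * t * t)) b ≤-refl iu iv ¬uv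
    where
    N = proj₁ (height-bound slab)
    bd = proj₂ (height-bound slab)

theorem3p1 : ExcludedMiddle 0ℓ →
    (G : Graph) → LocallyFinite G → Connected G → VertexTransitive G →
    TwoEnded G →
    ∃[ s ] ∃[ t ] (1 ≤ s × 1 ≤ t × Σ (CyclicSystem G) λ σ →
    RingLike G σ s t × Cohesive G σ (2 * s * t) × KappaInfEq G (s * t))
theorem3p1 em G lf conn vt te = s , HeightStructure.t HS , s≥1 , HeightStructure.t≥1 HS , system , ring-like , cohesive-system , kappa
  where
  HS : HeightStructure G
  -- Heights need some base point; the first vertex of a ray provides one.
  HS = Heights.heights em G lf conn vt (r (proj₁ te) 0)
         (Translations.shift-structure em G lf conn vt (Ends.cut em G lf conn te))
  open Levels em G lf conn vt HS using (s; s≥1)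
  open RingStructure em G lf conn vt HS
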